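{- For each $t \in \mathbb{Z}[\frac12]$ with $t>-1$ and all $G,H \in \widetilde{\mathbb{G}}$, the following hold: 1. If $G \geq H$, then $G_t \geq H_t$. 2. If $G \rhd\!| H$ (i.e. $G\not\le H$), then $G_t \rhd\!| H_t-t$ (i.e. $G_t\not\le H_t-t$).
   Context: Games. $\widetilde{\mathbb{G}}$ is the set of all formal (short, i.e. finite loopfree) normal-play partizan games $G=\{G^L\mid G^R\}$, where $G^L$ (resp. $G^R$) ranges over the finitely many Left (resp. Right) options of $G$; $\tilde b(G)$ is the formal birthday (height of the game tree). Sums and negatives of games are the usual ones; $G\ge 0$ means Left wins $G$ moving second under normal play, $G\ge H$ means $G-H\ge 0$, and $G$ is equal to $H$ (equality of game values) if $G\ge H$ and $H\ge G$. $G\rhd\!| H$ means $G\not\le H$. The dyadic rationals $\mathbb{Z}[\frac12]$ are identified in the usual way with the numbers among game values; "equal to an integer/number" means having such a game value. When a dyadic rational is used as a formal game, its canonical form is meant. Cooling and temperature. For $G\in\widetilde{\mathbb{G}}$ and $t\in\mathbb{Z}[\frac12]$, define $\lambda_t(G),\rho_t(G)\in\mathbb{Z}[\frac12]$, $G_t\in\widetilde{\mathbb{G}}$ and $t(G)\in\mathbb{Z}[\frac12]\cup\{ -\infty\}$ by recursion on $\tilde b(G)$ (this recursion is well-defined): - If $G$ is equal to an integer $n$: $\lambda_t(G)=\rho_t(G)=n$, $G_t=n$ (canonical form), $t(G)=-\infty$. - Otherwise let $\widetilde{\lambda}_t(G)=\max_{G^L}\{\rho_t(G^L)-t\}$, $\widetilde{\rho}_t(G)=\min_{G^R}\{\lambda_t(G^R)+t\}$,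 $\widetilde{G}_t=\{(G^L)_t-t\mid (G^R)_t+t\}$ (with all $G^L$, $G^R$), and $t(G)=\min\{t\in\mathbb{Z}[\frac12]\mid \widetilde{\lambda}_t(G)=\widetilde{\rho}_t(G)\}$. If $t\le t(G)$, set $\lambda_t(G)=\widetilde{\lambda}_t(G)$, $\rho_t(G)=\widetilde{\rho}_t(G)$, $G_t=\widetilde{G}_t$. If $t>t(G)$, set $\lambda_t(G)=\rho_t(G)=x$ and $G_t=x$ (canonical form), where $x=\lambda_{t(G)}(G)=\rho_{t(G)}(G)$. -}

module Defs where

open import Data.Empty using (⊥; ⊥-elim)
open import Data.Integer as ℤ using (ℤ; +_; -[1+_]; 0ℤ; -1ℤ)
import Data.Integer.DivMod as ℤ
import Data.Integer.Properties as ℤ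
open import Data.List using (List; []; _∷_; _++_; map)
open import Data.List.Membership.Propositional using (_∈_; mapWith∈; find; lose)
open import Data.List.Membership.Propositional.Properties
  using (∈-map⁺; ∈-map⁻; ∈-++⁺ˡ; ∈-++⁺ʳ; ∈-++⁻; mapWith∈-cong; mapWith∈≗map)
open import Data.List.Relation.Unary.All as All using (All; []; _∷_)
open import Data.List.Relation.Unary.Any as Any using (Any; here; there)
open import Data.Nat as ℕ using (ℕ; zero; suc; _^_)
import Data.Nat.Coprimality as Coprime
open import Data.Nat.Divisibility using (_∣_; divides; ∣1⇒≡1; *-cancelˡ-∣; _∣?_)
open import Data.Nat.Logarithm using (⌊log₂_⌋; ⌊log₂[2^n]⌋≡n)
import Data.Nat.Properties as ℕ
open import Data.Nat.Primality using (irreducible[2])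
open import Data.Product using (∃; _×_; _,_; proj₁; proj₂; swap)
open import Data.Rational as ℚ using (ℚ; mkℚ; ↥_; ↧_; ↧ₙ_; ½; 0ℚ; 1ℚ)
import Data.Rational.Properties as ℚ
import Data.Rational.Unnormalised as ℚᵘ
import Data.Rational.Unnormalised.Properties as ℚᵘ
open import Data.Rational.Solver using (module +-*-Solver)
open +-*-Solver using (solve; _:=_; _:+_; _:*_; _:-_; :-_; con)
open import Data.Sum using (_⊎_; inj₁; inj₂; [_,_]′)
open import Function using (_∘_; case_of_)
open import Relation.Binary.PropositionalEquality
open import Relation.Nullary using (¬_; Dec; yes; no; recompute; contradiction)
open import Relation.Nullary.Decidable using (decidable-stable; ¬?)
open import Relation.Nullary.Construct.Add.Infimum using (_₋; ⊥₋; [_])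

infixl 7 _*_
infixl 6 _+_ _-_
infix  8 -_
infix  4 _≤_ _<_

-- Rationals in ℚ are reduced, so the exponent and the irrelevant proof are
-- determined by the value and ℤ[½] embeds in ℚ.
record ℤ[½] : Set where
  constructor dyadic
  field
    value        : ℚ
    exponent     : ℕ
    .denominator : ↧ₙ value ≡ 2 ^ exponent

open ℤ[½] public using (value; exponent)

_≤_ _<_ : ℤ[½] → ℤ[½] → Set
x ≤ y = value x ℚ.≤ value y
x < y = value x ℚ.< value y

value-injective : ∀ {x y} → value x ≡ value y → x ≡ y
value-injective {dyadic q j p} {dyadic .q k p′} refl = same j≡k
  where
  p″ : ↧ₙ q ≡ 2 ^ j
  p″ = recompute (↧ₙ q ℕ.≟ 2 ^ j) p

  p‴ : ↧ₙ q ≡ 2 ^ k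
  p‴ = recompute (↧ₙ q ℕ.≟ 2 ^ k) p′

  j≡k : j ≡ k
  j≡k = trans (sym (⌊log₂[2^n]⌋≡n j))
          (trans (cong ⌊log₂_⌋ (trans (sym p″) p‴)) (⌊log₂[2^n]⌋≡n k))

  same : ∀ {k} .{p′ : ↧ₙ q ≡ 2 ^ k} → j ≡ k → dyadic q j p ≡ dyadic q k p′
  same refl = refl

∣2^⇒2^ : ∀ n {d} → d ∣ 2 ^ n → ∃ λ e → d ≡ 2 ^ e
∣2^⇒2^ zero d∣1 = 0 , ∣1⇒≡1 d∣1
∣2^⇒2^ (suc n) {d} d∣ with 2 ∣? d
... | yes (divides c refl) =
  let c∣ = *-cancelˡ-∣ {m = c} {n = 2 ^ n} 2 (subst (_∣ 2 ^ suc n) (ℕ.*-comm c 2) d∣)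
      e , c≡ = ∣2^⇒2^ n c∣
  in suc e , trans (ℕ.*-comm c 2) (cong (2 ℕ.*_) c≡)
... | no 2∤d = ∣2^⇒2^ n (Coprime.coprime-divisor coprime d∣)
  where
  coprime : Coprime.Coprime d 2
  coprime (e∣d , e∣2) with irreducible[2] e∣2
  ... | inj₁ e≡1  = e≡1
  ... | inj₂ refl = contradiction e∣d 2∤d

fromℚ : (q : ℚ) (n : ℕ) → .(↧ₙ q ∣ 2 ^ n) → ℤ[½]
fromℚ q n q∣ = dyadic q (proj₁ e,eq) (proj₂ e,eq)
  where
  e,eq : ∃ λ e → ↧ₙ q ≡ 2 ^ e
  e,eq = ∣2^⇒2^ n (recompute (↧ₙ q ∣? 2 ^ n) q∣)

private
  ↧ₙ-∣ : ∀ (x y : ℤ[½]) (r : ℚ) {g : ℤ} → ↧ r ℤ.* g ≡ ↧ value x ℤ.* ↧ value y →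
         ↧ₙ r ∣ 2 ^ (exponent x ℕ.+ exponent y)
  ↧ₙ-∣ (dyadic p j pj) (dyadic q k qk) r {g} eq = divides ℤ.∣ g ∣ (begin
    2 ^ (j ℕ.+ k)                ≡⟨ ℕ.^-distribˡ-+-* 2 j k ⟩
    2 ^ j ℕ.* 2 ^ k              ≡⟨ cong₂ ℕ._*_ (recompute (↧ₙ p ℕ.≟ 2 ^ j) pj) (recompute (↧ₙ q ℕ.≟ 2 ^ k) qk) ⟨
    ↧ₙ p ℕ.* ↧ₙ q                ≡⟨ ℤ.abs-* (↧ p) (↧ q) ⟨
    ℤ.∣ ↧ p ℤ.* ↧ q ∣            ≡⟨ cong ℤ.∣_∣ eq ⟨
    ℤ.∣ ↧ r ℤ.* g ∣              ≡⟨ ℤ.abs-* (↧ r) g ⟩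
    ↧ₙ r ℕ.* ℤ.∣ g ∣             ≡⟨ ℕ.*-comm (↧ₙ r) ℤ.∣ g ∣ ⟩
    ℤ.∣ g ∣ ℕ.* ↧ₙ r             ∎)
    where open ≡-Reasoning

_+_ : ℤ[½] → ℤ[½] → ℤ[½]
x + y = fromℚ (value x ℚ.+ value y) (exponent x ℕ.+ exponent y)
  (↧ₙ-∣ x y (value x ℚ.+ value y) (ℚ.↧-+ (value x) (value y)))

_*_ : ℤ[½] → ℤ[½] → ℤ[½]
x * y = fromℚ (value x ℚ.* value y) (exponent x ℕ.+ exponent y)
  (↧ₙ-∣ x y (value x ℚ.* value y) (ℚ.↧-* (value x) (value y)))

-_ : ℤ[½] → ℤ[½]
- dyadic q k q≡ = dyadic (ℚ.- q) k (trans (ℤ.+-injective (ℚ.↧-neg q)) q≡)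

_-_ : ℤ[½] → ℤ[½] → ℤ[½]
x - y = x + (- y)

fromℤ : ℤ → ℤ[½]
fromℤ n = dyadic (mkℚ n 0 (Coprime.sym (Coprime.1-coprimeTo ℤ.∣ n ∣))) 0 refl

½ᴰ : ℤ[½]
½ᴰ = dyadic ½ 1 refl

-- Finite sets of options are given by lists.  Reordering or repeating
-- options changes neither which player wins nor any λₜ, ρₜ or temperature.
data Game : Set where
  ⟨_∣_⟩ : (Gᴸ Gᴿ : List Game) → Game

lefts rights : Game → List Game
lefts  ⟨ L ∣ R ⟩ = L
rights ⟨ L ∣ R ⟩ = R

infixl 6 _+ᴳ_ _-ᴳ_
infix  8 -ᴳ_
infix  4 _≥ᴳ_ _≤ᴳ_ _≈ᴳ_ _⊳_

mutual
  -ᴳ_ : Game → Game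
  -ᴳ ⟨ L ∣ R ⟩ = ⟨ negs R ∣ negs L ⟩

  negs : List Game → List Game
  negs []       = []
  negs (X ∷ Xs) = -ᴳ X ∷ negs Xs

mutual
  _+ᴳ_ : Game → Game → Game
  G@(⟨ Gᴸ ∣ Gᴿ ⟩) +ᴳ H@(⟨ Hᴸ ∣ Hᴿ ⟩) =
    ⟨ Gᴸ +ˡ H ++ G +ʳ Hᴸ ∣ Gᴿ +ˡ H ++ G +ʳ Hᴿ ⟩

  _+ˡ_ : List Game → Game → List Game
  []       +ˡ H = []
  (X ∷ Xs) +ˡ H = X +ᴳ H ∷ Xs +ˡ H

  _+ʳ_ : Game → List Game → List Game
  G +ʳ []       = []
  G +ʳ (Y ∷ Ys) = G +ᴳ Y ∷ G +ʳ Ys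

_-ᴳ_ : Game → Game → Game
G -ᴳ H = G +ᴳ (-ᴳ H)

mutual
  data LeftWinsFirst (G : Game) : Set where
    move : Any LeftWinsSecond (lefts G) → LeftWinsFirst G

  data LeftWinsSecond (G : Game) : Set where
    replies : All LeftWinsFirst (rights G) → LeftWinsSecond G

_≥ᴳ_ _≤ᴳ_ _≈ᴳ_ _⊳_ : Game → Game → Set
G ≥ᴳ H = LeftWinsSecond (G -ᴳ H)
G ≤ᴳ H = H ≥ᴳ G
G ≈ᴳ H = G ≥ᴳ H × H ≥ᴳ G
G ⊳ H  = ¬ (G ≤ᴳ H)

natural : ℕ → Game
natural zero    = ⟨ [] ∣ [] ⟩
natural (suc n) = ⟨ natural n ∷ [] ∣ [] ⟩

integer : ℤ → Game
integer (+ n)            = natural n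
integer -[1+ zero ]      = ⟨ [] ∣ natural zero ∷ [] ⟩
integer -[1+ n@(suc m) ] = ⟨ [] ∣ integer -[1+ m ] ∷ [] ⟩

-- The canonical form of m / 2 ^ k: for odd m and k > 0 it is
-- { (m - 1) / 2 ^ k | (m + 1) / 2 ^ k }, and (m ± 1) / 2 is
-- m /ℕ 2 or its successor.
fraction : ℤ → ℕ → Game
fraction m zero = integer m
fraction m (suc k) with m ℤ.%ℕ 2
... | zero  = fraction (m ℤ./ℕ 2) k
... | suc _ = ⟨ fraction (m ℤ./ℕ 2) k ∷ [] ∣ fraction (ℤ.suc (m ℤ./ℕ 2)) k ∷ [] ⟩

⌜_⌝ : ℤ[½] → Game
⌜ x ⌝ = fraction (↥ value x) (exponent x)

IsInteger : Game → Set
IsInteger G = ∃ λ n → G ≈ᴳ integer n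

IsMax IsMin : (Game → ℤ[½]) → List Game → ℤ[½] → Set
IsMax f Xs m = (∃ λ X → X ∈ Xs × m ≡ f X) × (∀ {X} → X ∈ Xs → f X ≤ m)
IsMin f Xs m = (∃ λ X → X ∈ Xs × m ≡ f X) × (∀ {X} → X ∈ Xs → m ≤ f X)

IsLeast : (ℤ[½] → Set) → ℤ[½] → Set
IsLeast P t = P t × (∀ {s} → P s → t ≤ s)

-- The equations determine the four functions, by recursion on games; ⊥₋
-- is the temperature -∞.  The maximum and minimum over options do not
-- exist when there are no options, so they are relations: Isλ̃ t G x says
-- that the maximum of ρₜ t Gᴸ - t exists and equals x.
record Cooling : Set where
  field
    λₜ ρₜ       : ℤ[½] → Game → ℤ[½]
    cooled      : ℤ[½] → Game → Game
    temperature : Game → ℤ[½] ₋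

  Isλ̃ : ℤ[½] → Game → ℤ[½] → Set
  Isλ̃ t G = IsMax (λ Gᴸ → ρₜ t Gᴸ - t) (lefts G)

  Isρ̃ : ℤ[½] → Game → ℤ[½] → Set
  Isρ̃ t G = IsMin (λ Gᴿ → λₜ t Gᴿ + t) (rights G)

  pre-cooled : ℤ[½] → Game → Game
  pre-cooled t G = ⟨ map (λ Gᴸ → cooled t Gᴸ -ᴳ ⌜ t ⌝) (lefts G)
                   ∣ map (λ Gᴿ → cooled t Gᴿ +ᴳ ⌜ t ⌝) (rights G) ⟩

  λ̃≡ρ̃ : Game → ℤ[½] → Set
  λ̃≡ρ̃ G t = ∃ λ x → Isλ̃ t G x × Isρ̃ t G x

  field
    temperature-integer : ∀ {G} → IsInteger G → temperature G ≡ ⊥₋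
    λ-integer           : ∀ {G n} → G ≈ᴳ integer n → ∀ t → λₜ t G ≡ fromℤ n
    ρ-integer           : ∀ {G n} → G ≈ᴳ integer n → ∀ t → ρₜ t G ≡ fromℤ n
    cooled-integer      : ∀ {G n} → G ≈ᴳ integer n → ∀ t → cooled t G ≡ integer n

    temperature-least : ∀ {G} → ¬ IsInteger G → ∃ λ T → temperature G ≡ [ T ] × IsLeast (λ̃≡ρ̃ G) T

    λ-below      : ∀ {G T t} → temperature G ≡ [ T ] → t ≤ T → Isλ̃ t G (λₜ t G)
    ρ-below      : ∀ {G T t} → temperature G ≡ [ T ] → t ≤ T → Isρ̃ t G (ρₜ t G)
    cooled-below : ∀ {G T t} → temperature G ≡ [ T ] → t ≤ T → cooled t G ≡ pre-cooled t G

    λ-above      : ∀ {G T t} → temperature G ≡ [ T ] → T < t → λₜ t G ≡ λₜ T G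
    ρ-above      : ∀ {G T t} → temperature G ≡ [ T ] → T < t → ρₜ t G ≡ ρₜ T G
    cooled-above : ∀ {G T t} → temperature G ≡ [ T ] → T < t → cooled t G ≡ ⌜ λₜ T G ⌝

module GameOrder where

  negs≡map : ∀ Xs → negs Xs ≡ map -ᴳ_ Xs
  negs≡map []       = refl
  negs≡map (X ∷ Xs) = cong (-ᴳ X ∷_) (negs≡map Xs)

  +ˡ≡map : ∀ Xs H → Xs +ˡ H ≡ map (_+ᴳ H) Xs
  +ˡ≡map []       H = refl
  +ˡ≡map (X ∷ Xs) H = cong (X +ᴳ H ∷_) (+ˡ≡map Xs H)

  +ʳ≡map : ∀ G Ys → G +ʳ Ys ≡ map (G +ᴳ_) Ys
  +ʳ≡map G []       = refl
  +ʳ≡map G (Y ∷ Ys) = cong (G +ᴳ Y ∷_) (+ʳ≡map G Ys)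

  lefts-- : ∀ G H → lefts (G -ᴳ H) ≡ map (_-ᴳ H) (lefts G) ++ map (G +ᴳ_) (map -ᴳ_ (rights H))
  lefts-- G@(⟨ L ∣ _ ⟩) H@(⟨ _ ∣ R ⟩) =
    cong₂ _++_ (+ˡ≡map L (-ᴳ H)) (trans (+ʳ≡map G (negs R)) (cong (map (G +ᴳ_)) (negs≡map R)))

  rights-- : ∀ G H → rights (G -ᴳ H) ≡ map (_-ᴳ H) (rights G) ++ map (G +ᴳ_) (map -ᴳ_ (lefts H))
  rights-- G@(⟨ _ ∣ R ⟩) H@(⟨ L ∣ _ ⟩) =
    cong₂ _++_ (+ˡ≡map R (-ᴳ H)) (trans (+ʳ≡map G (negs L)) (cong (map (G +ᴳ_)) (negs≡map L)))

  first-left : ∀ {G H X} → X ∈ lefts G → X ≥ᴳ H → LeftWinsFirst (G -ᴳ H)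
  first-left {G} {H} X∈ X≥H =
    move (lose (subst (_ ∈_) (sym (lefts-- G H)) (∈-++⁺ˡ (∈-map⁺ (_-ᴳ H) X∈))) X≥H)

  first-right : ∀ {G H Y} → Y ∈ rights H → G ≥ᴳ Y → LeftWinsFirst (G -ᴳ H)
  first-right {G} {H} Y∈ G≥Y =
    move (lose (subst (_ ∈_) (sym (lefts-- G H))
      (∈-++⁺ʳ (map (_-ᴳ H) (lefts G)) (∈-map⁺ (G +ᴳ_) (∈-map⁺ -ᴳ_ Y∈)))) G≥Y)

  first-view : ∀ {G H} → LeftWinsFirst (G -ᴳ H) →
               (∃ λ X → X ∈ lefts G × X ≥ᴳ H) ⊎ (∃ λ Y → Y ∈ rights H × G ≥ᴳ Y)
  first-view {G} {H} (move m) with find m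
  ... | Z , Z∈ , wins with ∈-++⁻ (map (_-ᴳ H) (lefts G)) (subst (Z ∈_) (lefts-- G H) Z∈)
  ... | inj₁ Z∈₁ with ∈-map⁻ (_-ᴳ H) Z∈₁
  ... | X , X∈ , refl = inj₁ (X , X∈ , wins)
  first-view {G} {H} (move m) | Z , Z∈ , wins | inj₂ Z∈₂ with ∈-map⁻ (G +ᴳ_) Z∈₂
  ... | W , W∈ , refl with ∈-map⁻ -ᴳ_ W∈
  ... | Y , Y∈ , refl = inj₂ (Y , Y∈ , wins)

  second-right : ∀ {G H X} → G ≥ᴳ H → X ∈ rights G → LeftWinsFirst (X -ᴳ H)
  second-right {G} {H} (replies rs) X∈ =
    All.lookup rs (subst (_ ∈_) (sym (rights-- G H)) (∈-++⁺ˡ (∈-map⁺ (_-ᴳ H) X∈)))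

  second-left : ∀ {G H Y} → G ≥ᴳ H → Y ∈ lefts H → LeftWinsFirst (G -ᴳ Y)
  second-left {G} {H} (replies rs) Y∈ =
    All.lookup rs (subst (_ ∈_) (sym (rights-- G H))
      (∈-++⁺ʳ (map (_-ᴳ H) (rights G)) (∈-map⁺ (G +ᴳ_) (∈-map⁺ -ᴳ_ Y∈))))

  second-intro : ∀ {G H} → (∀ {X} → X ∈ rights G → LeftWinsFirst (X -ᴳ H)) →
                 (∀ {Y} → Y ∈ lefts H → LeftWinsFirst (G -ᴳ Y)) → G ≥ᴳ H
  second-intro {G} {H} f g = replies (All.tabulate λ Z∈ →
      [ (λ Z∈₁ → case ∈-map⁻ (_-ᴳ H) Z∈₁ of λ { (_ , X∈ , refl) → f X∈ })
      , (λ Z∈₂ → case ∈-map⁻ (G +ᴳ_) Z∈₂ of λ { (_ , W∈ , refl) →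
                 case ∈-map⁻ -ᴳ_ W∈ of λ { (_ , Y∈ , refl) → g Y∈ } })
      ]′ (∈-++⁻ (map (_-ᴳ H) (rights G)) (subst (_ ∈_) (rights-- G H) Z∈)))

  _≺_ : Game → Game → Set
  X ≺ G = X ∈ lefts G ⊎ X ∈ rights G

  module _ (P : Game → Set) (step : ∀ G → (∀ {X} → X ≺ G → P X) → P G) where
    mutual
      induction : ∀ G → P G
      induction ⟨ L ∣ R ⟩ = step ⟨ L ∣ R ⟩ [ All.lookup (inductions L) , All.lookup (inductions R) ]′

      inductions : ∀ Xs → All P Xs
      inductions []       = []
      inductions (X ∷ Xs) = induction X ∷ inductions Xs

  Both : (Game → Game → Set) → Game → Game → Set
  Both P G H = P G H × P H G

  induction₂ : ∀ (P : Game → Game → Set) →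
               (∀ G H → (∀ {X} → X ≺ G → Both P X H) → (∀ {Y} → Y ≺ H → Both P G Y) → P G H) →
               ∀ G H → Both P G H
  induction₂ P step = induction (λ G → ∀ H → Both P G H) λ G ihG → induction (Both P G) λ H ihH →
    step G H (λ X≺ → ihG X≺ H) ihH , step H G (λ Y≺ → swap (ihH Y≺)) (λ X≺ → swap (ihG X≺ H))

  first⇒⊳ : ∀ {G H} → LeftWinsFirst (G -ᴳ H) → G ⊳ H
  first⇒⊳ {G} {H} = proj₁ (induction₂ P step G H)
    where
    P : Game → Game → Set
    P G H = LeftWinsFirst (G -ᴳ H) → H ≥ᴳ G → ⊥

    step : ∀ G H → (∀ {X} → X ≺ G → Both P X H) → (∀ {Y} → Y ≺ H → Both P G Y) → P G H
    step G H ihG ihH w H≥G with first-view {G} {H} w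
    ... | inj₁ (X , X∈ , X≥H) = proj₂ (ihG (inj₁ X∈)) (second-left {H} {G} H≥G X∈) X≥H
    ... | inj₂ (Y , Y∈ , G≥Y) = proj₂ (ihH (inj₂ Y∈)) (second-right {H} {G} H≥G Y∈) G≥Y

  first-or-all : ∀ {P Q : Game → Set} Xs → (∀ {X} → X ∈ Xs → P X ⊎ Q X) →
                 (∃ λ X → X ∈ Xs × P X) ⊎ (∀ {X} → X ∈ Xs → Q X)
  first-or-all []       f = inj₂ λ ()
  first-or-all (X ∷ Xs) f with f (here refl) | first-or-all Xs (f ∘ there)
  ... | inj₁ p | _                  = inj₁ (X , here refl , p)
  ... | inj₂ _ | inj₁ (Y , Y∈ , p)  = inj₁ (Y , there Y∈ , p)
  ... | inj₂ q | inj₂ qs            = inj₂ λ { (here refl) → q ; (there Y∈) → qs Y∈ }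

  opaque
    determined : ∀ G H → LeftWinsFirst (G -ᴳ H) ⊎ H ≥ᴳ G
    determined G H = proj₁ (induction₂ P step G H)
      where
      P : Game → Game → Set
      P G H = LeftWinsFirst (G -ᴳ H) ⊎ H ≥ᴳ G

      flip⊎ : ∀ {A B : Set} → A ⊎ B → B ⊎ A
      flip⊎ (inj₁ a) = inj₂ a
      flip⊎ (inj₂ b) = inj₁ b

      step : ∀ G H → (∀ {X} → X ≺ G → Both P X H) → (∀ {Y} → Y ≺ H → Both P G Y) → P G H
      step G H ihG ihH
        with first-or-all (lefts G)  (λ X∈ → flip⊎ (proj₂ (ihG (inj₁ X∈))))
           | first-or-all (rights H) (λ Y∈ → flip⊎ (proj₂ (ihH (inj₂ Y∈))))
      ... | inj₁ (X , X∈ , X≥H) | _ = inj₁ (first-left {G} {H} X∈ X≥H)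
      ... | inj₂ _ | inj₁ (Y , Y∈ , G≥Y) = inj₁ (first-right {G} {H} Y∈ G≥Y)
      ... | inj₂ l | inj₂ r = inj₂ (second-intro {H} {G} r l)

  _≥?_ : ∀ G H → Dec (G ≥ᴳ H)
  G ≥? H with determined H G
  ... | inj₁ w   = no (first⇒⊳ {H} {G} w)
  ... | inj₂ G≥H = yes G≥H

  ⊳⇒first : ∀ {G H} → G ⊳ H → LeftWinsFirst (G -ᴳ H)
  ⊳⇒first {G} {H} G⊳H with determined G H
  ... | inj₁ w   = w
  ... | inj₂ H≥G = contradiction H≥G G⊳H

  ≥-intro : ∀ {G H} → (∀ {X} → X ∈ rights G → X ⊳ H) → (∀ {Y} → Y ∈ lefts H → G ⊳ Y) → G ≥ᴳ H
  ≥-intro {G} {H} f g = second-intro {G} {H}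
    (λ {X} X∈ → ⊳⇒first {X} {H} (f X∈)) (λ {Y} Y∈ → ⊳⇒first {G} {Y} (g Y∈))

  ≥-right : ∀ {G H X} → G ≥ᴳ H → X ∈ rights G → X ⊳ H
  ≥-right {G} {H} {X} G≥H X∈ = first⇒⊳ {X} {H} (second-right {G} {H} G≥H X∈)

  ≥-left : ∀ {G H Y} → G ≥ᴳ H → Y ∈ lefts H → G ⊳ Y
  ≥-left {G} {H} {Y} G≥H Y∈ = first⇒⊳ {G} {Y} (second-left {G} {H} G≥H Y∈)

  left-⊳ : ∀ {G H X} → X ∈ lefts G → X ≥ᴳ H → G ⊳ H
  left-⊳ {G} {H} X∈ X≥H H≥G = ≥-left {H} {G} H≥G X∈ X≥H

  right-⊳ : ∀ {G H Y} → Y ∈ rights H → G ≥ᴳ Y → G ⊳ H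
  right-⊳ {G} {H} Y∈ G≥Y H≥G = ≥-right {H} {G} H≥G Y∈ G≥Y

  ≥-refl : ∀ {G} → G ≥ᴳ G
  ≥-refl {G} = induction (λ G → G ≥ᴳ G)
    (λ G ih → ≥-intro {G} {G} (λ {X} X∈ → right-⊳ {X} {G} X∈ (ih (inj₂ X∈)))
                              (λ {Y} Y∈ → left-⊳ {G} {Y} Y∈ (ih (inj₁ Y∈)))) G

  ≥-trans : ∀ {G H K} → G ≥ᴳ H → H ≥ᴳ K → G ≥ᴳ K
  ≥-trans {G} {H} {K} = proj₁ (all G H K)
    where
    T Q : Game → Game → Game → Set
    T G H K = G ≥ᴳ H → H ≥ᴳ K → G ≥ᴳ K
    Q G H K = T G H K × T H K G × T K G H

    rotate : ∀ {G H K} → Q G H K → Q H K G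
    rotate (a , b , c) = b , c , a

    step : ∀ G H K → (∀ {X} → X ≺ G → Q X H K) → (∀ {X} → X ≺ K → Q G H X) → T G H K
    step G H K ihG ihK G≥H H≥K = ≥-intro {G} {K}
      (λ {X} X∈ K≥X → ≥-right {G} {H} G≥H X∈ (proj₁ (proj₂ (ihG (inj₂ X∈))) H≥K K≥X))
      (λ {X} X∈ X≥G → ≥-left {H} {K} H≥K X∈ (proj₂ (proj₂ (ihK (inj₁ X∈))) X≥G G≥H))

    all : ∀ G H K → Q G H K
    all = induction _ λ G ihG → induction _ λ H ihH → induction _ λ K ihK →
        step G H K (λ X≺ → ihG X≺ H K) ihK
      , step H K G (λ X≺ → rotate (ihH X≺ K)) (λ X≺ → rotate (ihG X≺ H K))
      , step K G H (λ X≺ → rotate (rotate (ihK X≺))) (λ X≺ → rotate (rotate (ihH X≺ K)))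

  data Step (n : ℤ) : Set where
    up   : lefts (integer (ℤ.suc n)) ≡ integer n ∷ [] → rights (integer (ℤ.suc n)) ≡ [] → Step n
    down : rights (integer n) ≡ integer (ℤ.suc n) ∷ [] → lefts (integer n) ≡ [] → Step n

  step : ∀ n → Step n
  step (+ n)          = up refl refl
  step -[1+ zero ]    = down refl refl
  step -[1+ suc n ]   = down refl refl

  integer-⊳ : ∀ n → integer (ℤ.suc n) ⊳ integer n
  integer-⊳ n with step n
  ... | up   L _ = left-⊳ {integer (ℤ.suc n)} {integer n} (subst (integer n ∈_) (sym L) (here refl)) (≥-refl {integer n})
  ... | down R _ = right-⊳ {integer (ℤ.suc n)} {integer n} (subst (integer (ℤ.suc n) ∈_) (sym R) (here refl)) (≥-refl {integer (ℤ.suc n)})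

  natural-suc : ∀ n → natural (suc n) ≥ᴳ natural n
  natural-suc zero    = ≥-intro {natural 1} {natural 0} (λ ()) (λ ())
  natural-suc (suc n) = ≥-intro {natural (2 ℕ.+ n)} {natural (suc n)} (λ ())
    (λ { (here refl) → left-⊳ {natural (2 ℕ.+ n)} {natural n} (here refl) (natural-suc n) })

  negative-suc : ∀ n → integer (ℤ.suc -[1+ n ]) ≥ᴳ integer -[1+ n ]
  negative-suc zero    = ≥-intro {natural 0} {integer -1ℤ} (λ ()) (λ ())
  negative-suc (suc n) = next n (negative-suc n)
    where
    next : ∀ n → integer (ℤ.suc -[1+ n ]) ≥ᴳ integer -[1+ n ] → integer -[1+ n ] ≥ᴳ integer -[1+ suc n ]
    next zero    ih = ≥-intro {integer -1ℤ} {integer -[1+ 1 ]}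
      (λ { (here refl) → right-⊳ {natural 0} {integer -[1+ 1 ]} (here refl) ih }) (λ ())
    next (suc n) ih = ≥-intro {integer -[1+ suc n ]} {integer -[1+ 2 ℕ.+ n ]}
      (λ { (here refl) → right-⊳ {integer -[1+ n ]} {integer -[1+ 2 ℕ.+ n ]} (here refl) ih }) (λ ())

  integer-suc : ∀ n → integer (ℤ.suc n) ≥ᴳ integer n
  integer-suc (+ n)    = natural-suc n
  integer-suc -[1+ n ] = negative-suc n

  ≤⇒+ : ∀ {m n} → m ℤ.≤ n → ∃ λ k → n ≡ + k ℤ.+ m
  ≤⇒+ {m} {n} m≤n with n ℤ.- m in eq | ℤ.i≤j⇒0≤j-i m≤n
  ... | + k | ℤ.+≤+ _ = k , (begin
    n                   ≡⟨ ℤ.+-identityʳ n ⟨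
    n ℤ.+ 0ℤ            ≡⟨ cong (λ i → n ℤ.+ i) (ℤ.+-inverseˡ m) ⟨
    n ℤ.+ (ℤ.- m ℤ.+ m) ≡⟨ ℤ.+-assoc n (ℤ.- m) m ⟨
    n ℤ.- m ℤ.+ m       ≡⟨ cong (ℤ._+ m) eq ⟩
    + k ℤ.+ m           ∎)
    where open ≡-Reasoning

  integer-mono : ∀ {m n} → m ℤ.≤ n → integer n ≥ᴳ integer m
  integer-mono {m} m≤n with ≤⇒+ m≤n
  ... | k , refl = go k
    where
    go : ∀ k → integer (+ k ℤ.+ m) ≥ᴳ integer m
    go zero    = subst (λ i → integer i ≥ᴳ integer m) (sym (ℤ.+-identityˡ m)) (≥-refl {integer m})
    go (suc k) = subst (λ i → integer i ≥ᴳ integer m) (sym (ℤ.+-assoc (+ 1) (+ k) m))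
      (≥-trans {integer (ℤ.suc (+ k ℤ.+ m))} {integer (+ k ℤ.+ m)} {integer m} (integer-suc (+ k ℤ.+ m)) (go k))

  integer-cancel : ∀ {m n} → integer n ≥ᴳ integer m → m ℤ.≤ n
  integer-cancel {m} {n} n≥m with m ℤ.≤? n
  ... | yes m≤n = m≤n
  ... | no  m≰n = contradiction
    (≥-trans {integer n} {integer m} {integer (ℤ.suc n)} n≥m (integer-mono (ℤ.i<j⇒suc[i]≤j (ℤ.≰⇒> m≰n))))
    (integer-⊳ n)

  -- An integer n fits G when no left option of G is ≥ n and no right
  -- option of G is ≤ n; a game fitted by some integer equals an integer.
  Fits : Game → ℤ → Set
  Fits G n = (∀ {X} → X ∈ lefts G → integer n ⊳ X) × (∀ {Y} → Y ∈ rights G → Y ⊳ integer n)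

  fits-natural : ∀ {G} n → Fits G (+ n) → IsInteger G
  fits-natural {G} zero (l , r) = 0ℤ ,
    ≥-intro {G} {natural 0} r (λ ()) , ≥-intro {natural 0} {G} (λ ()) l
  fits-natural {G} (suc k) (l , r) with natural k ≥? G
  ... | no  k≱G = + suc k ,
    ≥-intro {G} {natural (suc k)} r (λ { (here refl) → k≱G }) , ≥-intro {natural (suc k)} {G} (λ ()) l
  ... | yes k≥G = fits-natural {G} k
    ( (λ {X} X∈ X≥k → ≥-left {natural k} {G} k≥G X∈ X≥k)
    , (λ {Y} Y∈ k≥Y → r Y∈ (≥-trans {natural (suc k)} {natural k} {Y} (natural-suc k) k≥Y)))

  fits-negative : ∀ {G} k → Fits G -[1+ k ] → IsInteger G
  fits-negative {G} zero (l , r) with G ≥? natural 0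
  ... | no  G≱ = -1ℤ ,
    ≥-intro {G} {integer -1ℤ} r (λ ()) , ≥-intro {integer -1ℤ} {G} (λ { (here refl) → G≱ }) l
  ... | yes G≥ = fits-natural {G} 0
    ( (λ {X} X∈ X≥ → l X∈ (≥-trans {X} {natural 0} {integer -1ℤ} X≥ (negative-suc 0)))
    , (λ {Y} Y∈ → ≥-right {G} {natural 0} G≥ Y∈))
  fits-negative {G} (suc k) (l , r) with G ≥? integer -[1+ k ]
  ... | no  G≱ = -[1+ suc k ] ,
    ≥-intro {G} {integer -[1+ suc k ]} r (λ ()) , ≥-intro {integer -[1+ suc k ]} {G} (λ { (here refl) → G≱ }) l
  ... | yes G≥ = fits-negative {G} k
    ( (λ {X} X∈ X≥ → l X∈ (≥-trans {X} {integer -[1+ k ]} {integer -[1+ suc k ]} X≥ (negative-suc (suc k))))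
    , (λ {Y} Y∈ → ≥-right {G} {integer -[1+ k ]} G≥ Y∈))

  fits⇒IsInteger : ∀ {G n} → Fits G n → IsInteger G
  fits⇒IsInteger {G} {+ n}      = fits-natural {G} n
  fits⇒IsInteger {G} { -[1+ n ]} = fits-negative {G} n

  ≥-integer : ∀ {G n} → ¬ IsInteger G → (∀ {Y} → Y ∈ rights G → Y ⊳ integer n) → G ≥ᴳ integer n
  ≥-integer {G} {n} ¬int r with n ℤ.≤? 0ℤ
  ... | yes n≤0 = ≥-intro {G} {integer n} r (λ X∈ → case subst (_ ∈_) (none n n≤0) X∈ of λ ())
    where
    none : ∀ n → n ℤ.≤ 0ℤ → lefts (integer n) ≡ []
    none (+ zero)     _ = refl
    none -[1+ zero ]  _ = refl
    none -[1+ suc _ ] _ = refl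
    none (+ suc _) (ℤ.+≤+ ())
  ≥-integer {G} {+ zero}   ¬int r | no n≰0 = contradiction (ℤ.+≤+ ℕ.z≤n) n≰0
  ≥-integer {G} { -[1+ n ]} ¬int r | no n≰0 = contradiction ℤ.-≤+ n≰0
  ≥-integer {G} {+ suc k}  ¬int r | no _ = ≥-intro {G} {natural (suc k)} r
    (λ { (here refl) k≥G → ¬int (fits⇒IsInteger {G} {+ k}
      ( (λ {X} X∈ → ≥-left {natural k} {G} k≥G X∈)
      , (λ {Y} Y∈ k≥Y → r Y∈ (≥-trans {natural (suc k)} {natural k} {Y} (natural-suc k) k≥Y)))) })

  integer-≥ : ∀ {G n} → ¬ IsInteger G → (∀ {X} → X ∈ lefts G → integer n ⊳ X) → integer n ≥ᴳ G
  integer-≥ {G} {+ n} ¬int l = ≥-intro {natural n} {G} (λ Y∈ → case subst (_ ∈_) (none n) Y∈ of λ ()) l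
    where
    none : ∀ n → rights (natural n) ≡ []
    none zero    = refl
    none (suc _) = refl
  integer-≥ {G} { -[1+ k ]} ¬int l = ≥-intro {integer -[1+ k ]} {G}
    (λ Y∈ → case subst (_ ∈_) (one k) Y∈ of λ { (here refl) G≥ → ¬int (fits⇒IsInteger {G} {ℤ.suc -[1+ k ]}
      ( (λ {X} X∈ X≥ → l X∈ (≥-trans {X} {integer (ℤ.suc -[1+ k ])} {integer -[1+ k ]} X≥ (integer-suc -[1+ k ])))
      , (λ {Y} Y∈ → ≥-right {G} {integer (ℤ.suc -[1+ k ])} G≥ Y∈))) })
    l
    where
    one : ∀ k → rights (integer -[1+ k ]) ≡ integer (ℤ.suc -[1+ k ]) ∷ []
    one zero    = refl
    one (suc _) = refl

  opaque
    upper-bound : ∀ G → ∃ λ k → natural k ≥ᴳ G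
    upper-bound = induction _ λ G ih → bound G ih
      where
      bounds : ∀ Xs → (∀ {X} → X ∈ Xs → ∃ λ k → natural k ≥ᴳ X) → ∃ λ k → ∀ {X} → X ∈ Xs → natural k ≥ᴳ X
      bounds []       f = 0 , λ ()
      bounds (X ∷ Xs) f with f (here refl) | bounds Xs (f ∘ there)
      ... | k , k≥X | l , l≥ = k ℕ.+ l , λ
        { (here refl)    → ≥-trans {natural (k ℕ.+ l)} {natural k} {X} (integer-mono (ℤ.+≤+ (ℕ.m≤m+n k l))) k≥X
        ; {Y} (there Y∈) → ≥-trans {natural (k ℕ.+ l)} {natural l} {Y} (integer-mono (ℤ.+≤+ (ℕ.m≤n+m l k))) (l≥ Y∈) }

      bound : ∀ G → (∀ {X} → X ≺ G → ∃ λ k → natural k ≥ᴳ X) → ∃ λ k → natural k ≥ᴳ G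
      bound G ih with bounds (lefts G) (ih ∘ inj₁)
      ... | k , k≥ = suc k , ≥-intro {natural (suc k)} {G} (λ ())
        (λ {X} X∈ X≥ → integer-⊳ (+ k) (≥-trans {natural k} {X} {natural (suc k)} (k≥ X∈) X≥))

    lower-bound : ∀ G → ∃ λ k → G ≥ᴳ integer -[1+ k ]
    lower-bound = induction _ λ G ih → bound G ih
      where
      bounds : ∀ Xs → (∀ {X} → X ∈ Xs → ∃ λ k → X ≥ᴳ integer -[1+ k ]) →
               ∃ λ k → ∀ {X} → X ∈ Xs → X ≥ᴳ integer -[1+ k ]
      bounds []       f = 0 , λ ()
      bounds (X ∷ Xs) f with f (here refl) | bounds Xs (f ∘ there)
      ... | k , X≥k | l , ≥l = k ℕ.+ l , λ
        { (here refl)    → ≥-trans {X} {integer -[1+ k ]} {integer -[1+ k ℕ.+ l ]} X≥k (integer-mono (ℤ.-≤- (ℕ.m≤m+n k l)))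
        ; {Y} (there Y∈) → ≥-trans {Y} {integer -[1+ l ]} {integer -[1+ k ℕ.+ l ]} (≥l Y∈) (integer-mono (ℤ.-≤- (ℕ.m≤n+m l k))) }

      bound : ∀ G → (∀ {X} → X ≺ G → ∃ λ k → X ≥ᴳ integer -[1+ k ]) → ∃ λ k → G ≥ᴳ integer -[1+ k ]
      bound G ih with bounds (rights G) (ih ∘ inj₂)
      ... | k , ≥k = suc k , ≥-intro {G} {integer -[1+ suc k ]}
        (λ {Y} Y∈ ≥Y → integer-⊳ -[1+ suc k ] (≥-trans {integer -[1+ suc k ]} {Y} {integer -[1+ k ]} ≥Y (≥k Y∈)))
        (λ ())

  least : ∀ {P : ℕ → Set} → (∀ n → Dec (P n)) → ¬ P 0 → ∀ n → P n → ∃ λ m → ¬ P m × P (suc m)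
  least P? ¬p0 zero    p = contradiction p ¬p0
  least P? ¬p0 (suc n) p with P? n
  ... | yes pn = least P? ¬p0 n pn
  ... | no ¬pn = n , ¬pn , p

  record Rounding (G : Game) : Set where
    field
      ceiling floor : ℤ
      ceiling⁺ : integer ceiling ≥ᴳ G
      ceiling⁻ : ∀ {n} → integer n ≥ᴳ G → ceiling ℤ.≤ n
      floor⁺   : G ≥ᴳ integer floor
      floor⁻   : ∀ {n} → G ≥ᴳ integer n → n ℤ.≤ floor

  least-integer : ∀ {P : ℤ → Set} → (∀ n → Dec (P n)) → ∀ {a b} → a ℤ.≤ b → ¬ P a → P b →
                  ∃ λ n → ¬ P n × P (ℤ.suc n)
  least-integer {P} P? {a} a≤b ¬pa pb with ≤⇒+ a≤b
  ... | N , refl with least (λ n → P? (+ n ℤ.+ a)) (subst (¬_ ∘ P) (sym (ℤ.+-identityˡ a)) ¬pa) N pb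
  ... | m , ¬pm , psm = + m ℤ.+ a , ¬pm , subst P (ℤ.+-assoc (+ 1) (+ m) a) psm

  <suc⇒≤ : ∀ {i j : ℤ} → i ℤ.< ℤ.suc j → i ℤ.≤ j
  <suc⇒≤ {i} {j} i<sj = subst (i ℤ.≤_) (ℤ.pred-suc j) (ℤ.i<j⇒i≤pred[j] i<sj)

  opaque
    least-above : ∀ G → ∃ λ n → ¬ (integer n ≥ᴳ G) × integer (ℤ.suc n) ≥ᴳ G
    least-above G with upper-bound G | lower-bound G
    ... | k , k≥G | l , G≥l = least-integer (λ n → integer n ≥? G) { -[1+ suc l ] } {+ k} ℤ.-≤+
      (λ a≥G → integer-⊳ -[1+ suc l ] (≥-trans {integer -[1+ suc l ]} {G} {integer -[1+ l ]} a≥G G≥l)) k≥G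

    greatest-below : ∀ G → ∃ λ n → G ≥ᴳ integer n × ¬ (G ≥ᴳ integer (ℤ.suc n))
    greatest-below G with upper-bound G | lower-bound G
    ... | k , k≥G | l , G≥l with least-integer (λ n → ¬? (G ≥? integer n)) { -[1+ l ] } {+ suc k} ℤ.-≤+
      (λ G≱l → G≱l G≥l) (λ G≥ → integer-⊳ (+ k) (≥-trans {natural k} {G} {natural (suc k)} k≥G G≥))
    ... | n , ¬¬G≥n , G≱sn = n , decidable-stable (G ≥? integer n) ¬¬G≥n , G≱sn

  ceiling-least : ∀ {G m n} → ¬ (integer m ≥ᴳ G) → integer n ≥ᴳ G → ℤ.suc m ℤ.≤ n
  ceiling-least {G} {m} {n} m≱G n≥G = ℤ.≮⇒≥ (λ n<c → m≱G
    (≥-trans {integer m} {integer n} {G} (integer-mono {n} {m} (<suc⇒≤ {n} {m} n<c)) n≥G))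

  floor-greatest : ∀ {G j n} → ¬ (G ≥ᴳ integer (ℤ.suc j)) → G ≥ᴳ integer n → n ℤ.≤ j
  floor-greatest {G} {j} {n} G≱sj G≥n = ℤ.≮⇒≥ (λ j<n → G≱sj
    (≥-trans {G} {integer n} {integer (ℤ.suc j)} G≥n (integer-mono {ℤ.suc j} {n} (ℤ.i<j⇒suc[i]≤j {j} {n} j<n))))

  opaque
    rounding : ∀ G → Rounding G
    rounding G with least-above G | greatest-below G
    ... | m , m≱G , c≥G | j , G≥j , G≱sj = record
      { ceiling  = ℤ.suc m
      ; floor    = j
      ; ceiling⁺ = c≥G
      ; ceiling⁻ = λ {n} n≥G → ceiling-least {G} {m} {n} m≱G n≥G
      ; floor⁺   = G≥j
      ; floor⁻   = λ {n} G≥n → floor-greatest {G} {j} {n} G≱sj G≥n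
      }

  ceiling floor : Game → ℤ
  ceiling G = Rounding.ceiling (rounding G)
  floor   G = Rounding.floor   (rounding G)

  ≈-rounding : ∀ {G n} → G ≈ᴳ integer n → ceiling G ≡ n × floor G ≡ n
  ≈-rounding {G} {n} (G≥n , n≥G) =
      ℤ.≤-antisym (ceiling⁻ n≥G) (integer-cancel {n} {ceiling′} (≥-trans {integer ceiling′} {G} {integer n} ceiling⁺ G≥n))
    , ℤ.≤-antisym (integer-cancel {floor′} {n} (≥-trans {integer n} {G} {integer floor′} n≥G floor⁺)) (floor⁻ G≥n)
    where open Rounding (rounding G) renaming (ceiling to ceiling′; floor to floor′)

  integer? : ∀ G → Dec (IsInteger G)
  integer? G with G ≥? integer (ceiling G)
  ... | yes G≥ = yes (ceiling G , G≥ , Rounding.ceiling⁺ (rounding G))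
  ... | no  G≱ = no λ { (n , G≈n) → G≱ (subst (λ i → G ≥ᴳ integer i) (sym (proj₁ (≈-rounding {G} {n} G≈n))) (proj₁ G≈n)) }

  nonempty-lefts : ∀ {G} → ¬ IsInteger G → ∃ λ X → X ∈ lefts G
  nonempty-lefts {G} ¬int with lefts G in eq
  ... | X ∷ _ = X , here refl
  ... | []    with lower-bound G
  ... | k , G≥ = contradiction
    (fits⇒IsInteger {G} { -[1+ k ]} ((λ X∈ → case subst (_ ∈_) eq X∈ of λ ()) , λ {Y} Y∈ → ≥-right {G} {integer -[1+ k ]} G≥ Y∈)) ¬int

  nonempty-rights : ∀ {G} → ¬ IsInteger G → ∃ λ Y → Y ∈ rights G
  nonempty-rights {G} ¬int with rights G in eq
  ... | Y ∷ _ = Y , here refl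
  ... | []    with upper-bound G
  ... | k , ≥G = contradiction
    (fits⇒IsInteger {G} {+ k} ((λ {X} X∈ → ≥-left {natural k} {G} ≥G X∈) , λ Y∈ → case subst (_ ∈_) eq Y∈ of λ ())) ¬int

-- The recursion is well-defined because the minimum defining the
-- temperature of a non-integer exists.  Both λₜ and νₜ = - ρₜ are
-- nonincreasing and 1-Lipschitz in t and preserve some grid of multiples of
-- 1 / 2 ^ k, and the tilde versions likewise.  At t = -1 they are integers, namely
-- the least n ≥ G and minus the greatest n ≤ G, whence λ̃ₜ + ν̃ₜ > 0 there by
-- the simplicity theorem.  For large t this sum is ≤ 0, so it has a least zero.
module Existence where
  open GameOrder

  ι : ℤ → ℚ
  ι n = value (fromℤ n)

  ι-≤ : ∀ {i j} → i ℤ.≤ j → ι i ℚ.≤ ι j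
  ι-≤ i≤j = ℚ.*≤* (subst₂ ℤ._≤_ (sym (ℤ.*-identityʳ _)) (sym (ℤ.*-identityʳ _)) i≤j)

  ι-cancel-≤ : ∀ {i j} → ι i ℚ.≤ ι j → i ℤ.≤ j
  ι-cancel-≤ (ℚ.*≤* i≤j) = subst₂ ℤ._≤_ (ℤ.*-identityʳ _) (ℤ.*-identityʳ _) i≤j

  ι-+ : ∀ i j → ι (i ℤ.+ j) ≡ ι i ℚ.+ ι j
  ι-+ i j = ℚ.toℚᵘ-injective (ℚᵘ.≃-trans
    (ℚᵘ.*≡* (cong (ℤ._* + 1) (sym (cong₂ ℤ._+_ (ℤ.*-identityʳ i) (ℤ.*-identityʳ j)))))
    (ℚᵘ.≃-sym (ℚ.toℚᵘ-homo-+ (ι i) (ι j))))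

  ι-neg : ∀ i → ι (ℤ.- i) ≡ ℚ.- ι i
  ι-neg (+ zero)    = refl
  ι-neg (+ suc _)   = refl
  ι-neg -[1+ _ ]    = refl

  ℚ<⇒≱ : ∀ {p q} → p ℚ.< q → ¬ (q ℚ.≤ p)
  ℚ<⇒≱ p<q q≤p = ℚ.<-irrefl refl (ℚ.<-≤-trans p<q q≤p)

  lin≤ : ∀ {a b c d} → a ℚ.≤ b → d ℚ.- c ≡ b ℚ.- a → c ℚ.≤ d
  lin≤ {a} {b} {c} {d} a≤b eq = subst₂ ℚ._≤_
    (solve 2 (λ a c → c :+ (a :- a) := c) refl a c)
    (trans (cong (c ℚ.+_) (sym eq)) (solve 2 (λ c d → c :+ (d :- c) := d) refl c d))
    (ℚ.+-monoʳ-≤ c (ℚ.+-monoˡ-≤ (ℚ.- a) a≤b))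

  lin< : ∀ {a b c d} → a ℚ.< b → d ℚ.- c ≡ b ℚ.- a → c ℚ.< d
  lin< {a} {b} {c} {d} a<b eq = subst₂ ℚ._<_
    (solve 2 (λ a c → c :+ (a :- a) := c) refl a c)
    (trans (cong (c ℚ.+_) (sym eq)) (solve 2 (λ c d → c :+ (d :- c) := d) refl c d))
    (ℚ.+-monoʳ-< c (ℚ.+-monoˡ-< (ℚ.- a) a<b))

  archimedes : ∀ x → ∃ λ n → fromℤ (ℤ.- (+ n)) ≤ x
  archimedes x = go (value x)
    where
    go : ∀ q → ∃ λ n → ι (ℤ.- (+ n)) ℚ.≤ q
    go (mkℚ (+ n) d _)    = 0 , ℚ.*≤* (subst (0ℤ ℤ.≤_) (sym (ℤ.*-identityʳ (+ n))) (ℤ.+≤+ ℕ.z≤n))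
    go (mkℚ -[1+ n ] d _) = suc n , ℚ.*≤* (subst (-[1+ n ] ℤ.* + suc d ℤ.≤_) (sym (ℤ.*-identityʳ -[1+ n ]))
      (ℤ.-≤- (ℕ.≤-trans (ℕ.m≤m*n n (suc d)) (ℕ.m≤n+m _ d))))

  unit : ℕ → ℤ[½]
  unit zero    = fromℤ (+ 1)
  unit (suc k) = ½ᴰ * unit k

  h : ℕ → ℚ
  h k = value (unit k)

  h-positive : ∀ k → 0ℚ ℚ.< h k
  h-positive zero    = ℚ.*<* (ℤ.+<+ (ℕ.s≤s ℕ.z≤n))
  h-positive (suc k) = subst (ℚ._< h (suc k)) (ℚ.*-zeroʳ ½) (ℚ.*-monoʳ-<-pos ½ (h-positive k))

  h-≥0 : ∀ k → 0ℚ ℚ.≤ h k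
  h-≥0 k = ℚ.<⇒≤ (h-positive k)

  h-double : ∀ k → h k ≡ h (suc k) ℚ.+ h (suc k)
  h-double k = trans (sym (ℚ.*-identityˡ (h k))) (ℚ.*-distribʳ-+ (h k) ½ ½)

  ι-* : ∀ k {i j} → i ℤ.≤ j → ι i ℚ.* h k ℚ.≤ ι j ℚ.* h k
  ι-* k i≤j = ℚ.*-monoʳ-≤-nonNeg (h k) {{ℚ.nonNegative (h-≥0 k)}} (ι-≤ i≤j)

  Grid : ℕ → ℤ[½] → Set
  Grid k x = ∃ λ i → value x ≡ ι i ℚ.* h k

  grid-+ : ∀ k {x y} → Grid k x → Grid k y → Grid k (x + y)
  grid-+ k (i , p) (j , q) = i ℤ.+ j , trans (cong₂ ℚ._+_ p q)
    (trans (sym (ℚ.*-distribʳ-+ (h k) (ι i) (ι j))) (cong (ℚ._* h k) (sym (ι-+ i j))))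

  value-neg : ∀ x → value (- x) ≡ ℚ.- value x
  value-neg x = refl

  grid-neg : ∀ k {x} → Grid k x → Grid k (- x)
  grid-neg k {x} (i , p) = ℤ.- i , trans (value-neg x) (trans (cong ℚ.-_ p)
    (trans (ℚ.neg-distribˡ-* (ι i) (h k)) (cong (ℚ._* h k) (sym (ι-neg i)))))

  grid-unit : ∀ k → Grid k (unit k)
  grid-unit k = + 1 , sym (ℚ.*-identityˡ (h k))

  *-double : ∀ a b → a ℚ.* (b ℚ.+ b) ≡ (a ℚ.+ a) ℚ.* b
  *-double = solve 2 (λ a b → a :* (b :+ b) := (a :+ a) :* b) refl

  1+* : ∀ a b → (1ℚ ℚ.+ a) ℚ.* b ≡ a ℚ.* b ℚ.+ b
  1+* = solve 2 (λ a b → (con 1ℚ :+ a) :* b := a :* b :+ b) refl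

  double : ∀ k i → ι i ℚ.* h k ≡ ι (i ℤ.+ i) ℚ.* h (suc k)
  double k i = trans (cong (ι i ℚ.*_) (h-double k)) (trans
    (*-double (ι i) (h (suc k)))
    (cong (ℚ._* h (suc k)) (sym (ι-+ i i))))

  grid-suc : ∀ k {x} → Grid k x → Grid (suc k) x
  grid-suc k (i , p) = i ℤ.+ i , trans p (double k i)

  integer-grid : ∀ k n → Grid k (fromℤ n)
  integer-grid zero    n = n , sym (ℚ.*-identityʳ (ι n))
  integer-grid (suc k) n = grid-suc k {fromℤ n} (integer-grid k n)

  positive-gap : ∀ k {x} → Grid k x → 0ℚ ℚ.< value x → h k ℚ.≤ value x
  positive-gap k {x} (i , p) 0<x with i ℤ.≤? 0ℤ
  ... | yes i≤0 = contradiction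
    (subst₂ ℚ._≤_ (sym p) (ℚ.*-zeroˡ (h k)) (ι-* k i≤0)) (ℚ<⇒≱ 0<x)
  ... | no  i≰0 = subst₂ ℚ._≤_ (ℚ.*-identityˡ (h k)) (sym p) (ι-* k (ℤ.i<j⇒suc[i]≤j (ℤ.≰⇒> i≰0)))

  0<- : ∀ {a b} → a ℚ.< b → 0ℚ ℚ.< b ℚ.- a
  0<- {a} {b} a<b = lin< a<b (solve 2 (λ a b → b :- a :- con 0ℚ := b :- a) refl a b)

  ≤-⇒+≤ : ∀ {a b c} → c ℚ.≤ b ℚ.- a → a ℚ.+ c ℚ.≤ b
  ≤-⇒+≤ {a} {b} {c} c≤b-a = lin≤ c≤b-a (solve 3 (λ a b c → b :- (a :+ c) := b :- a :- c) refl a b c)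

  gap : ∀ k {x y} → Grid k x → Grid k y → x < y → value x ℚ.+ h k ℚ.≤ value y
  gap k {x} {y} gx gy x<y = ≤-⇒+≤ {value x} {value y} {h k}
    (positive-gap k {y - x} (grid-+ k {y} { - x} gy (grid-neg k {x} gx)) (0<- {value x} {value y} x<y))

  whole : ∀ k n → ∃ λ m → ι (+ n) ≡ ι (+ m) ℚ.* h k
  whole zero    n = n , sym (ℚ.*-identityʳ (ι (+ n)))
  whole (suc k) n with whole k n
  ... | m , p = m ℕ.+ m , trans p (double k (+ m))

  record Wall (k : ℕ) (f : ℤ[½] → ℤ[½]) : Set where
    field
      mono      : ∀ {s t} → s ≤ t → f t ≤ f s
      lipschitz : ∀ {s t} → s ≤ t → value (f s) ℚ.≤ value (f t) ℚ.+ (value t ℚ.- value s)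
      grid      : ∀ {t} → Grid k t → Grid k (f t)

  open Wall public

  parity : ∀ i → ∃ λ j → (i ≡ j ℤ.+ j) ⊎ (i ≡ ℤ.suc (j ℤ.+ j))
  parity i with i ℤ.%ℕ 2 | ℤ.n%ℕd<d i 2 | ℤ.a≡a%ℕn+[a/ℕn]*n i 2
  ... | 0           | _ | eq = i ℤ./ℕ 2 , inj₁ (trans eq (trans (ℤ.+-identityˡ _) (twice (i ℤ./ℕ 2))))
    where
    twice : ∀ j → j ℤ.* + 2 ≡ j ℤ.+ j
    twice j = trans (ℤ.*-distribˡ-+ j (+ 1) (+ 1)) (cong₂ ℤ._+_ (ℤ.*-identityʳ j) (ℤ.*-identityʳ j))
  ... | 1           | _ | eq = i ℤ./ℕ 2 , inj₂ (trans eq (cong ℤ.suc (twice (i ℤ./ℕ 2))))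
    where
    twice : ∀ j → j ℤ.* + 2 ≡ j ℤ.+ j
    twice j = trans (ℤ.*-distribˡ-+ j (+ 1) (+ 1)) (cong₂ ℤ._+_ (ℤ.*-identityʳ j) (ℤ.*-identityʳ j))
  ... | suc (suc _) | ℕ.s≤s (ℕ.s≤s ()) | _

  midpoint-≤ : ∀ {a t e} → 0ℚ ℚ.≤ e → t ≡ a ℚ.+ e → a ℚ.≤ t
  midpoint-≤ {a} {_} {e} 0≤e refl = lin≤ 0≤e (solve 2 (λ a e → a :+ e :- a := e :- con 0ℚ) refl a e)

  midpoint-- : ∀ {a t e} → t ≡ a ℚ.+ e → t ℚ.- a ≡ e
  midpoint-- {a} {_} {e} refl = solve 2 (λ a e → a :+ e :- a := e) refl a e

  midpoint-drop : ∀ {fa fb ft e} → fb ℚ.+ (e ℚ.+ e) ℚ.≤ fa → fa ℚ.≤ ft ℚ.+ e → fb ℚ.+ e ℚ.≤ ft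
  midpoint-drop {fa} {fb} {ft} {e} p q = lin≤ (ℚ.+-mono-≤ p q)
    (solve 4 (λ fa fb ft e → ft :- (fb :+ e) := fa :+ (ft :+ e) :- (fb :+ (e :+ e) :+ fa)) refl fa fb ft e)

  midpoint-grid : ∀ {k f} → Wall k f → ∀ {a b t} → Grid k a → Grid k b →
                  value t ≡ value a ℚ.+ h (suc k) → value b ≡ value t ℚ.+ h (suc k) → Grid (suc k) (f t)
  midpoint-grid {k} {f} w {a} {b} {t} ga gb t≡ b≡ with value (f b) ℚ.<? value (f a)
  ... | no fb≮fa = subst (Grid (suc k)) (value-injective {f b} {f t} (ℚ.≤-antisym
      (mono w {t} {b} (midpoint-≤ (h-≥0 (suc k)) b≡))
      (ℚ.≤-trans (mono w {a} {t} (midpoint-≤ (h-≥0 (suc k)) t≡)) (ℚ.≮⇒≥ fb≮fa))))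
    (grid-suc k {f b} (grid w {b} gb))
  ... | yes fb<fa = subst (Grid (suc k)) (value-injective {f b + unit (suc k)} {f t} (ℚ.≤-antisym
      (midpoint-drop {value (f a)} {value (f b)} {value (f t)} {h (suc k)}
        (subst (λ z → value (f b) ℚ.+ z ℚ.≤ value (f a)) (h-double k) (gap k {f b} {f a} (grid w {b} gb) (grid w {a} ga) fb<fa))
        (subst (λ z → value (f a) ℚ.≤ value (f t) ℚ.+ z) (midpoint-- t≡) (lipschitz w {a} {t} (midpoint-≤ (h-≥0 (suc k)) t≡))))
      (subst (λ z → value (f t) ℚ.≤ value (f b) ℚ.+ z) (midpoint-- b≡) (lipschitz w {t} {b} (midpoint-≤ (h-≥0 (suc k)) b≡)))))
    (grid-+ (suc k) {f b} {unit (suc k)} (grid-suc k {f b} (grid w {b} gb)) (grid-unit (suc k)))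

  wall-suc : ∀ {k f} → Wall k f → Wall (suc k) f
  wall-suc {k} {f} w = record { mono = mono w ; lipschitz = lipschitz w ; grid = λ {t} → refined t }
    where
    refined : ∀ t → Grid (suc k) t → Grid (suc k) (f t)
    refined t (i , p) with parity i
    ... | j , inj₁ refl = grid-suc k {f t} (grid w {t} (j , trans p (sym (double k j))))
    ... | j , inj₂ refl = midpoint-grid w {a} {a + unit k} {t} ga (grid-+ k {a} {unit k} ga (grid-unit k)) t≡
      (trans (cong (λ z → value a ℚ.+ z) (h-double k))
        (trans (sym (ℚ.+-assoc (value a) (h (suc k)) (h (suc k)))) (cong (ℚ._+ h (suc k)) (sym t≡))))
      where
      a : ℤ[½]
      a = fromℤ j * unit k

      ga : Grid k a
      ga = j , refl

      t≡ : value t ≡ value a ℚ.+ h (suc k)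
      t≡ = trans p (trans (cong (ℚ._* h (suc k)) (ι-+ (+ 1) (j ℤ.+ j)))
        (trans (1+* (ι (j ℤ.+ j)) (h (suc k))) (cong (ℚ._+ h (suc k)) (sym (double k j)))))

  wall-≤ : ∀ {k l f} → k ℕ.≤ l → Wall k f → Wall l f
  wall-≤ k≤l = go (ℕ.≤⇒≤′ k≤l)
    where
    go : ∀ {k l f} → k ℕ.≤′ l → Wall k f → Wall l f
    go (ℕ.≤′-reflexive refl) w = w
    go (ℕ.≤′-step k≤l)       w = wall-suc (go k≤l w)

  ≤-+ : ∀ n {s t} → s ℚ.≤ t → n ℚ.≤ n ℚ.+ (t ℚ.- s)
  ≤-+ n {s} {t} s≤t = lin≤ s≤t (solve 3 (λ n s t → n :+ (t :- s) :- n := t :- s) refl n s t)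

  wall-const : ∀ n → Wall 0 (λ _ → fromℤ n)
  wall-const n = record
    { mono      = λ _ → ℚ.≤-refl
    ; lipschitz = λ {s} {t} s≤t → ≤-+ (ι n) s≤t
    ; grid      = λ _ → integer-grid 0 n
    }

  Index : List Game → Set
  Index Xs = ∃ λ X → X ∈ Xs

  argmax : ∀ Xs (v : Index Xs → ℤ[½]) → Index Xs → ∃ λ i → ∀ j → v j ≤ v i
  argmax []            v (_ , ())
  argmax (X ∷ [])      v _ = (X , here refl) , λ { (_ , here refl) → ℚ.≤-refl }
  argmax (X ∷ Y ∷ Ys)  v _ with argmax (Y ∷ Ys) (λ { (Z , Z∈) → v (Z , there Z∈) }) (Y , here refl)
  ... | (Z , Z∈) , best with ℚ.≤-total (value (v (X , here refl))) (value (v (Z , there Z∈)))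
  ... | inj₁ X≤Z = (Z , there Z∈) , λ { (_ , here refl) → X≤Z ; (W , there W∈) → best (W , W∈) }
  ... | inj₂ Z≤X = (X , here refl) , λ { (_ , here refl) → ℚ.≤-refl ; (W , there W∈) → ℚ.≤-trans (best (W , W∈)) Z≤X }

  upper : ∀ Xs (n : Index Xs → ℕ) → ∃ λ N → ∀ i → n i ℕ.≤ N
  upper []       n = 0 , λ ()
  upper (X ∷ Xs) n with upper Xs (λ { (Y , Y∈) → n (Y , there Y∈) })
  ... | N , n≤N = n (X , here refl) ℕ.+ N , λ
    { (_ , here refl) → ℕ.m≤m+n _ N
    ; (Y , there Y∈)  → ℕ.≤-trans (n≤N (Y , Y∈)) (ℕ.m≤n+m N (n (X , here refl))) }

  shift-mono : ∀ {ws wt s t} → ws ℚ.≤ wt ℚ.+ (t ℚ.- s) → ℚ.- wt ℚ.- t ℚ.≤ ℚ.- ws ℚ.- s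
  shift-mono {ws} {wt} {s} {t} p = lin≤ p
    (solve 4 (λ ws wt s t → :- ws :- s :- (:- wt :- t) := wt :+ (t :- s) :- ws) refl ws wt s t)

  shift-lipschitz : ∀ {ws wt s t} → wt ℚ.≤ ws → ℚ.- ws ℚ.- s ℚ.≤ ℚ.- wt ℚ.- t ℚ.+ (t ℚ.- s)
  shift-lipschitz {ws} {wt} {s} {t} p = lin≤ p
    (solve 4 (λ ws wt s t → :- wt :- t :+ (t :- s) :- (:- ws :- s) := ws :- wt) refl ws wt s t)

  shift : (ℤ[½] → ℤ[½]) → ℤ[½] → ℤ[½]
  shift w t = - w t - t

  wall-shift : ∀ {k w} → Wall k w → Wall k (shift w)
  wall-shift {k} {w} wall = record
    { mono      = λ {s} {t} s≤t → shift-mono {value (w s)} {value (w t)} {value s} {value t} (lipschitz wall s≤t)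
    ; lipschitz = λ {s} {t} s≤t → shift-lipschitz {value (w s)} {value (w t)} {value s} {value t} (mono wall s≤t)
    ; grid      = λ {t} gt → grid-+ k { - w t} { - t} (grid-neg k {w t} (grid wall gt)) (grid-neg k {t} gt)
    }

  record Scaffold (Xs : List Game) (w : Index Xs → ℤ[½] → ℤ[½]) : Set where
    field
      f         : ℤ[½] → ℤ[½]
      attained  : ∀ t → ∃ λ i → f t ≡ shift (w i) t
      bound     : ∀ t i → shift (w i) t ≤ f t
      level top : ℕ
      wall      : Wall level f
      bounded   : ∀ t → value (f t) ℚ.+ value t ℚ.≤ ι (+ top)

  shift-bound : ∀ {l n w t} → ℚ.- n ℚ.≤ w → l ≡ ℚ.- w ℚ.- t → l ℚ.+ t ℚ.≤ n
  shift-bound {_} {n} {w} {t} p refl = lin≤ p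
    (solve 3 (λ n w t → n :- (:- w :- t :+ t) := w :- :- n) refl n w t)

  scaffold : ∀ {Xs w} → Index Xs → (k n : Index Xs → ℕ) → (∀ i → Wall (k i) (w i)) →
             (∀ i t → fromℤ (ℤ.- (+ n i)) ≤ w i t) → Scaffold Xs w
  scaffold {Xs} {w} i₀ k n walls low = record
    { f = f ; attained = λ t → proj₁ (best t) , refl ; bound = λ t → proj₂ (best t)
    ; level = K ; top = N
    ; wall = record
      { mono      = λ {s} {t} s≤t → ℚ.≤-trans (mono (walls′ (arg t)) s≤t) (proj₂ (best s) (arg t))
      ; lipschitz = λ {s} {t} s≤t → ℚ.≤-trans (lipschitz (walls′ (arg s)) s≤t)
                      (ℚ.+-monoˡ-≤ (value t ℚ.- value s) (proj₂ (best t) (arg s)))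
      ; grid      = λ {t} → grid (walls′ (arg t)) {t}
      }
    ; bounded = λ t → shift-bound {value (f t)} {ι (+ N)} {value (w (arg t) t)} {value t} (low′ (arg t) t) refl
    }
    where
    best : ∀ t → ∃ λ i → ∀ j → shift (w j) t ≤ shift (w i) t
    best t = argmax Xs (λ i → shift (w i) t) i₀

    arg : ℤ[½] → Index Xs
    arg t = proj₁ (best t)

    f : ℤ[½] → ℤ[½]
    f t = shift (w (arg t)) t

    K N : ℕ
    K = proj₁ (upper Xs k)
    N = proj₁ (upper Xs n)

    walls′ : ∀ i → Wall K (shift (w i))
    walls′ i = wall-shift (wall-≤ (proj₂ (upper Xs k) i) (walls i))

    low′ : ∀ i t → ℚ.- ι (+ N) ℚ.≤ value (w i t)
    low′ i t = subst (ℚ._≤ value (w i t)) (ι-neg (+ N))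
      (ℚ.≤-trans (ι-≤ (ℤ.neg-mono-≤ (ℤ.+≤+ (proj₂ (upper Xs n) i)))) (low i t))

  cross-positive : ∀ {fa fb fs gb gs a b s u} → fb ℚ.+ u ℚ.≤ fa → fa ℚ.≤ fs ℚ.+ (s ℚ.- a) → gb ℚ.≤ gs →
                   fb ℚ.+ gb ≡ 0ℚ → b ≡ a ℚ.+ u → s ℚ.< b → 0ℚ ℚ.< fs ℚ.+ gs
  cross-positive {fa} {fb} {fs} {gb} {gs} {a} {_} {s} {u} p q r z refl s<b =
    subst (ℚ._< fs ℚ.+ gs) z (lin< (ℚ.+-mono-<-≤ s<b (ℚ.+-mono-≤ p (ℚ.+-mono-≤ q r)))
      (solve 8 (λ fa fb fs gb gs a s u →
          fs :+ gs :- (fb :+ gb) := (a :+ u) :+ (fa :+ (fs :+ (s :- a) :+ gs)) :- (s :+ (fb :+ u :+ (fa :+ gb))))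
        refl fa fb fs gb gs a s u))

  middle-positive : ∀ {fa fs ga gs a t s e} → e ℚ.+ e ℚ.≤ fa ℚ.+ ga → fa ℚ.≤ fs ℚ.+ (s ℚ.- a) →
                    ga ℚ.≤ gs ℚ.+ (s ℚ.- a) → t ≡ a ℚ.+ e → s ℚ.< t → 0ℚ ℚ.< fs ℚ.+ gs
  middle-positive {fa} {fs} {ga} {gs} {a} {_} {s} {e} p q r refl s<t =
    lin< (ℚ.+-mono-<-≤ (ℚ.+-mono-< s<t s<t) (ℚ.+-mono-≤ p (ℚ.+-mono-≤ q r)))
      (solve 7 (λ fa fs ga gs a s e →
          fs :+ gs :- con 0ℚ := (a :+ e :+ (a :+ e)) :+ (fa :+ ga :+ (fs :+ (s :- a) :+ (gs :+ (s :- a))))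
                                  :- (s :+ s :+ (e :+ e :+ (fa :+ ga))))
        refl fa fs ga gs a s e)

  middle-≤0 : ∀ {fb ft gb gt e} → ft ℚ.≤ fb ℚ.+ e → gt ℚ.≤ gb ℚ.+ e → fb ℚ.+ gb ℚ.+ (e ℚ.+ e) ℚ.≤ 0ℚ → ft ℚ.+ gt ℚ.≤ 0ℚ
  middle-≤0 {fb} {ft} {gb} {gt} {e} p q r = lin≤ (ℚ.+-mono-≤ p (ℚ.+-mono-≤ q r))
    (solve 5 (λ fb ft gb gt e → con 0ℚ :- (ft :+ gt) :=
        fb :+ e :+ (gb :+ e :+ con 0ℚ) :- (ft :+ (gt :+ (fb :+ gb :+ (e :+ e))))) refl fb ft gb gt e)

  middle-≥0 : ∀ {fa ft ga gt e} → fa ℚ.≤ ft ℚ.+ e → ga ℚ.≤ gt ℚ.+ e → e ℚ.+ e ℚ.≤ fa ℚ.+ ga → 0ℚ ℚ.≤ ft ℚ.+ gt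
  middle-≥0 {fa} {ft} {ga} {gt} {e} p q r = lin≤ (ℚ.+-mono-≤ p (ℚ.+-mono-≤ q r))
    (solve 5 (λ fa ft ga gt e → ft :+ gt :- con 0ℚ :=
        ft :+ e :+ (gt :+ e :+ (fa :+ ga)) :- (fa :+ (ga :+ (e :+ e)))) refl fa ft ga gt e)

  record FirstZero (k : ℕ) (f g : ℤ[½] → ℤ[½]) (a : ℤ[½]) : Set where
    field
      T     : ℤ[½]
      onT   : Grid k T
      zeroT : value (f T) ℚ.+ value (g T) ≡ 0ℚ
      a≤T   : a ≤ T
      first : ∀ {s} → value (f s) ℚ.+ value (g s) ≡ 0ℚ → T ≤ s

  module _ {k f g} (wf : Wall k f) (wg : Wall k g) where

    private
      d : ℤ[½] → ℚ
      d t = value (f t) ℚ.+ value (g t)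

    d-mono : ∀ {s t} → s ≤ t → d t ℚ.≤ d s
    d-mono s≤t = ℚ.+-mono-≤ (mono wf s≤t) (mono wg s≤t)

    module _ {a b} (ga : Grid k a) (gb : Grid k b) (b≡ : value b ≡ value a ℚ.+ h k)
             (da : 0ℚ ℚ.< d a) (db : d b ℚ.≤ 0ℚ) where

      after-a : ∀ {s} → ¬ (0ℚ ℚ.< d s) → a < s
      after-a {s} ds = ℚ.≰⇒> (λ s≤a → ds (ℚ.<-≤-trans da (d-mono {s} {a} s≤a)))

      end-positive : d b ≡ 0ℚ → ∀ {s} → a < s → s < b → 0ℚ ℚ.< d s
      end-positive z {s} a<s s<b with value (f b) ℚ.<? value (f a) | value (g b) ℚ.<? value (g a)
      ... | yes fb<fa | _ = cross-positive {value (f a)} {value (f b)} {value (f s)} {value (g b)} {value (g s)} {value a} {value b} {value s} {h k}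
        (gap k {f b} {f a} (grid wf {b} gb) (grid wf {a} ga) fb<fa) (lipschitz wf {a} {s} (ℚ.<⇒≤ a<s)) (mono wg {s} {b} (ℚ.<⇒≤ s<b)) z b≡ s<b
      ... | no _ | yes gb<ga = subst (0ℚ ℚ.<_) (ℚ.+-comm (value (g s)) (value (f s))) (cross-positive {value (g a)} {value (g b)} {value (g s)} {value (f b)} {value (f s)} {value a} {value b} {value s} {h k}
        (gap k {g b} {g a} (grid wg {b} gb) (grid wg {a} ga) gb<ga) (lipschitz wg {a} {s} (ℚ.<⇒≤ a<s)) (mono wf {s} {b} (ℚ.<⇒≤ s<b))
        (trans (ℚ.+-comm (value (g b)) (value (f b))) z) b≡ s<b)
      ... | no fb≮fa | no gb≮ga = contradiction (ℚ.≤-trans (ℚ.+-mono-≤ (ℚ.≮⇒≥ fb≮fa) (ℚ.≮⇒≥ gb≮ga)) db) (ℚ<⇒≱ da)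

      zero⇒≮ : ∀ {s} → d s ≡ 0ℚ → ¬ (0ℚ ℚ.< d s)
      zero⇒≮ z 0<d = ℚ.<-irrefl (sym z) 0<d

      end-zero : d b ≡ 0ℚ → FirstZero (suc k) f g a
      end-zero z = record
        { T     = b
        ; onT   = grid-suc k {b} gb
        ; zeroT = z
        ; a≤T   = midpoint-≤ (h-≥0 k) b≡
        ; first = λ {s} zs → ℚ.≮⇒≥ (λ s<b → zero⇒≮ {s} zs (end-positive z {s} (after-a {s} (zero⇒≮ {s} zs)) s<b))
        }

      module _ {m} (m≡ : value m ≡ value a ℚ.+ h (suc k)) (gm : Grid (suc k) m) (db<0 : d b ℚ.< 0ℚ) where
        private
          ε = h (suc k)
          a≤m : a ≤ m
          a≤m = midpoint-≤ (h-≥0 (suc k)) m≡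

          b≡m : value b ≡ value m ℚ.+ ε
          b≡m = trans b≡ (trans (cong (λ z → value a ℚ.+ z) (h-double k))
            (trans (sym (ℚ.+-assoc (value a) ε ε)) (cong (ℚ._+ ε) (sym m≡))))

          m≤b : m ≤ b
          m≤b = midpoint-≤ (h-≥0 (suc k)) b≡m

          da≥ : ε ℚ.+ ε ℚ.≤ d a
          da≥ = subst (ℚ._≤ d a) (h-double k)
            (positive-gap k {f a + g a} (grid-+ k {f a} {g a} (grid wf {a} ga) (grid wg {a} ga)) da)

          db≤ : d b ℚ.+ (ε ℚ.+ ε) ℚ.≤ 0ℚ
          db≤ = subst (λ z → d b ℚ.+ z ℚ.≤ 0ℚ) (h-double k)
            (gap k {f b + g b} {fromℤ 0ℤ} (grid-+ k {f b} {g b} (grid wf {b} gb) (grid wg {b} gb)) (integer-grid k 0ℤ) db<0)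

          drop : ∀ {w} → Wall k w → ∀ {s t} → s ≤ t → value t ≡ value s ℚ.+ ε → value (w s) ℚ.≤ value (w t) ℚ.+ ε
          drop {w} ww {s} {t} s≤t t≡ = subst (λ z → value (w s) ℚ.≤ value (w t) ℚ.+ z) (midpoint-- t≡) (lipschitz ww {s} {t} s≤t)

        middle-zero : FirstZero (suc k) f g a
        middle-zero = record
          { T     = m
          ; onT   = gm
          ; zeroT = ℚ.≤-antisym
              (middle-≤0 {value (f b)} {value (f m)} {value (g b)} {value (g m)} {ε} (drop wf {m} {b} m≤b b≡m) (drop wg {m} {b} m≤b b≡m) db≤)
              (middle-≥0 {value (f a)} {value (f m)} {value (g a)} {value (g m)} {ε} (drop wf {a} {m} a≤m m≡) (drop wg {a} {m} a≤m m≡) da≥)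
          ; a≤T   = a≤m
          ; first = λ {s} zs → ℚ.≮⇒≥ (λ s<m → zero⇒≮ {s} zs
              (middle-positive {value (f a)} {value (f s)} {value (g a)} {value (g s)} {value a} {value m} {value s} {ε} da≥ (lipschitz wf {a} {s} (ℚ.<⇒≤ (after-a {s} (zero⇒≮ {s} zs))))
                (lipschitz wg {a} {s} (ℚ.<⇒≤ (after-a {s} (zero⇒≮ {s} zs)))) m≡ s<m))
          }

      zero-in-cell : FirstZero (suc k) f g a
      zero-in-cell with d b ℚ.≟ 0ℚ
      ... | yes z = end-zero z
      ... | no ¬z = middle-zero {a + unit (suc k)} refl
        (grid-+ (suc k) {a} {unit (suc k)} (grid-suc k {a} ga) (grid-unit (suc k)))
        (ℚ.≰⇒> (λ 0≤db → ¬z (ℚ.≤-antisym db 0≤db)))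

    private
      point : ℕ → ℤ[½]
      point n = fromℤ -1ℤ + fromℤ (+ n) * unit k

      point-0 : value (point 0) ≡ value (fromℤ -1ℤ)
      point-0 = trans (cong (λ z → ι -1ℤ ℚ.+ z) (ℚ.*-zeroˡ (h k))) (ℚ.+-identityʳ (ι -1ℤ))

      point-suc : ∀ n → value (point (suc n)) ≡ value (point n) ℚ.+ h k
      point-suc n = trans (cong (λ z → ι -1ℤ ℚ.+ z) (trans (cong (ℚ._* h k) (ι-+ (+ 1) (+ n))) (1+* (ι (+ n)) (h k))))
        (sym (ℚ.+-assoc (ι -1ℤ) (ι (+ n) ℚ.* h k) (h k)))

      point-grid : ∀ n → Grid k (point n)
      point-grid n = grid-+ k {fromℤ -1ℤ} {fromℤ (+ n) * unit k} (integer-grid k -1ℤ) (+ n , refl)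

      point-≥ : ∀ n → fromℤ -1ℤ ≤ point n
      point-≥ zero    = ℚ.≤-reflexive (sym point-0)
      point-≥ (suc n) = ℚ.≤-trans (point-≥ n) (midpoint-≤ (h-≥0 k) (point-suc n))

      both-≤0 : ∀ {x y t n} → x ℚ.+ t ℚ.≤ n → y ℚ.+ t ℚ.≤ n → t ≡ n → x ℚ.+ y ℚ.≤ 0ℚ
      both-≤0 {x} {y} {t} p q refl = lin≤ (ℚ.+-mono-≤ p q)
        (solve 3 (λ x y t → con 0ℚ :- (x :+ y) := t :+ t :- (x :+ t :+ (y :+ t))) refl x y t)

    first-zero : ∀ n → (∀ t → value (f t) ℚ.+ value t ℚ.≤ ι (+ n)) → (∀ t → value (g t) ℚ.+ value t ℚ.≤ ι (+ n)) →
                 0ℚ ℚ.< d (fromℤ -1ℤ) → FirstZero (suc k) f g (fromℤ -1ℤ)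
    first-zero n bf bg d₋₁ with whole k (suc n)
    ... | N , eq = conclude (least {λ m → d (point m) ℚ.≤ 0ℚ} (λ m → d (point m) ℚ.≤? 0ℚ) start N end)
      where
      start : ¬ (d (point 0) ℚ.≤ 0ℚ)
      start = subst (λ t → ¬ (d t ℚ.≤ 0ℚ)) (sym (value-injective {point 0} {fromℤ -1ℤ} point-0)) (ℚ<⇒≱ d₋₁)

      end : d (point N) ℚ.≤ 0ℚ
      end = both-≤0 {value (f (point N))} {value (g (point N))} {value (point N)} {ι (+ n)} (bf (point N)) (bg (point N)) (trans (cong (λ z → ι -1ℤ ℚ.+ z) (sym eq)) (sym (ι-+ -1ℤ (+ suc n))))

      conclude : (∃ λ m → ¬ (d (point m) ℚ.≤ 0ℚ) × d (point (suc m)) ℚ.≤ 0ℚ) → FirstZero (suc k) f g (fromℤ -1ℤ)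
      conclude (m , dm , dsm) = record
        { T = T ; onT = onT ; zeroT = zeroT ; first = first ; a≤T = ℚ.≤-trans (point-≥ m) a≤T }
        where
        open FirstZero (zero-in-cell {point m} {point (suc m)} (point-grid m) (point-grid (suc m)) (point-suc m) (ℚ.≰⇒> dm) dsm)

  clip : ℤ[½] → ℤ[½] → ℤ[½]
  clip T t with value t ℚ.≤? value T
  ... | yes _ = t
  ... | no  _ = T

  clip-below : ∀ {T t} → t ≤ T → clip T t ≡ t
  clip-below {T} {t} t≤T with value t ℚ.≤? value T
  ... | yes _   = refl
  ... | no  t≰T = contradiction t≤T t≰T

  clip-above : ∀ {T t} → T < t → clip T t ≡ T
  clip-above {T} {t} T<t with value t ℚ.≤? value T
  ... | yes t≤T = contradiction t≤T (ℚ<⇒≱ T<t)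
  ... | no  _   = refl

  clip-≤ : ∀ T t → clip T t ≤ T
  clip-≤ T t with value t ℚ.≤? value T
  ... | yes t≤T = t≤T
  ... | no  _   = ℚ.≤-refl

  clip-mono : ∀ T {s t} → s ≤ t → clip T s ≤ clip T t
  clip-mono T {s} {t} s≤t with value s ℚ.≤? value T | value t ℚ.≤? value T
  ... | yes _   | yes _   = s≤t
  ... | yes s≤T | no  _   = s≤T
  ... | no  s≰T | yes t≤T = contradiction (ℚ.≤-trans s≤t t≤T) s≰T
  ... | no  _   | no  _   = ℚ.≤-refl

  self-≤ : ∀ t {a b} → a ℚ.≤ b → t ℚ.- t ℚ.≤ b ℚ.- a
  self-≤ t {a} {b} a≤b = lin≤ a≤b (solve 3 (λ t a b → b :- a :- (t :- t) := b :- a) refl t a b)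

  clip-lipschitz : ∀ T {s t} → s ≤ t → value (clip T t) ℚ.- value (clip T s) ℚ.≤ value t ℚ.- value s
  clip-lipschitz T {s} {t} s≤t with value s ℚ.≤? value T | value t ℚ.≤? value T
  ... | yes _   | yes _   = ℚ.≤-refl
  ... | yes _   | no  t≰T = ℚ.+-monoˡ-≤ (ℚ.- value s) (ℚ.<⇒≤ (ℚ.≰⇒> t≰T))
  ... | no  s≰T | yes t≤T = contradiction (ℚ.≤-trans s≤t t≤T) s≰T
  ... | no  _   | no  _   = self-≤ (value T) s≤t

  clip-grid : ∀ {k T t} → Grid k T → Grid k t → Grid k (clip T t)
  clip-grid {k} {T} {t} gT gt with value t ℚ.≤? value T
  ... | yes _ = gt
  ... | no  _ = gT

  wall-clip : ∀ {k f T} → Grid k T → Wall k f → Wall k (f ∘ clip T)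
  wall-clip {k} {f} {T} gT w = record
    { mono      = λ {s} {t} s≤t → mono w (clip-mono T {s} {t} s≤t)
    ; lipschitz = λ {s} {t} s≤t → ℚ.≤-trans (lipschitz w (clip-mono T {s} {t} s≤t))
                    (ℚ.+-monoʳ-≤ (value (f (clip T t))) (clip-lipschitz T {s} {t} s≤t))
    ; grid      = λ {t} gt → grid w (clip-grid {k} {T} {t} gT gt)
    }

  record Thermograph (G : Game) : Set where
    field
      λ′ ν  : ℤ[½] → ℤ[½]
      cool  : ℤ[½] → Game
      temp  : ℤ[½] ₋
      level low : ℕ
      wall-λ  : Wall level λ′
      wall-ν  : Wall level ν
      low-λ   : ∀ t → fromℤ (ℤ.- (+ low)) ≤ λ′ t
      low-ν   : ∀ t → fromℤ (ℤ.- (+ low)) ≤ ν t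
      λ-at-−1 : λ′ (fromℤ -1ℤ) ≡ fromℤ (ceiling G)
      ν-at-−1 : ν (fromℤ -1ℤ) ≡ fromℤ (ℤ.- floor G)

  open Thermograph

  Options : Game → Set
  Options G = ∀ {X} → X ≺ G → Thermograph X

  left-wall : ∀ G → Options G → Index (lefts G) → ℤ[½] → ℤ[½]
  left-wall G sub i = ν (sub (inj₁ (proj₂ i)))

  right-wall : ∀ G → Options G → Index (rights G) → ℤ[½] → ℤ[½]
  right-wall G sub i = λ′ (sub (inj₂ (proj₂ i)))

  record Proper (G : Game) (sub : Options G) : Set where
    constructor proper
    field
      ¬integer : ¬ IsInteger G
      l : Scaffold (lefts G) (left-wall G sub)
      r : Scaffold (rights G) (right-wall G sub)
      k : ℕ
      l≤k : Scaffold.level l ℕ.≤ k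
      r≤k : Scaffold.level r ℕ.≤ k
      zero-of-sum : FirstZero (suc k) (Scaffold.f l) (Scaffold.f r) (fromℤ -1ℤ)

    module L = Scaffold l
    module R = Scaffold r
    open FirstZero zero-of-sum public

  data Shape (G : Game) (sub : Options G) : Set where
    constant : ∀ n → G ≈ᴳ integer n → Shape G sub
    nonconstant : Proper G sub → Shape G sub

  shift-integer : ∀ m → value (shift (λ _ → fromℤ m) (fromℤ -1ℤ)) ≡ ι (ℤ.suc (ℤ.- m))
  shift-integer m = trans (ℚ.+-comm (ℚ.- ι m) 1ℚ)
    (trans (cong (1ℚ ℚ.+_) (sym (ι-neg m))) (sym (ι-+ (+ 1) (ℤ.- m))))

  module _ {Xs w} (s : Scaffold Xs w) (m : Index Xs → ℤ) (w≡ : ∀ i → w i (fromℤ -1ℤ) ≡ fromℤ (m i)) where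
    open Scaffold s

    private
      shift≡ : ∀ i → value (shift (w i) (fromℤ -1ℤ)) ≡ ι (ℤ.suc (ℤ.- m i))
      shift≡ i = trans (cong (λ x → value (- x - fromℤ -1ℤ)) (w≡ i)) (shift-integer (m i))

    scaffold-at-−1 : ∃ λ i → f (fromℤ -1ℤ) ≡ fromℤ (ℤ.suc (ℤ.- m i)) × (∀ j → ℤ.suc (ℤ.- m j) ℤ.≤ ℤ.suc (ℤ.- m i))
    scaffold-at-−1 = i , value-injective {f (fromℤ -1ℤ)} {fromℤ (ℤ.suc (ℤ.- m i))} eq′ , λ j →
        ι-cancel-≤ {ℤ.suc (ℤ.- m j)} {ℤ.suc (ℤ.- m i)} (subst₂ ℚ._≤_ (shift≡ j) eq′ (bound (fromℤ -1ℤ) j))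
      where
      i : Index Xs
      i = proj₁ (attained (fromℤ -1ℤ))

      eq′ : value (f (fromℤ -1ℤ)) ≡ ι (ℤ.suc (ℤ.- m i))
      eq′ = trans (cong value (proj₂ (attained (fromℤ -1ℤ)))) (shift≡ i)

  floor-⊳ : ∀ {X n} → ℤ.suc (floor X) ℤ.≤ n → integer n ⊳ X
  floor-⊳ {X} {n} sf≤n X≥n = ℤ.≤⇒≯ (Rounding.floor⁻ (rounding X) {n} X≥n) (ℤ.suc[i]≤j⇒i<j {floor X} {n} sf≤n)

  ⊳-floor : ∀ {X n} → integer n ⊳ X → ℤ.suc (floor X) ℤ.≤ n
  ⊳-floor {X} {n} n⊳X = ℤ.i<j⇒suc[i]≤j {floor X} {n} (ℤ.≰⇒> (λ n≤f → n⊳X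
    (≥-trans {X} {integer (floor X)} {integer n} (Rounding.floor⁺ (rounding X)) (integer-mono {n} {floor X} n≤f))))

  ceiling-⊳ : ∀ {Y n} → ℤ.suc n ℤ.≤ ceiling Y → Y ⊳ integer n
  ceiling-⊳ {Y} {n} sn≤c n≥Y = ℤ.≤⇒≯ (Rounding.ceiling⁻ (rounding Y) {n} n≥Y) (ℤ.suc[i]≤j⇒i<j {n} {ceiling Y} sn≤c)

  ⊳-ceiling : ∀ {Y n} → Y ⊳ integer n → ℤ.suc n ℤ.≤ ceiling Y
  ⊳-ceiling {Y} {n} Y⊳n = ℤ.i<j⇒suc[i]≤j {n} {ceiling Y} (ℤ.≰⇒> (λ c≤n → Y⊳n
    (≥-trans {integer n} {integer (ceiling Y)} {Y} (integer-mono {ceiling Y} {n} c≤n) (Rounding.ceiling⁺ (rounding Y)))))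

  suc-neg-flip : ∀ {a b} → ℤ.suc (ℤ.- a) ℤ.≤ b → ℤ.suc (ℤ.- b) ℤ.≤ a
  suc-neg-flip {a} {b} p = ℤ.i<j⇒suc[i]≤j {ℤ.- b} {a}
    (subst (ℤ.- b ℤ.<_) (ℤ.neg-involutive a) (ℤ.neg-mono-< (ℤ.suc[i]≤j⇒i<j {ℤ.- a} {b} p)))

  module _ {G : Game} (sub : Options G) (¬int : ¬ IsInteger G)
           (l : Scaffold (lefts G) (left-wall G sub)) (r : Scaffold (rights G) (right-wall G sub)) where
    private
      module L = Scaffold l
      module R = Scaffold r

      lefts-at : ∃ λ i → L.f (fromℤ -1ℤ) ≡ fromℤ (ℤ.suc (ℤ.- (ℤ.- floor (proj₁ i)))) ×
                 (∀ j → ℤ.suc (ℤ.- (ℤ.- floor (proj₁ j))) ℤ.≤ ℤ.suc (ℤ.- (ℤ.- floor (proj₁ i))))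
      lefts-at = scaffold-at-−1 {w = left-wall G sub} l (λ i → ℤ.- floor (proj₁ i)) (λ i → ν-at-−1 (sub (inj₁ (proj₂ i))))

      rights-at : ∃ λ i → R.f (fromℤ -1ℤ) ≡ fromℤ (ℤ.suc (ℤ.- ceiling (proj₁ i))) ×
                  (∀ j → ℤ.suc (ℤ.- ceiling (proj₁ j)) ℤ.≤ ℤ.suc (ℤ.- ceiling (proj₁ i)))
      rights-at = scaffold-at-−1 {w = right-wall G sub} r (λ i → ceiling (proj₁ i)) (λ i → λ-at-−1 (sub (inj₂ (proj₂ i))))

      p q : ℤ
      p = ℤ.suc (ℤ.- (ℤ.- floor (proj₁ (proj₁ lefts-at))))
      q = ℤ.suc (ℤ.- ceiling (proj₁ (proj₁ rights-at)))

      left-bound : ∀ {X} → X ∈ lefts G → ℤ.suc (floor X) ℤ.≤ p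
      left-bound {X} X∈ = subst (λ i → ℤ.suc i ℤ.≤ p) (ℤ.neg-involutive (floor X)) (proj₂ (proj₂ lefts-at) (X , X∈))

      right-bound : ∀ {Y} → Y ∈ rights G → ℤ.suc (ℤ.- q) ℤ.≤ ceiling Y
      right-bound {Y} Y∈ = suc-neg-flip {ceiling Y} {q} (proj₂ (proj₂ rights-at) (Y , Y∈))

      p≡ceiling : p ≡ ceiling G
      p≡ceiling = ℤ.≤-antisym
        (subst (λ i → ℤ.suc i ℤ.≤ ceiling G) (sym (ℤ.neg-involutive (floor X)))
          (⊳-floor {X} {ceiling G} (≥-left {integer (ceiling G)} {G} {X} (Rounding.ceiling⁺ (rounding G)) (proj₂ (proj₁ lefts-at)))))
        (Rounding.ceiling⁻ (rounding G) {p} (integer-≥ {G} {p} ¬int (λ {X} X∈ → floor-⊳ {X} {p} (left-bound X∈))))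
        where
        X : Game
        X = proj₁ (proj₁ lefts-at)

      q≡-floor : q ≡ ℤ.- floor G
      q≡-floor = ℤ.≤-antisym
        (subst₂ ℤ._≤_ (ℤ.neg-involutive q) refl (ℤ.neg-mono-≤ q-≤))
        (subst₂ ℤ._≤_ refl (ℤ.neg-involutive q) (ℤ.neg-mono-≤ -q≤))
        where
        Y : Game
        Y = proj₁ (proj₁ rights-at)

        -q≤ : ℤ.- q ℤ.≤ floor G
        -q≤ = Rounding.floor⁻ (rounding G) {ℤ.- q}
          (≥-integer {G} {ℤ.- q} ¬int (λ {Y} Y∈ → ceiling-⊳ {Y} {ℤ.- q} (right-bound Y∈)))

        q-≤ : floor G ℤ.≤ ℤ.- q
        q-≤ = subst (floor G ℤ.≤_) (lemma (ceiling Y)) (ℤ.i<j⇒i≤pred[j] (ℤ.suc[i]≤j⇒i<j {floor G} {ceiling Y}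
          (⊳-ceiling {Y} {floor G} (≥-right {G} {integer (floor G)} {Y} (Rounding.floor⁺ (rounding G)) (proj₂ (proj₁ rights-at))))))
          where
          lemma : ∀ c → ℤ.pred c ≡ ℤ.- ℤ.suc (ℤ.- c)
          lemma c = sym (trans (ℤ.neg-distrib-+ (+ 1) (ℤ.- c)) (cong ℤ.pred (ℤ.neg-involutive c)))

    left-at-−1 : L.f (fromℤ -1ℤ) ≡ fromℤ (ceiling G)
    left-at-−1 = trans (proj₁ (proj₂ lefts-at)) (cong fromℤ p≡ceiling)

    right-at-−1 : R.f (fromℤ -1ℤ) ≡ fromℤ (ℤ.- floor G)
    right-at-−1 = trans (proj₁ (proj₂ rights-at)) (cong fromℤ q≡-floor)

    positive-at-−1 : 0ℚ ℚ.< value (L.f (fromℤ -1ℤ)) ℚ.+ value (R.f (fromℤ -1ℤ))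
    positive-at-−1 = ℚ.≰⇒> λ ≤0 → ¬int (fits⇒IsInteger {G} {p}
      ( (λ {X} X∈ → floor-⊳ {X} {p} (left-bound X∈))
      , (λ {Y} Y∈ → ceiling-⊳ {Y} {p} (ℤ.≤-trans (ℤ.+-monoʳ-≤ (+ 1) (p≤-q ≤0)) (right-bound Y∈)))))
      where
      p≤-q : value (L.f (fromℤ -1ℤ)) ℚ.+ value (R.f (fromℤ -1ℤ)) ℚ.≤ 0ℚ → p ℤ.≤ ℤ.- q
      p≤-q ≤0 = subst (ℤ._≤ ℤ.- q) (p+q-q p q) (subst (p ℤ.+ q ℤ.- q ℤ.≤_) (ℤ.+-identityˡ (ℤ.- q))
        (ℤ.+-monoˡ-≤ (ℤ.- q) (ι-cancel-≤ {p ℤ.+ q} {0ℤ} (subst (ℚ._≤ 0ℚ)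
          (trans (cong₂ (λ x y → value x ℚ.+ value y) (proj₁ (proj₂ lefts-at)) (proj₁ (proj₂ rights-at))) (sym (ι-+ p q))) ≤0))))
        where
        p+q-q : ∀ p q → p ℤ.+ q ℤ.- q ≡ p
        p+q-q p q = trans (ℤ.+-assoc p q (ℤ.- q)) (trans (cong (λ i → p ℤ.+ i) (ℤ.+-inverseʳ q)) (ℤ.+-identityʳ p))

  bounded-≤ : ∀ {m n x} → m ℕ.≤ n → x ℚ.≤ ι (+ m) → x ℚ.≤ ι (+ n)
  bounded-≤ m≤n x≤m = ℚ.≤-trans x≤m (ι-≤ (ℤ.+≤+ m≤n))

  opaque
    shape : ∀ G (sub : Options G) → Shape G sub
    shape G sub with integer? G
    ... | yes (n , G≈n) = constant n G≈n
    ... | no  ¬int      = nonconstant (proper ¬int l r (L.level ℕ.⊔ R.level) (ℕ.m≤m⊔n L.level R.level) (ℕ.m≤n⊔m L.level R.level)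
      (first-zero (wall-≤ (ℕ.m≤m⊔n L.level R.level) L.wall) (wall-≤ (ℕ.m≤n⊔m L.level R.level) R.wall)
        (L.top ℕ.⊔ R.top)
        (λ t → bounded-≤ (ℕ.m≤m⊔n L.top R.top) (L.bounded t))
        (λ t → bounded-≤ (ℕ.m≤n⊔m L.top R.top) (R.bounded t))
        (positive-at-−1 {G} sub ¬int l r)))
      where
      l : Scaffold (lefts G) (left-wall G sub)
      l = scaffold (nonempty-lefts {G} ¬int) (λ (_ , X∈) → level (sub (inj₁ X∈))) (λ (_ , X∈) → low (sub (inj₁ X∈)))
            (λ (_ , X∈) → wall-ν (sub (inj₁ X∈))) (λ (_ , X∈) → low-ν (sub (inj₁ X∈)))

      r : Scaffold (rights G) (right-wall G sub)
      r = scaffold (nonempty-rights {G} ¬int) (λ (_ , Y∈) → level (sub (inj₂ Y∈))) (λ (_ , Y∈) → low (sub (inj₂ Y∈)))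
            (λ (_ , Y∈) → wall-λ (sub (inj₂ Y∈))) (λ (_ , Y∈) → low-λ (sub (inj₂ Y∈)))

      module L = Scaffold l
      module R = Scaffold r

  lower-≤ : ∀ {m n x} → m ℕ.≤ n → fromℤ (ℤ.- (+ m)) ≤ x → fromℤ (ℤ.- (+ n)) ≤ x
  lower-≤ m≤n m≤x = ℚ.≤-trans (ι-≤ (ℤ.neg-mono-≤ (ℤ.+≤+ m≤n))) m≤x

  clipped-low : ∀ {k f} → Wall k f → ∀ T t {n} → fromℤ (ℤ.- (+ n)) ≤ f T → fromℤ (ℤ.- (+ n)) ≤ f (clip T t)
  clipped-low w T t n≤ = ℚ.≤-trans n≤ (mono w {clip T t} {T} (clip-≤ T t))

  cool-proper : ∀ G (sub : Options G) → Proper G sub → ℤ[½] → Game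
  cool-proper G sub c t with value t ℚ.≤? value (Proper.T c)
  ... | yes _ = ⟨ mapWith∈ (lefts G)  (λ X∈ → cool (sub (inj₁ X∈)) t -ᴳ ⌜ t ⌝)
                ∣ mapWith∈ (rights G) (λ Y∈ → cool (sub (inj₂ Y∈)) t +ᴳ ⌜ t ⌝) ⟩
  ... | no  _ = ⌜ Proper.L.f c (Proper.T c) ⌝

  thermograph : ∀ G (sub : Options G) → Shape G sub → Thermograph G
  thermograph G sub (constant n G≈n) = record
    { λ′      = λ _ → fromℤ n
    ; ν       = λ _ → fromℤ (ℤ.- n)
    ; cool    = λ _ → integer n
    ; temp    = ⊥₋
    ; level   = 0
    ; low     = ℤ.∣ n ∣
    ; wall-λ  = wall-const n
    ; wall-ν  = wall-const (ℤ.- n)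
    ; low-λ   = λ _ → ι-≤ (-∣∣≤ n)
    ; low-ν   = λ _ → ι-≤ (subst (λ i → ℤ.- (+ i) ℤ.≤ ℤ.- n) (ℤ.∣-i∣≡∣i∣ n) (-∣∣≤ (ℤ.- n)))
    ; λ-at-−1 = cong fromℤ (sym (proj₁ (≈-rounding {G} {n} G≈n)))
    ; ν-at-−1 = cong (fromℤ ∘ ℤ.-_) (sym (proj₂ (≈-rounding {G} {n} G≈n)))
    }
    where
    -∣∣≤ : ∀ i → ℤ.- (+ ℤ.∣ i ∣) ℤ.≤ i
    -∣∣≤ (+ zero)  = ℤ.≤-refl
    -∣∣≤ (+ suc _) = ℤ.-≤+
    -∣∣≤ -[1+ _ ]  = ℤ.≤-refl
  thermograph G sub (nonconstant c) = record
    { λ′      = L.f ∘ clip T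
    ; ν       = R.f ∘ clip T
    ; cool    = cool-proper G sub c
    ; temp    = [ T ]
    ; level   = suc k
    ; low     = proj₁ lowˡ ℕ.⊔ proj₁ lowʳ
    ; wall-λ  = wall-clip onT (wall-suc (wall-≤ l≤k L.wall))
    ; wall-ν  = wall-clip onT (wall-suc (wall-≤ r≤k R.wall))
    ; low-λ   = λ t → clipped-low L.wall T t {proj₁ lowˡ ℕ.⊔ proj₁ lowʳ}
                  (lower-≤ {x = L.f T} (ℕ.m≤m⊔n (proj₁ lowˡ) (proj₁ lowʳ)) (proj₂ lowˡ))
    ; low-ν   = λ t → clipped-low R.wall T t {proj₁ lowˡ ℕ.⊔ proj₁ lowʳ}
                  (lower-≤ {x = R.f T} (ℕ.m≤n⊔m (proj₁ lowˡ) (proj₁ lowʳ)) (proj₂ lowʳ))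
    ; λ-at-−1 = trans (cong L.f (clip-below {T} {fromℤ -1ℤ} a≤T)) (left-at-−1 {G} sub ¬integer l r)
    ; ν-at-−1 = trans (cong R.f (clip-below {T} {fromℤ -1ℤ} a≤T)) (right-at-−1 {G} sub ¬integer l r)
    }
    where
    open Proper c

    lowˡ : ∃ λ n → fromℤ (ℤ.- (+ n)) ≤ L.f T
    lowˡ = archimedes (L.f T)

    lowʳ : ∃ λ n → fromℤ (ℤ.- (+ n)) ≤ R.f T
    lowʳ = archimedes (R.f T)

  grow : ∀ G → Options G → Thermograph G
  grow G sub = thermograph G sub (shape G sub)

  build : ∀ G → Thermograph G
  build = induction Thermograph grow

  options : ∀ G → Options G
  options ⟨ L ∣ R ⟩ = [ All.lookup (inductions Thermograph grow L) , All.lookup (inductions Thermograph grow R) ]′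

  build-unfold : ∀ G → build G ≡ grow G (options G)
  build-unfold ⟨ L ∣ R ⟩ = refl

  options≡build : ∀ G {X} (X≺ : X ≺ G) → options G X≺ ≡ build X
  options≡build ⟨ L ∣ R ⟩ = λ { (inj₁ X∈) → lookup≡ L X∈ ; (inj₂ X∈) → lookup≡ R X∈ }
    where
    lookup≡ : ∀ Xs {X} (X∈ : X ∈ Xs) →
              All.lookup (inductions Thermograph grow Xs) X∈ ≡ build X
    lookup≡ (_ ∷ _)  (here refl) = refl
    lookup≡ (_ ∷ Xs) (there X∈)  = lookup≡ Xs X∈

  module _ (G : Game) where
    private
      λᴮ ρᴮ : ℤ[½] → Game → ℤ[½]
      λᴮ t X = λ′ (build X) t
      ρᴮ t X = - ν (build X) t

      Left Right : ℤ[½] → ℤ[½] → Set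
      Left  t = IsMax (λ X → ρᴮ t X - t) (lefts G)
      Right t = IsMin (λ Y → λᴮ t Y + t) (rights G)

      -shift : ∀ x t → - (- x - t) ≡ x + t
      -shift x t = value-injective {x = - (- x - t)} {y = x + t} (solve 2 (λ x t → :- (:- x :- t) := x :+ t) refl (value x) (value t))

      is-left : (l : Scaffold (lefts G) (left-wall G (options G))) → ∀ t → Left t (Scaffold.f l t)
      is-left l t = witness (Scaffold.attained l t)
        , λ {X} X∈ → subst (λ th → - ν th t - t ≤ Scaffold.f l t) (options≡build G (inj₁ X∈)) (Scaffold.bound l t (X , X∈))
        where
        witness : (∃ λ i → Scaffold.f l t ≡ shift (left-wall G (options G) i) t) →
                  ∃ λ X → X ∈ lefts G × Scaffold.f l t ≡ ρᴮ t X - t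
        witness ((X , X∈) , eq) = X , X∈ , trans eq (cong (λ th → - ν th t - t) (options≡build G (inj₁ X∈)))

      is-right : (r : Scaffold (rights G) (right-wall G (options G))) → ∀ t → Right t (- Scaffold.f r t)
      is-right r t = witness (Scaffold.attained r t)
        , λ {Y} Y∈ → subst (- Scaffold.f r t ≤_) (-shift (λᴮ t Y) t)
            (ℚ.neg-antimono-≤ (subst (λ th → - λ′ th t - t ≤ Scaffold.f r t) (options≡build G (inj₂ Y∈)) (Scaffold.bound r t (Y , Y∈))))
        where
        witness : (∃ λ i → Scaffold.f r t ≡ shift (right-wall G (options G) i) t) →
                  ∃ λ Y → Y ∈ rights G × - Scaffold.f r t ≡ λᴮ t Y + t
        witness ((Y , Y∈) , eq) = Y , Y∈ , trans (cong -_ (trans eq (cong (λ th → - λ′ th t - t) (options≡build G (inj₂ Y∈))))) (-shift (λᴮ t Y) t)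

    max-unique : ∀ {F Xs x y} → IsMax F Xs x → IsMax F Xs y → x ≡ y
    max-unique {x = x} {y} ((X , X∈ , refl) , x≥) ((Y , Y∈ , refl) , y≥) = value-injective {x} {y} (ℚ.≤-antisym (y≥ X∈) (x≥ Y∈))

    min-unique : ∀ {F Xs x y} → IsMin F Xs x → IsMin F Xs y → x ≡ y
    min-unique {x = x} {y} ((X , X∈ , refl) , x≤) ((Y , Y∈ , refl) , y≤) = value-injective {x} {y} (ℚ.≤-antisym (x≤ Y∈) (y≤ X∈))

    private
      opposite : ∀ x y → value x ℚ.+ value y ≡ 0ℚ → x ≡ - y
      opposite x y eq = value-injective {x} { - y} (trans (solve 2 (λ x y → x := x :+ y :- y) refl (value x) (value y))
        (trans (cong (ℚ._- value y) eq) (ℚ.+-identityˡ (ℚ.- value y))))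

      opposite⁻ : ∀ {x} y → x ≡ - y → value x ℚ.+ value y ≡ 0ℚ
      opposite⁻ y refl = ℚ.+-inverseˡ (value y)

    record Spec (th : Thermograph G) : Set where
      field
        spec-integer : ∀ {n} → G ≈ᴳ integer n →
          temp th ≡ ⊥₋ × (∀ t → λ′ th t ≡ fromℤ n × - ν th t ≡ fromℤ n × cool th t ≡ integer n)
        spec-temp    : ¬ IsInteger G → ∃ λ T → temp th ≡ [ T ] × IsLeast (λ t → ∃ λ x → Left t x × Right t x) T
        spec-below   : ∀ {T t} → temp th ≡ [ T ] → t ≤ T → Left t (λ′ th t) × Right t (- ν th t) ×
          cool th t ≡ ⟨ map (λ X → cool (build X) t -ᴳ ⌜ t ⌝) (lefts G) ∣ map (λ Y → cool (build Y) t +ᴳ ⌜ t ⌝) (rights G) ⟩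
        spec-above   : ∀ {T t} → temp th ≡ [ T ] → T < t →
          λ′ th t ≡ λ′ th T × - ν th t ≡ - ν th T × cool th t ≡ ⌜ λ′ th T ⌝

    private
      cool-below : ∀ c {t} → t ≤ Proper.T c → cool-proper G (options G) c t ≡
        ⟨ map (λ X → cool (build X) t -ᴳ ⌜ t ⌝) (lefts G) ∣ map (λ Y → cool (build Y) t +ᴳ ⌜ t ⌝) (rights G) ⟩
      cool-below c {t} t≤T with value t ℚ.≤? value (Proper.T c)
      ... | no  t≰T = contradiction t≤T t≰T
      ... | yes _   = cong₂ ⟨_∣_⟩
        (trans (mapWith∈-cong (lefts G) _ (λ {X} _ → cool (build X) t -ᴳ ⌜ t ⌝) (λ X∈ → cong (λ th → cool th t -ᴳ ⌜ t ⌝) (options≡build G (inj₁ X∈))))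
          (mapWith∈≗map (λ X → cool (build X) t -ᴳ ⌜ t ⌝) (lefts G)))
        (trans (mapWith∈-cong (rights G) _ (λ {Y} _ → cool (build Y) t +ᴳ ⌜ t ⌝) (λ Y∈ → cong (λ th → cool th t +ᴳ ⌜ t ⌝) (options≡build G (inj₂ Y∈))))
          (mapWith∈≗map (λ Y → cool (build Y) t +ᴳ ⌜ t ⌝) (rights G)))

      cool-above : ∀ c {t} → Proper.T c < t → cool-proper G (options G) c t ≡ ⌜ Proper.L.f c (Proper.T c) ⌝
      cool-above c {t} T<t with value t ℚ.≤? value (Proper.T c)
      ... | no  _   = refl
      ... | yes t≤T = contradiction t≤T (ℚ<⇒≱ T<t)

      spec : ∀ s → Spec (thermograph G (options G) s)
      spec (constant n G≈n) = record
        { spec-integer = λ {m} G≈m → refl , λ _ → cong fromℤ (n≡ m G≈m)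
            , trans (value-injective { - fromℤ (ℤ.- n)} {fromℤ n} (trans (sym (ι-neg (ℤ.- n))) (cong ι (ℤ.neg-involutive n)))) (cong fromℤ (n≡ m G≈m))
            , cong integer (n≡ m G≈m)
        ; spec-temp    = λ ¬int → contradiction (n , G≈n) ¬int
        ; spec-below   = λ ()
        ; spec-above   = λ ()
        }
        where
        n≡ : ∀ m → G ≈ᴳ integer m → n ≡ m
        n≡ m G≈m = trans (sym (proj₁ (≈-rounding {G} {n} G≈n))) (proj₁ (≈-rounding {G} {m} G≈m))
      spec (nonconstant c) = record
        { spec-integer = λ {n} G≈n → contradiction (n , G≈n) ¬integer
        ; spec-temp    = λ _ → T , refl
            , (L.f T , is-left l T , subst (Right T) (sym (opposite (L.f T) (R.f T) zeroT)) (is-right r T))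
            , λ {s} (x , lx , rx) → first {s} (opposite⁻ {L.f s} (R.f s)
                (trans (max-unique (is-left l s) lx) (min-unique rx (is-right r s))))
        ; spec-below   = λ { {t = t} refl t≤T →
              subst (λ u → Left t (L.f u)) (sym (clip-below {T} {t} t≤T)) (is-left l t)
            , subst (λ u → Right t (- R.f u)) (sym (clip-below {T} {t} t≤T)) (is-right r t)
            , cool-below c {t} t≤T }
        ; spec-above   = λ { {t = t} refl T<t →
              cong L.f (clips {t} T<t)
            , cong (-_ ∘ R.f) (clips {t} T<t)
            , trans (cool-above c {t} T<t) (cong (⌜_⌝ ∘ L.f) (sym (clip-below {T} {T} ℚ.≤-refl))) }
        }
        where
        open Proper c

        clips : ∀ {t} → T < t → clip T t ≡ clip T T
        clips {t} T<t = trans (clip-above {T} {t} T<t) (sym (clip-below {T} {T} ℚ.≤-refl))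

    build-spec : Spec (build G)
    build-spec = subst Spec (sym (build-unfold G)) (spec (shape G (options G)))

  opaque
    cooling : Cooling
    cooling = record
      { λₜ                  = λ t G → λ′ (build G) t
      ; ρₜ                  = λ t G → - ν (build G) t
      ; cooled              = λ t G → cool (build G) t
      ; temperature         = λ G → temp (build G)
      ; temperature-integer = λ { {G} (n , G≈n) → proj₁ (integer-spec G {n} G≈n) }
      ; λ-integer           = λ {G} {n} G≈n t → proj₁ (proj₂ (integer-spec G {n} G≈n) t)
      ; ρ-integer           = λ {G} {n} G≈n t → proj₁ (proj₂ (proj₂ (integer-spec G {n} G≈n) t))
      ; cooled-integer      = λ {G} {n} G≈n t → proj₂ (proj₂ (proj₂ (integer-spec G {n} G≈n) t))
      ; temperature-least   = λ {G} → Spec.spec-temp (build-spec G)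
      ; λ-below             = λ {G} eq t≤T → proj₁ (Spec.spec-below (build-spec G) eq t≤T)
      ; ρ-below             = λ {G} eq t≤T → proj₁ (proj₂ (Spec.spec-below (build-spec G) eq t≤T))
      ; cooled-below        = λ {G} eq t≤T → proj₂ (proj₂ (Spec.spec-below (build-spec G) eq t≤T))
      ; λ-above             = λ {G} eq T<t → proj₁ (Spec.spec-above (build-spec G) eq T<t)
      ; ρ-above             = λ {G} eq T<t → proj₁ (proj₂ (Spec.spec-above (build-spec G) eq T<t))
      ; cooled-above        = λ {G} eq T<t → proj₂ (proj₂ (Spec.spec-above (build-spec G) eq T<t))
      }
      where
      integer-spec : ∀ G {n} → G ≈ᴳ integer n → temp (build G) ≡ ⊥₋ ×
        (∀ t → λ′ (build G) t ≡ fromℤ n × - ν (build G) t ≡ fromℤ n × cool (build G) t ≡ integer n)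
      integer-spec G {n} = Spec.spec-integer (build-spec G) {n}

open Existence public using (cooling)
open Cooling cooling public

{-# OPTIONS --safe #-}

-- Both parts are proved together by induction on G and H, for all t at once.
-- Part 2 follows from part 1 for the options, because Gₜ ⊳ (Gᴸ)ₜ - t and
-- (Hᴿ)ₜ ⊳ Hₜ - t.  This is clear up to the temperature.  A game frozen at a
-- number x since the temperature s < t has ρₛ(Gᴸ) - s ≤ x, and it suffices
-- that for every s < t, ρₛ(K) - s ≤ x implies x ⊳ Kₜ - t and λₛ(K) ≤ x implies
-- x ≥ Kₜ; these two are proved together by induction on K.  They fail for s = t,
-- where Kₜ may be x plus an infinitesimal, so the stops at an earlier time are
-- what has to be assumed.  Part 1 for unfrozen games is immediate from part 2
-- for the options, which also shows that G ≥ H implies λₜ(G) ≥ λₜ(H) and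
-- ρₜ(G) ≥ ρₜ(H); for two frozen games these are compared at the larger of the
-- two temperatures.
module Submission where

open import Defs
open import Data.Integer using (-1ℤ)
open import Data.Product using (_×_)
open import Data.Integer as ℤ using (ℤ; +_; -[1+_])
import Data.Integer.DivMod as ℤ
import Data.Integer.Properties as ℤ
open import Data.Integer.Tactic.RingSolver using (solve-∀)
open import Data.List using ([]; _∷_; _++_; map)
open import Data.List.Membership.Propositional using (_∈_)
open import Data.List.Membership.Propositional.Properties using (∈-map⁺; ∈-map⁻; ∈-++⁺ˡ; ∈-++⁺ʳ; ∈-++⁻)
open import Data.List.Relation.Unary.Any using (here)
open import Data.Nat as ℕ using (ℕ; zero; suc; _^_)
import Data.Nat.Properties as ℕ
open import Data.Product using (∃; _,_; proj₁; proj₂)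
open import Data.Rational as ℚ using (ℚ; mkℚ; ↥_; ↧_; ↧ₙ_; ½; 0ℚ; 1ℚ)
import Data.Rational.Properties as ℚ
open import Data.Rational.Solver using (module +-*-Solver)
open +-*-Solver using (solve; _:=_; _:+_; _:-_; :-_; con)
import Data.Rational.Unnormalised as ℚᵘ
import Data.Rational.Unnormalised.Properties as ℚᵘ
open import Data.Sum using (_⊎_; inj₁; inj₂)
open import Function using (case_of_)
open import Relation.Binary.Definitions using (tri<; tri≈; tri>)
open import Relation.Binary.PropositionalEquality
open import Relation.Nullary using (¬_; yes; no; contradiction; recompute)
open import Relation.Nullary.Construct.Add.Infimum using ([_])
open GameOrder
  using (_≺_; negs≡map; +ˡ≡map; +ʳ≡map; first-view; ⊳⇒first; ≥-intro; ≥-right; ≥-left; right-⊳; left-⊳;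
         induction; integer-⊳; integer-suc; integer-cancel; ≤⇒+; rounding; Rounding; ceiling; floor; integer?)
open Existence
  using (ι; ι-≤; ι-cancel-≤; ι-+; ι-neg; ι-*; h; h-positive; unit; double; 1+*; parity; Grid; grid-+; lin≤; lin<;
         ℚ<⇒≱; Wall; Thermograph; build; ⊳-floor; ⊳-ceiling; max-unique; min-unique)
open Thermograph using (wall-λ; wall-ν; λ-at-−1; ν-at-−1)

-- The order on games.

infix 4 _≽_ _▷_

-- _≥ᴳ_ and _⊳_ unfold to winning conditions on sums, from which the two
-- games cannot be inferred.
record _≽_ (G H : Game) : Set where
  constructor wrap
  field unwrap : G ≥ᴳ H

record _▷_ (G H : Game) : Set where
  constructor wrap
  field unwrap : G ⊳ H

open _≽_ public
open _▷_ public

≽-intro : ∀ {G H} → (∀ {X} → X ∈ rights G → X ▷ H) → (∀ {Y} → Y ∈ lefts H → G ▷ Y) → G ≽ H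
≽-intro {G} {H} r l = wrap (≥-intro {G} {H} (λ X∈ → unwrap (r X∈)) (λ Y∈ → unwrap (l Y∈)))

≽-right : ∀ {G H X} → G ≽ H → X ∈ rights G → X ▷ H
≽-right {G} {H} (wrap G≥H) X∈ = wrap (≥-right {G} {H} G≥H X∈)

≽-left : ∀ {G H Y} → G ≽ H → Y ∈ lefts H → G ▷ Y
≽-left {G} {H} (wrap G≥H) Y∈ = wrap (≥-left {G} {H} G≥H Y∈)

▷-left : ∀ {G H X} → X ∈ lefts G → X ≽ H → G ▷ H
▷-left {G} {H} X∈ (wrap X≥H) = wrap (left-⊳ {G} {H} X∈ X≥H)

▷-right : ∀ {G H Y} → Y ∈ rights H → G ≽ Y → G ▷ H
▷-right {G} {H} Y∈ (wrap G≥Y) = wrap (right-⊳ {G} {H} Y∈ G≥Y)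

▷-view : ∀ {G H} → G ▷ H → (∃ λ X → X ∈ lefts G × X ≽ H) ⊎ (∃ λ Y → Y ∈ rights H × G ≽ Y)
▷-view {G} {H} (wrap G⊳H) with first-view {G} {H} (⊳⇒first {G} {H} G⊳H)
... | inj₁ (X , X∈ , X≥H) = inj₁ (X , X∈ , wrap X≥H)
... | inj₂ (Y , Y∈ , G≥Y) = inj₂ (Y , Y∈ , wrap G≥Y)

≽-refl : ∀ {G} → G ≽ G
≽-refl {G} = wrap (GameOrder.≥-refl {G})

≽-trans : ∀ {G H K} → G ≽ H → H ≽ K → G ≽ K
≽-trans {G} {H} {K} (wrap p) (wrap q) = wrap (GameOrder.≥-trans {G} {H} {K} p q)

▷-≽-trans : ∀ {G H K} → G ▷ H → H ≽ K → G ▷ K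
▷-≽-trans {G} {H} {K} (wrap p) (wrap q) = wrap λ K≥G → p (GameOrder.≥-trans {H} {K} {G} q K≥G)

≽-▷-trans : ∀ {G H K} → G ≽ H → H ▷ K → G ▷ K
≽-▷-trans {G} {H} {K} (wrap p) (wrap q) = wrap λ K≥G → q (GameOrder.≥-trans {K} {G} {H} K≥G p)

▷⇒⋠ : ∀ {G H} → G ▷ H → ¬ (H ≽ G)
▷⇒⋠ (wrap p) (wrap q) = p q

-- Sums and negatives of games.

lefts-+ : ∀ G H → lefts (G +ᴳ H) ≡ map (_+ᴳ H) (lefts G) ++ map (G +ᴳ_) (lefts H)
lefts-+ G@(⟨ L ∣ _ ⟩) H@(⟨ L′ ∣ _ ⟩) = cong₂ _++_ (+ˡ≡map L H) (+ʳ≡map G L′)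

rights-+ : ∀ G H → rights (G +ᴳ H) ≡ map (_+ᴳ H) (rights G) ++ map (G +ᴳ_) (rights H)
rights-+ G@(⟨ _ ∣ R ⟩) H@(⟨ _ ∣ R′ ⟩) = cong₂ _++_ (+ˡ≡map R H) (+ʳ≡map G R′)

module _ {G H : Game} where

  left-+ˡ : ∀ {X} → X ∈ lefts G → X +ᴳ H ∈ lefts (G +ᴳ H)
  left-+ˡ X∈ = subst (_ ∈_) (sym (lefts-+ G H)) (∈-++⁺ˡ (∈-map⁺ (_+ᴳ H) X∈))

  left-+ʳ : ∀ {Y} → Y ∈ lefts H → G +ᴳ Y ∈ lefts (G +ᴳ H)
  left-+ʳ Y∈ = subst (_ ∈_) (sym (lefts-+ G H)) (∈-++⁺ʳ (map (_+ᴳ H) (lefts G)) (∈-map⁺ (G +ᴳ_) Y∈))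

  right-+ˡ : ∀ {X} → X ∈ rights G → X +ᴳ H ∈ rights (G +ᴳ H)
  right-+ˡ X∈ = subst (_ ∈_) (sym (rights-+ G H)) (∈-++⁺ˡ (∈-map⁺ (_+ᴳ H) X∈))

  right-+ʳ : ∀ {Y} → Y ∈ rights H → G +ᴳ Y ∈ rights (G +ᴳ H)
  right-+ʳ Y∈ = subst (_ ∈_) (sym (rights-+ G H)) (∈-++⁺ʳ (map (_+ᴳ H) (rights G)) (∈-map⁺ (G +ᴳ_) Y∈))

  module _ (P : Game → Set) where
    private
      split : ∀ {Xs Ys} → (∀ {X} → X ∈ Xs → P (X +ᴳ H)) → (∀ {Y} → Y ∈ Ys → P (G +ᴳ Y)) →
              ∀ {Z} → Z ∈ map (_+ᴳ H) Xs ++ map (G +ᴳ_) Ys → P Z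
      split {Xs} f g Z∈ with ∈-++⁻ (map (_+ᴳ H) Xs) Z∈
      ... | inj₁ Z∈ˡ = case ∈-map⁻ (_+ᴳ H) Z∈ˡ of λ { (_ , X∈ , refl) → f X∈ }
      ... | inj₂ Z∈ʳ = case ∈-map⁻ (G +ᴳ_) Z∈ʳ of λ { (_ , Y∈ , refl) → g Y∈ }

    all-lefts-+ : (∀ {X} → X ∈ lefts G → P (X +ᴳ H)) → (∀ {Y} → Y ∈ lefts H → P (G +ᴳ Y)) →
                  ∀ {Z} → Z ∈ lefts (G +ᴳ H) → P Z
    all-lefts-+ f g Z∈ = split f g (subst (_ ∈_) (lefts-+ G H) Z∈)

    all-rights-+ : (∀ {X} → X ∈ rights G → P (X +ᴳ H)) → (∀ {Y} → Y ∈ rights H → P (G +ᴳ Y)) →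
                   ∀ {Z} → Z ∈ rights (G +ᴳ H) → P Z
    all-rights-+ f g Z∈ = split f g (subst (_ ∈_) (rights-+ G H) Z∈)

lefts-neg : ∀ G → lefts (-ᴳ G) ≡ map -ᴳ_ (rights G)
lefts-neg ⟨ _ ∣ R ⟩ = negs≡map R

rights-neg : ∀ G → rights (-ᴳ G) ≡ map -ᴳ_ (lefts G)
rights-neg ⟨ L ∣ _ ⟩ = negs≡map L

left-neg : ∀ {G X} → X ∈ rights G → -ᴳ X ∈ lefts (-ᴳ G)
left-neg {G} X∈ = subst (_ ∈_) (sym (lefts-neg G)) (∈-map⁺ -ᴳ_ X∈)

right-neg : ∀ {G X} → X ∈ lefts G → -ᴳ X ∈ rights (-ᴳ G)
right-neg {G} X∈ = subst (_ ∈_) (sym (rights-neg G)) (∈-map⁺ -ᴳ_ X∈)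

all-lefts-neg : ∀ {G} (P : Game → Set) → (∀ {X} → X ∈ rights G → P (-ᴳ X)) → ∀ {Z} → Z ∈ lefts (-ᴳ G) → P Z
all-lefts-neg {G} P f Z∈ = case ∈-map⁻ -ᴳ_ (subst (_ ∈_) (lefts-neg G) Z∈) of λ { (_ , X∈ , refl) → f X∈ }

all-rights-neg : ∀ {G} (P : Game → Set) → (∀ {X} → X ∈ lefts G → P (-ᴳ X)) → ∀ {Z} → Z ∈ rights (-ᴳ G) → P Z
all-rights-neg {G} P f Z∈ = case ∈-map⁻ -ᴳ_ (subst (_ ∈_) (rights-neg G) Z∈) of λ { (_ , X∈ , refl) → f X∈ }

mutual
  neg-involutive : ∀ G → -ᴳ (-ᴳ G) ≡ G
  neg-involutive ⟨ L ∣ R ⟩ = cong₂ ⟨_∣_⟩ (negs-involutive L) (negs-involutive R)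

  negs-involutive : ∀ Xs → negs (negs Xs) ≡ Xs
  negs-involutive []       = refl
  negs-involutive (X ∷ Xs) = cong₂ _∷_ (neg-involutive X) (negs-involutive Xs)

+-comm : ∀ G H → G +ᴳ H ≽ H +ᴳ G
+-comm = induction _ λ G ihG → induction _ λ H ihH → ≽-intro
  (all-rights-+ {G} {H} (_▷ H +ᴳ G) (λ X∈ → ▷-right (right-+ʳ {H} {G} X∈) (ihG (inj₂ X∈) H))
                        (λ Y∈ → ▷-right (right-+ˡ {H} {G} Y∈) (ihH (inj₂ Y∈))))
  (all-lefts-+ {H} {G} (G +ᴳ H ▷_) (λ Y∈ → ▷-left (left-+ʳ {G} {H} Y∈) (ihH (inj₁ Y∈)))
                       (λ X∈ → ▷-left (left-+ˡ {G} {H} X∈) (ihG (inj₁ X∈) H)))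

-- Moves in `A` or `B` are answered as in the comparison of `A` with `B`, and a move in one copy of
-- `C` is copied in the other. An option of `A` or `B` turns `≽` into `▷`, and a winning move turns
-- `▷` back into `≽`, so both claims are proved together.
+-mono : ∀ A B C → (A ≽ B → A +ᴳ C ≽ B +ᴳ C) × (A ▷ B → A +ᴳ C ▷ B +ᴳ C)
+-mono = induction _ λ A ihA → induction _ λ B ihB → induction _ λ C ihC →
    (λ A≽B → ≽-intro
      (all-rights-+ {A} {C} (_▷ B +ᴳ C) (λ {X} X∈ → proj₂ (ihA (inj₂ X∈) B C) (≽-right A≽B X∈))
                            (λ Z∈ → ▷-right (right-+ʳ {B} {C} Z∈) (proj₁ (ihC (inj₂ Z∈)) A≽B)))
      (all-lefts-+ {B} {C} (A +ᴳ C ▷_) (λ Y∈ → proj₂ (ihB (inj₁ Y∈) C) (≽-left A≽B Y∈))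
                           (λ Z∈ → ▷-left (left-+ʳ {A} {C} Z∈) (proj₁ (ihC (inj₁ Z∈)) A≽B))))
  , λ A▷B → case ▷-view A▷B of λ
      { (inj₁ (X , X∈ , X≽B)) → ▷-left (left-+ˡ {A} {C} X∈) (proj₁ (ihA (inj₁ X∈) B C) X≽B)
      ; (inj₂ (Y , Y∈ , A≽Y)) → ▷-right (right-+ˡ {B} {C} Y∈) (proj₁ (ihB (inj₂ Y∈) C) A≽Y) }

+-monoˡ : ∀ {A B} C → A ≽ B → A +ᴳ C ≽ B +ᴳ C
+-monoˡ {A} {B} C = proj₁ (+-mono A B C)

+-monoˡ-▷ : ∀ {A B} C → A ▷ B → A +ᴳ C ▷ B +ᴳ C
+-monoˡ-▷ {A} {B} C = proj₂ (+-mono A B C)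

+-monoʳ : ∀ C {A B} → A ≽ B → C +ᴳ A ≽ C +ᴳ B
+-monoʳ C {A} {B} A≽B = ≽-trans (+-comm C A) (≽-trans (+-monoˡ C A≽B) (+-comm B C))

-- The mirror strategy: a move in `D` is answered in `-ᴳ D` and conversely, while moves in the two
-- copies of `C` are matched with each other.
+--≽ : ∀ C D → C +ᴳ D -ᴳ D ≽ C
+--≽ = induction _ λ C ihC → induction _ λ D ihD → ≽-intro
  (all-rights-+ {C +ᴳ D} { -ᴳ D} (_▷ C)
    (all-rights-+ {C} {D} (λ X → X -ᴳ D ▷ C) (λ X∈ → ▷-right X∈ (ihC (inj₂ X∈) D))
                          (λ {Y} Y∈ → ▷-left (left-+ʳ {C +ᴳ Y} { -ᴳ D} (left-neg {D} Y∈)) (ihD (inj₂ Y∈))))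
    (all-rights-neg {D} (λ Z → C +ᴳ D +ᴳ Z ▷ C) λ {Y} Y∈ → ▷-left (left-+ˡ {C +ᴳ D} { -ᴳ Y} (left-+ʳ {C} {D} Y∈)) (ihD (inj₁ Y∈))))
  (λ X∈ → ▷-left (left-+ˡ {C +ᴳ D} { -ᴳ D} (left-+ˡ {C} {D} X∈)) (ihC (inj₁ X∈) D))

≽-+- : ∀ C D → C ≽ C +ᴳ D -ᴳ D
≽-+- = induction _ λ C ihC → induction _ λ D ihD → ≽-intro
  (λ X∈ → ▷-right (right-+ˡ {C +ᴳ D} { -ᴳ D} (right-+ˡ {C} {D} X∈)) (ihC (inj₂ X∈) D))
  (all-lefts-+ {C +ᴳ D} { -ᴳ D} (C ▷_)
    (all-lefts-+ {C} {D} (λ X → C ▷ X -ᴳ D) (λ X∈ → ▷-left X∈ (ihC (inj₁ X∈) D))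
                         (λ {Y} Y∈ → ▷-right (right-+ʳ {C +ᴳ Y} { -ᴳ D} (right-neg {D} Y∈)) (ihD (inj₁ Y∈))))
    (all-lefts-neg {D} (λ Z → C ▷ C +ᴳ D +ᴳ Z) λ {Y} Y∈ → ▷-right (right-+ˡ {C +ᴳ D} { -ᴳ Y} (right-+ʳ {C} {D} Y∈)) (ihD (inj₂ Y∈))))

-+-≽ : ∀ C D → C -ᴳ D +ᴳ D ≽ C
-+-≽ C D = subst (λ E → C -ᴳ D +ᴳ E ≽ C) (neg-involutive D) (+--≽ C (-ᴳ D))

≽--+ : ∀ C D → C ≽ C -ᴳ D +ᴳ D
≽--+ C D = subst (λ E → C ≽ C -ᴳ D +ᴳ E) (neg-involutive D) (≽-+- C (-ᴳ D))

-- Sums of integers.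

infix 4 _≃_

_≃_ : Game → Game → Set
G ≃ H = G ≽ H × H ≽ G

lefts-integer : ∀ {m X} → X ∈ lefts (integer m) → ∃ λ n → m ≡ ℤ.suc n × X ≡ integer n
lefts-integer { + zero }        ()
lefts-integer { + suc n }       (here refl) = + n , refl , refl
lefts-integer { -[1+ zero ] }  ()
lefts-integer { -[1+ suc _ ] } ()

rights-integer : ∀ {m X} → X ∈ rights (integer m) → X ≡ integer (ℤ.suc m)
rights-integer { + zero }       ()
rights-integer { + suc _ }      ()
rights-integer { -[1+ zero ] }  (here refl) = refl
rights-integer { -[1+ suc n ] } (here refl) = refl

-- If `m + n` is positive then so is `m` or `n`. Left thus has a move in a summand that matches the
-- move to `m + n - 1`.
left-summand : ∀ m n {X} → X ∈ lefts (integer (m ℤ.+ n)) →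
               (∃ λ Y → Y ∈ lefts (integer m)) ⊎ (∃ λ Y → Y ∈ lefts (integer n))
left-summand (+ suc _)    n            _ = inj₁ (_ , here refl)
left-summand m            (+ suc _)    _ = inj₂ (_ , here refl)
left-summand (+ zero)     (+ zero)     ()
left-summand (+ zero)     -[1+ zero ]  ()
left-summand (+ zero)     -[1+ suc _ ] ()
left-summand -[1+ zero ]  (+ zero)     ()
left-summand -[1+ suc _ ] (+ zero)     ()
left-summand -[1+ _ ]     -[1+ _ ]     ()

right-summand : ∀ m n {X} → X ∈ rights (integer (m ℤ.+ n)) →
                (∃ λ Y → Y ∈ rights (integer m)) ⊎ (∃ λ Y → Y ∈ rights (integer n))
right-summand -[1+ zero ]  n            _ = inj₁ (_ , here refl)
right-summand -[1+ suc _ ] n            _ = inj₁ (_ , here refl)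
right-summand m            -[1+ zero ]  _ = inj₂ (_ , here refl)
right-summand m            -[1+ suc _ ] _ = inj₂ (_ , here refl)
right-summand (+ zero)     (+ zero)     ()
right-summand (+ zero)     (+ suc _)    ()
right-summand (+ suc _)    (+ _)        ()

suc-injective : ∀ {m n} → ℤ.suc m ≡ ℤ.suc n → m ≡ n
suc-injective {m} {n} eq = trans (sym (ℤ.pred-suc m)) (trans (cong ℤ.pred eq) (ℤ.pred-suc n))

suc-+ˡ : ∀ m n → ℤ.suc m ℤ.+ n ≡ ℤ.suc (m ℤ.+ n)
suc-+ˡ m n = ℤ.+-assoc (+ 1) m n

suc-+ʳ : ∀ m n → m ℤ.+ ℤ.suc n ≡ ℤ.suc (m ℤ.+ n)
suc-+ʳ m n = trans (sym (ℤ.+-assoc m (+ 1) n)) (trans (cong (ℤ._+ n) (ℤ.+-comm m (+ 1))) (ℤ.+-assoc (+ 1) m n))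

integer-+ : ∀ m n → integer m +ᴳ integer n ≃ integer (m ℤ.+ n)
integer-+ m n = go (integer m) (integer n) m n refl refl
  where
  -- The games are tied to `m` and `n` by equations so that the induction can run over options:
  -- passing to one moves the integer up or down according to its sign.
  go : ∀ G H m n → G ≡ integer m → H ≡ integer n → G +ᴳ H ≃ integer (m ℤ.+ n)
  go = induction _ λ G ihG → induction _ λ H ihH → λ m n → λ
    { refl refl →
      let
        1+ˡ : ∀ {X} → X ∈ rights (integer m) → X +ᴳ integer n ≃ integer (ℤ.suc (m ℤ.+ n))
        1+ˡ {X} X∈ = subst (λ i → X +ᴳ integer n ≃ integer i) (suc-+ˡ m n) (ihG (inj₂ X∈) (integer n) (ℤ.suc m) n (rights-integer {m} X∈) refl)

        1+ʳ : ∀ {X} → X ∈ rights (integer n) → integer m +ᴳ X ≃ integer (ℤ.suc (m ℤ.+ n))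
        1+ʳ {X} X∈ = subst (λ i → integer m +ᴳ X ≃ integer i) (suc-+ʳ m n) (ihH (inj₂ X∈) m (ℤ.suc n) refl (rights-integer {n} X∈))

        -1ˡ : ∀ {X} → X ∈ lefts (integer m) → ∃ λ i → m ℤ.+ n ≡ ℤ.suc i × X +ᴳ integer n ≃ integer i
        -1ˡ {X} X∈ = let m′ , m≡ , X≡ = lefts-integer {m} X∈ in
          m′ ℤ.+ n , trans (cong (ℤ._+ n) m≡) (suc-+ˡ m′ n) , ihG (inj₁ X∈) (integer n) m′ n X≡ refl

        -1ʳ : ∀ {X} → X ∈ lefts (integer n) → ∃ λ i → m ℤ.+ n ≡ ℤ.suc i × integer m +ᴳ X ≃ integer i
        -1ʳ {X} X∈ = let n′ , n≡ , X≡ = lefts-integer {n} X∈ in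
          m ℤ.+ n′ , trans (cong (λ i → m ℤ.+ i) n≡) (suc-+ʳ m n′) , ihH (inj₁ X∈) m n′ refl X≡

        above : ∀ {Z} → Z ≃ integer (ℤ.suc (m ℤ.+ n)) → Z ▷ integer (m ℤ.+ n)
        above Z≃ = ≽-▷-trans (proj₁ Z≃) (wrap (integer-⊳ (m ℤ.+ n)))

        below : ∀ {Z} → (∃ λ i → m ℤ.+ n ≡ ℤ.suc i × Z ≃ integer i) → integer (m ℤ.+ n) ▷ Z
        below (i , eq , Z≃) = ▷-≽-trans (subst (λ j → integer j ▷ integer i) (sym eq) (wrap (integer-⊳ i))) (proj₂ Z≃)

        same : ∀ {X Z} → X ∈ lefts (integer (m ℤ.+ n)) → (∃ λ i → m ℤ.+ n ≡ ℤ.suc i × Z ≃ integer i) → Z ≽ X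
        same {Z = Z} X∈ (i , eq , Z≃) = let i′ , eq′ , X≡ = lefts-integer {m ℤ.+ n} X∈ in
          subst (Z ≽_) (sym X≡) (subst (λ j → Z ≽ integer j) (suc-injective {i} {i′} (trans (sym eq) eq′)) (proj₁ Z≃))

        same′ : ∀ {X Z} → X ∈ rights (integer (m ℤ.+ n)) → Z ≃ integer (ℤ.suc (m ℤ.+ n)) → X ≽ Z
        same′ X∈ Z≃ = subst (_≽ _) (sym (rights-integer {m ℤ.+ n} X∈)) (proj₂ Z≃)
      in
        ≽-intro
          (all-rights-+ {integer m} {integer n} (_▷ integer (m ℤ.+ n)) (λ X∈ → above (1+ˡ X∈)) (λ X∈ → above (1+ʳ X∈)))
          (λ X∈ → case left-summand m n X∈ of λ
            { (inj₁ (Y , Y∈)) → ▷-left (left-+ˡ {integer m} {integer n} Y∈) (same X∈ (-1ˡ Y∈))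
            ; (inj₂ (Y , Y∈)) → ▷-left (left-+ʳ {integer m} {integer n} Y∈) (same X∈ (-1ʳ Y∈)) })
      , ≽-intro
          (λ X∈ → case right-summand m n X∈ of λ
            { (inj₁ (Y , Y∈)) → ▷-right (right-+ˡ {integer m} {integer n} Y∈) (same′ X∈ (1+ˡ Y∈))
            ; (inj₂ (Y , Y∈)) → ▷-right (right-+ʳ {integer m} {integer n} Y∈) (same′ X∈ (1+ʳ Y∈)) })
          (all-lefts-+ {integer m} {integer n} (integer (m ℤ.+ n) ▷_) (λ X∈ → below (-1ˡ X∈)) (λ X∈ → below (-1ʳ X∈)))
    }

-- Dyadic rationals

twice-injective : ∀ {a b} → a ℤ.+ a ≡ b ℤ.+ b → a ≡ b
twice-injective {a} {b} eq with ℤ.<-cmp a b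
... | tri< a<b _ _ = contradiction (ℤ.+-mono-< a<b a<b) (ℤ.<-irrefl eq)
... | tri≈ _ a≡b _ = a≡b
... | tri> _ _ b<a = contradiction (ℤ.+-mono-< b<a b<a) (ℤ.<-irrefl (sym eq))

even≢odd : ∀ a b → a ℤ.+ a ≢ ℤ.suc (b ℤ.+ b)
even≢odd a b eq with a ℤ.≤? b
... | yes a≤b = ℤ.<-irrefl eq (ℤ.suc[i]≤j⇒i<j (ℤ.+-monoʳ-≤ (+ 1) (ℤ.+-mono-≤ a≤b a≤b)))
... | no  a≰b = ℤ.<-irrefl (sym eq) (ℤ.suc[i]≤j⇒i<j (subst (ℤ._≤ a ℤ.+ a)
  (trans (suc-+ˡ b (ℤ.suc b)) (cong ℤ.suc (suc-+ʳ b b))) (ℤ.+-mono-≤ b<a b<a)))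
  where
  b<a : ℤ.suc b ℤ.≤ a
  b<a = ℤ.i<j⇒suc[i]≤j (ℤ.≰⇒> a≰b)

halve : ∀ m → m ≡ + (m ℤ.%ℕ 2) ℤ.+ (m ℤ./ℕ 2 ℤ.+ m ℤ./ℕ 2)
halve m = trans (ℤ.a≡a%ℕn+[a/ℕn]*n m 2) (cong (λ i → + (m ℤ.%ℕ 2) ℤ.+ i)
  (trans (ℤ.*-distribˡ-+ q (+ 1) (+ 1)) (cong₂ ℤ._+_ (ℤ.*-identityʳ q) (ℤ.*-identityʳ q))))
  where
  q : ℤ
  q = m ℤ./ℕ 2

suc-twice : ∀ a → ℤ.suc (ℤ.suc (a ℤ.+ a)) ≡ ℤ.suc a ℤ.+ ℤ.suc a
suc-twice a = sym (trans (suc-+ˡ a (ℤ.suc a)) (cong ℤ.suc (suc-+ʳ a a)))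

-- This and `fraction-odd` serve as computation rules: once the parity of the numerator is visible,
-- the remainder test inside `fraction` is decided.
fraction-even : ∀ a k → fraction (a ℤ.+ a) (suc k) ≡ fraction a k
fraction-even a k with (a ℤ.+ a) ℤ.%ℕ 2 | ℤ.n%ℕd<d (a ℤ.+ a) 2 | halve (a ℤ.+ a)
... | 0           | _                   | eq = cong (λ i → fraction i k) (sym (twice-injective {a} (trans eq (ℤ.+-identityˡ _))))
... | 1           | _                   | eq = contradiction eq (even≢odd a ((a ℤ.+ a) ℤ./ℕ 2))
... | suc (suc _) | ℕ.s≤s (ℕ.s≤s ()) | _

fraction-odd : ∀ a k → fraction (ℤ.suc (a ℤ.+ a)) (suc k) ≡ ⟨ fraction a k ∷ [] ∣ fraction (ℤ.suc a) k ∷ [] ⟩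
fraction-odd a k with ℤ.suc (a ℤ.+ a) ℤ.%ℕ 2 | ℤ.n%ℕd<d (ℤ.suc (a ℤ.+ a)) 2 | halve (ℤ.suc (a ℤ.+ a))
... | 0           | _                   | eq = contradiction (sym (trans eq (ℤ.+-identityˡ _))) (even≢odd (ℤ.suc (a ℤ.+ a) ℤ./ℕ 2) a)
... | 1           | _                   | eq = cong (λ i → ⟨ fraction i k ∷ [] ∣ fraction (ℤ.suc i) k ∷ [] ⟩)
  (sym (twice-injective {a} (suc-injective {a ℤ.+ a} eq)))
... | suc (suc _) | ℕ.s≤s (ℕ.s≤s ()) | _

-- What is used about consecutive multiples of 1 / 2 ^ k. The last two fields say that the options
-- of one do not reach into the gap between it and the other.
record Neighbours (G H : Game) : Set where
  field
    ≽-below  : H ≽ G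
    ▷-below  : H ▷ G
    rights-≽ : ∀ {Y} → Y ∈ rights G → Y ≽ H
    ≽-lefts  : ∀ {X} → X ∈ lefts H → G ≽ X

open Neighbours

-- The midpoint lies above `B` because the left options of `B` are at most `A`, and below `C`
-- because the right options of `C` are at least `D`; hence the two outer neighbours.
midway : ∀ {A B C D} → Neighbours A B → Neighbours B C → Neighbours C D →
         Neighbours B ⟨ B ∷ [] ∣ C ∷ [] ⟩ × Neighbours ⟨ B ∷ [] ∣ C ∷ [] ⟩ C
midway {A} {B} {C} {D} AB BC CD =
    record
      { ≽-below  = M≽B
      ; ▷-below  = ▷-left (here refl) ≽-refl
      ; rights-≽ = λ Y∈ → ≽-trans (rights-≽ BC Y∈) C≽M
      ; ≽-lefts  = λ { (here refl) → ≽-refl }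
      }
  , record
      { ≽-below  = C≽M
      ; ▷-below  = ▷-right (here refl) ≽-refl
      ; rights-≽ = λ { (here refl) → ≽-refl }
      ; ≽-lefts  = λ X∈ → ≽-trans M≽B (≽-lefts BC X∈)
      }
  where
  M : Game
  M = ⟨ B ∷ [] ∣ C ∷ [] ⟩

  M≽B : M ≽ B
  M≽B = ≽-intro (λ { (here refl) → ▷-below BC })
    (λ X∈ → ▷-left (here refl) (≽-trans (≽-below AB) (≽-lefts AB X∈)))

  C≽M : C ≽ M
  C≽M = ≽-intro (λ Y∈ → ▷-right (here refl) (≽-trans (rights-≽ CD Y∈) (≽-below CD)))
    (λ { (here refl) → ▷-below BC })

-- The canonical form of an even m has a smaller denominator than 2 ^ k, but its
-- options are still separated from it by the grid of multiples of 1 / 2 ^ k.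
neighbours : ∀ k m → Neighbours (fraction m k) (fraction (ℤ.suc m) k)
neighbours zero m = record
  { ≽-below  = wrap (integer-suc m)
  ; ▷-below  = wrap (integer-⊳ m)
  ; rights-≽ = λ Y∈ → subst (_≽ integer (ℤ.suc m)) (sym (rights-integer {m} Y∈)) ≽-refl
  ; ≽-lefts  = λ X∈ → let n , eq , X≡ = lefts-integer {ℤ.suc m} X∈ in
      subst (integer m ≽_) (trans (cong integer (suc-injective {m} {n} eq)) (sym X≡)) ≽-refl
  }
neighbours (suc k) m with parity m
... | a , p = case p of λ
  { (inj₁ refl) → subst₂ Neighbours (sym (fraction-even a k)) (sym (fraction-odd a k)) (proj₁ mid)
  ; (inj₂ refl) → subst₂ Neighbours (sym (fraction-odd a k))
      (trans (sym (fraction-even (ℤ.suc a) k)) (cong (λ i → fraction i (suc k)) (sym (suc-twice a)))) (proj₂ mid) }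
  where
  mid : Neighbours (fraction a k) ⟨ fraction a k ∷ [] ∣ fraction (ℤ.suc a) k ∷ [] ⟩ ×
        Neighbours ⟨ fraction a k ∷ [] ∣ fraction (ℤ.suc a) k ∷ [] ⟩ (fraction (ℤ.suc a) k)
  mid = midway (subst (λ i → Neighbours (fraction (ℤ.pred a) k) (fraction i k)) (ℤ.suc-pred a) (neighbours k (ℤ.pred a)))
    (neighbours k a) (neighbours k (ℤ.suc a))

module _ {B C} (BM : Neighbours B ⟨ B ∷ [] ∣ C ∷ [] ⟩) (MC : Neighbours ⟨ B ∷ [] ∣ C ∷ [] ⟩ C) where
  private
    M : Game
    M = ⟨ B ∷ [] ∣ C ∷ [] ⟩

  -- Moving in `E` gains nothing over moving in the midpoint: a right option `Y` of `E` is at least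
  -- `F`, so `M +ᴳ Y` is at least `B +ᴳ F`, which equals `C +ᴳ E`. The neighbour `D` plays the same
  -- part for Left.
  midpoint-+ : ∀ {D E F P Q} → Neighbours D E → Neighbours E F →
               B +ᴳ E ≃ P → C +ᴳ D ≃ P → C +ᴳ E ≃ Q → B +ᴳ F ≃ Q → M +ᴳ E ≃ ⟨ P ∷ [] ∣ Q ∷ [] ⟩
  midpoint-+ {D} {E} {F} {P} {Q} DE EF BE CD CE BF =
      ≽-intro
        (all-rights-+ {M} {E} (_▷ ⟨ P ∷ [] ∣ Q ∷ [] ⟩)
          (λ { (here refl) → ▷-right (here refl) (proj₁ CE) })
          (λ {Y} Y∈ → ▷-right (here refl)
            (≽-trans (+-monoˡ Y (≽-below BM)) (≽-trans (+-monoʳ B (rights-≽ EF Y∈)) (proj₁ BF)))))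
        (λ { (here refl) → ▷-left (left-+ˡ {M} {E} (here refl)) (proj₁ BE) })
    , ≽-intro
        (λ { (here refl) → ▷-right (right-+ˡ {M} {E} (here refl)) (proj₂ CE) })
        (all-lefts-+ {M} {E} (⟨ P ∷ [] ∣ Q ∷ [] ⟩ ▷_)
          (λ { (here refl) → ▷-left (here refl) (proj₂ BE) })
          (λ {X} X∈ → ▷-left (here refl)
            (≽-trans (proj₂ CD) (≽-trans (+-monoʳ C (≽-lefts DE X∈)) (+-monoˡ X (≽-below MC))))))

  -- A move by one player in one midpoint is answered by the opposite move in the other, which
  -- brings the sum to `C +ᴳ B′` or `B +ᴳ C′`, both equal to `Q`. The options of `Q` itself are
  -- bounded by `P` and `R`.
  midpoints-+ : ∀ {B′ C′ P Q R} → Neighbours B′ ⟨ B′ ∷ [] ∣ C′ ∷ [] ⟩ → Neighbours ⟨ B′ ∷ [] ∣ C′ ∷ [] ⟩ C′ →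
                Neighbours P Q → Neighbours Q R → B +ᴳ B′ ≃ P → B +ᴳ C′ ≃ Q → C +ᴳ B′ ≃ Q → C +ᴳ C′ ≃ R →
                M +ᴳ ⟨ B′ ∷ [] ∣ C′ ∷ [] ⟩ ≃ Q
  midpoints-+ {B′} {C′} {P} {Q} {R} BM′ MC′ PQ QR BB BC CB CC =
      ≽-intro
        (all-rights-+ {M} {M′} (_▷ Q)
          (λ { (here refl) → ▷-left (left-+ʳ {C} {M′} (here refl)) (proj₁ CB) })
          (λ { (here refl) → ▷-left (left-+ˡ {M} {C′} (here refl)) (proj₁ BC) }))
        (λ X∈ → ▷-left (left-+ˡ {M} {M′} (here refl))
          (≽-trans (+-monoʳ B (≽-below BM′)) (≽-trans (proj₁ BB) (≽-lefts PQ X∈))))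
    , ≽-intro
        (λ Y∈ → ▷-right (right-+ˡ {M} {M′} (here refl))
          (≽-trans (rights-≽ QR Y∈) (≽-trans (proj₂ CC) (+-monoʳ C (≽-below MC′)))))
        (all-lefts-+ {M} {M′} (Q ▷_)
          (λ { (here refl) → ▷-right (right-+ʳ {B} {M′} (here refl)) (proj₂ BC) })
          (λ { (here refl) → ▷-right (right-+ˡ {M} {B′} (here refl)) (proj₂ CB) }))
    where
    M′ : Game
    M′ = ⟨ B′ ∷ [] ∣ C′ ∷ [] ⟩

sum-twice : ∀ a b → (a ℤ.+ a) ℤ.+ (b ℤ.+ b) ≡ (a ℤ.+ b) ℤ.+ (a ℤ.+ b)
sum-twice = solve-∀

neighbours-odd : ∀ k a → Neighbours (fraction a k) ⟨ fraction a k ∷ [] ∣ fraction (ℤ.suc a) k ∷ [] ⟩ ×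
                         Neighbours ⟨ fraction a k ∷ [] ∣ fraction (ℤ.suc a) k ∷ [] ⟩ (fraction (ℤ.suc a) k)
neighbours-odd k a = subst₂ Neighbours (fraction-even a k) (fraction-odd a k) (neighbours (suc k) (a ℤ.+ a))
  , subst₂ Neighbours (fraction-odd a k) (trans (cong (λ i → fraction i (suc k)) (suc-twice a)) (fraction-even (ℤ.suc a) k))
      (neighbours (suc k) (ℤ.suc (a ℤ.+ a)))

≃-comm : ∀ {G H K} → G +ᴳ H ≃ K → H +ᴳ G ≃ K
≃-comm {G} {H} (p , q) = ≽-trans (+-comm H G) p , ≽-trans q (+-comm G H)

-- Induction on `k` by the parities of the numerators: two even ones reduce to `k - 1`, two odd ones
-- are midpoints whose sum lies on the coarser grid, and one of each is a midpoint shifted by a grid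
-- point.
fraction-+ : ∀ k m n → fraction m k +ᴳ fraction n k ≃ fraction (m ℤ.+ n) k
odd+even : ∀ k a b → fraction (ℤ.suc (a ℤ.+ a)) (suc k) +ᴳ fraction (b ℤ.+ b) (suc k) ≃
                     fraction (ℤ.suc (a ℤ.+ a) ℤ.+ (b ℤ.+ b)) (suc k)

fraction-+ zero m n = integer-+ m n
fraction-+ (suc k) m n with parity m | parity n
... | a , inj₁ refl | b , inj₁ refl = subst₂ _≃_
  (sym (cong₂ _+ᴳ_ (fraction-even a k) (fraction-even b k)))
  (sym (trans (cong (λ i → fraction i (suc k)) (sum-twice a b)) (fraction-even (a ℤ.+ b) k)))
  (fraction-+ k a b)
... | a , inj₂ refl | b , inj₁ refl = odd+even k a b
... | a , inj₁ refl | b , inj₂ refl = subst (λ i → fraction (a ℤ.+ a) (suc k) +ᴳ fraction (ℤ.suc (b ℤ.+ b)) (suc k) ≃ fraction i (suc k))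
  (ℤ.+-comm (ℤ.suc (b ℤ.+ b)) (a ℤ.+ a)) (≃-comm (odd+even k b a))
... | a , inj₂ refl | b , inj₂ refl = subst₂ _≃_
  (sym (cong₂ _+ᴳ_ (fraction-odd a k) (fraction-odd b k)))
  (sym (trans (cong (λ i → fraction i (suc k)) eq) (fraction-even (ℤ.suc (a ℤ.+ b)) k)))
  (midpoints-+ (proj₁ (neighbours-odd k a)) (proj₂ (neighbours-odd k a)) (proj₁ (neighbours-odd k b)) (proj₂ (neighbours-odd k b))
    (neighbours k (a ℤ.+ b)) (neighbours k (ℤ.suc (a ℤ.+ b)))
    (fraction-+ k a b) (sums (suc-+ʳ a b) (fraction-+ k a (ℤ.suc b))) (sums (suc-+ˡ a b) (fraction-+ k (ℤ.suc a) b))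
    (sums (trans (suc-+ˡ a (ℤ.suc b)) (cong ℤ.suc (suc-+ʳ a b))) (fraction-+ k (ℤ.suc a) (ℤ.suc b))))
  where
  sums : ∀ {G i j} → i ≡ j → G ≃ fraction i k → G ≃ fraction j k
  sums refl p = p

  eq : ℤ.suc (a ℤ.+ a) ℤ.+ ℤ.suc (b ℤ.+ b) ≡ ℤ.suc (a ℤ.+ b) ℤ.+ ℤ.suc (a ℤ.+ b)
  eq = trans (trans (suc-+ˡ (a ℤ.+ a) (ℤ.suc (b ℤ.+ b))) (cong ℤ.suc (suc-+ʳ (a ℤ.+ a) (b ℤ.+ b))))
    (trans (cong (λ i → ℤ.suc (ℤ.suc i)) (sum-twice a b)) (suc-twice (a ℤ.+ b)))

odd+even k a b = subst₂ _≃_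
  (sym (cong₂ _+ᴳ_ (fraction-odd a k) (fraction-even b k)))
  (sym (trans (cong (λ i → fraction i (suc k)) eq) (fraction-odd (a ℤ.+ b) k)))
  (midpoint-+ (proj₁ (neighbours-odd k a)) (proj₂ (neighbours-odd k a))
    (subst (λ i → Neighbours (fraction (ℤ.pred b) k) (fraction i k)) (ℤ.suc-pred b) (neighbours k (ℤ.pred b))) (neighbours k b)
    (fraction-+ k a b)
    (sums (trans (suc-+ˡ a (ℤ.pred b)) (trans (sym (suc-+ʳ a (ℤ.pred b))) (cong (λ i → a ℤ.+ i) (ℤ.suc-pred b)))) (fraction-+ k (ℤ.suc a) (ℤ.pred b)))
    (sums (suc-+ˡ a b) (fraction-+ k (ℤ.suc a) b)) (sums (suc-+ʳ a b) (fraction-+ k a (ℤ.suc b))))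
  where
  sums : ∀ {G i j} → i ≡ j → G ≃ fraction i k → G ≃ fraction j k
  sums refl p = p

  eq : ℤ.suc (a ℤ.+ a) ℤ.+ (b ℤ.+ b) ≡ ℤ.suc ((a ℤ.+ b) ℤ.+ (a ℤ.+ b))
  eq = trans (suc-+ˡ (a ℤ.+ a) (b ℤ.+ b)) (cong ℤ.suc (sum-twice a b))

-- From fractions over a fixed denominator to canonical forms.

*-↧ : ∀ q → q ℚ.* ι (↧ q) ≡ ι (↥ q)
*-↧ q@(mkℚ n d _) = ℚ.toℚᵘ-injective (ℚᵘ.≃-trans (ℚ.toℚᵘ-homo-* q (ι (↧ q)))
  (ℚᵘ.*≡* (trans (ℤ.*-identityʳ (n ℤ.* + suc d)) (cong (λ e → n ℤ.* + e) (sym (ℕ.*-identityʳ (suc d)))))))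

2^*h : ∀ k → ι (+ (2 ^ k)) ℚ.* h k ≡ 1ℚ
2^*h zero    = refl
2^*h (suc k) = trans (cong (λ i → ι (+ i) ℚ.* h (suc k)) (cong (2 ^ k ℕ.+_) (ℕ.+-identityʳ (2 ^ k))))
  (trans (sym (double k (+ (2 ^ k)))) (2^*h k))

value-on-grid : ∀ x → value x ≡ ι (↥ value x) ℚ.* h (exponent x)
value-on-grid (dyadic q k q≡) = begin
  q                                ≡⟨ ℚ.*-identityʳ q ⟨
  q ℚ.* 1ℚ                         ≡⟨ cong (q ℚ.*_) (2^*h k) ⟨
  q ℚ.* (ι (+ (2 ^ k)) ℚ.* h k)    ≡⟨ ℚ.*-assoc q (ι (+ (2 ^ k))) (h k) ⟨
  q ℚ.* ι (+ (2 ^ k)) ℚ.* h k      ≡⟨ cong (λ d → q ℚ.* ι (+ d) ℚ.* h k) (recompute (↧ₙ q ℕ.≟ 2 ^ k) q≡) ⟨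
  q ℚ.* ι (↧ q) ℚ.* h k            ≡⟨ cong (ℚ._* h k) (*-↧ q) ⟩
  ι (↥ q) ℚ.* h k                  ∎
  where open ≡-Reasoning

*h-cancel-≤ : ∀ k {i j} → ι i ℚ.* h k ℚ.≤ ι j ℚ.* h k → i ℤ.≤ j
*h-cancel-≤ k p = ι-cancel-≤ (ℚ.*-cancelʳ-≤-pos (h k) {{ℚ.positive (h-positive k)}} p)

refine : ∀ j {k i} → ∃ λ i′ → fraction i k ≡ fraction i′ (j ℕ.+ k) × ι i ℚ.* h k ≡ ι i′ ℚ.* h (j ℕ.+ k)
refine zero    {k} {i} = i , refl , refl
refine (suc j) {k} {i} =
  let i′ , p , q = refine j {k} {i}
  in i′ ℤ.+ i′ , trans p (sym (fraction-even i′ (j ℕ.+ k))) , trans q (double (j ℕ.+ k) i′)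

-- Both sides are brought to the denominator 2 ^ (k + l). Doubling the numerator along with the
-- denominator leaves the game unchanged, and over one denominator the value determines the
-- numerator.
fraction-unique : ∀ {i k j l} → ι i ℚ.* h k ≡ ι j ℚ.* h l → fraction i k ≡ fraction j l
fraction-unique {i} {k} {j} {l} eq with refine l {k} {i} | refine k {l} {j}
... | i′ , p , q | j′ , r , s = trans p (trans
    (cong₂ fraction (ℤ.≤-antisym (*h-cancel-≤ (k ℕ.+ l) (ℚ.≤-reflexive eq′)) (*h-cancel-≤ (k ℕ.+ l) (ℚ.≤-reflexive (sym eq′)))) (ℕ.+-comm l k))
    (sym r))
  where
  eq′ : ι i′ ℚ.* h (k ℕ.+ l) ≡ ι j′ ℚ.* h (k ℕ.+ l)
  eq′ = trans (cong (λ n → ι i′ ℚ.* h n) (ℕ.+-comm k l)) (trans (sym q) (trans eq s))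

⌜⌝-on-grid : ∀ {k i} x → value x ≡ ι i ℚ.* h k → ⌜ x ⌝ ≡ fraction i k
⌜⌝-on-grid {k} {i} x eq = fraction-unique {↥ value x} {exponent x} {i} {k} (trans (sym (value-on-grid x)) eq)

common-grid : ∀ x y → ∃ λ k → Grid k x × Grid k y
common-grid x y =
  let i , _ , p = refine (exponent y) {exponent x} {↥ value x}
      j , _ , q = refine (exponent x) {exponent y} {↥ value y}
  in exponent x ℕ.+ exponent y
   , (i , trans (value-on-grid x) (trans p (cong (λ n → ι i ℚ.* h n) (ℕ.+-comm (exponent y) (exponent x)))))
   , (j , trans (value-on-grid y) q)

fraction-mono : ∀ k {m n} → m ℤ.≤ n → fraction n k ≽ fraction m k
fraction-mono k {m} m≤n with ≤⇒+ m≤n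
... | d , refl = go d
  where
  go : ∀ d → fraction (+ d ℤ.+ m) k ≽ fraction m k
  go zero    = subst (λ i → fraction i k ≽ fraction m k) (sym (ℤ.+-identityˡ m)) ≽-refl
  go (suc d) = subst (λ i → fraction i k ≽ fraction m k) (sym (ℤ.+-assoc (+ 1) (+ d) m))
    (≽-trans (≽-below (neighbours k (+ d ℤ.+ m))) (go d))

⌜⌝-mono : ∀ {x y} → x ≤ y → ⌜ y ⌝ ≽ ⌜ x ⌝
⌜⌝-mono {x} {y} x≤y with common-grid x y
... | k , (i , p) , (j , q) = subst₂ _≽_ (sym (⌜⌝-on-grid {k} {j} y q)) (sym (⌜⌝-on-grid {k} {i} x p))
  (fraction-mono k (*h-cancel-≤ k (subst₂ ℚ._≤_ p q x≤y)))

⌜⌝-mono-▷ : ∀ {x y} → x < y → ⌜ y ⌝ ▷ ⌜ x ⌝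
⌜⌝-mono-▷ {x} {y} x<y with common-grid x y
... | k , (i , p) , (j , q) = subst₂ _▷_ (sym (⌜⌝-on-grid {k} {j} y q)) (sym (⌜⌝-on-grid {k} {i} x p))
  (≽-▷-trans (fraction-mono k (ℤ.i<j⇒suc[i]≤j (ℤ.≰⇒> λ j≤i → ℚ<⇒≱ x<y
    (subst₂ ℚ._≤_ (sym q) (sym p) (ι-* k j≤i))))) (▷-below (neighbours k i)))

⌜⌝-+ : ∀ x y → ⌜ x ⌝ +ᴳ ⌜ y ⌝ ≃ ⌜ x + y ⌝
⌜⌝-+ x y with common-grid x y
... | k , (i , p) , (j , q) = subst₂ _≃_
  (sym (cong₂ _+ᴳ_ (⌜⌝-on-grid {k} {i} x p) (⌜⌝-on-grid {k} {j} y q)))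
  (sym (⌜⌝-on-grid {k} {i ℤ.+ j} (x + y) (proj₂ (grid-+ k {x} {y} (i , p) (j , q)))))
  (fraction-+ k i j)

-- Cancel `⌜ y ⌝` in the instance of `⌜⌝-+` with summands `x - y` and `y`.
⌜⌝-- : ∀ x y → ⌜ x ⌝ -ᴳ ⌜ y ⌝ ≃ ⌜ x - y ⌝
⌜⌝-- x y = ≽-trans (+-monoˡ (-ᴳ ⌜ y ⌝) (proj₂ x-y+y)) (+--≽ ⌜ x - y ⌝ ⌜ y ⌝)
         , ≽-trans (≽-+- ⌜ x - y ⌝ ⌜ y ⌝) (+-monoˡ (-ᴳ ⌜ y ⌝) (proj₁ x-y+y))
  where
  x-y+y : ⌜ x - y ⌝ +ᴳ ⌜ y ⌝ ≃ ⌜ x ⌝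
  x-y+y = subst (λ z → ⌜ x - y ⌝ +ᴳ ⌜ y ⌝ ≃ ⌜ z ⌝)
    (value-injective {x - y + y} {x} (trans (ℚ.+-assoc (value x) (ℚ.- value y) (value y))
      (trans (cong (λ q → value x ℚ.+ q) (ℚ.+-inverseˡ (value y))) (ℚ.+-identityʳ (value x)))))
    (⌜⌝-+ (x - y) y)

suc*h : ∀ i k → ι (ℤ.suc i) ℚ.* h k ≡ ι i ℚ.* h k ℚ.+ h k
suc*h i k = trans (cong (ℚ._* h k) (ι-+ (+ 1) i)) (1+* (ι i) (h k))

module _ x m k (on-grid : value x ≡ ι m ℚ.* h k) where

  next : x < x + unit k × ⌜ x + unit k ⌝ ≡ fraction (ℤ.suc m) k
  next = lin< (h-positive k) (solve 2 (λ q e → q :+ e :- q := e :- con 0ℚ) refl (value x) (h k))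
    , ⌜⌝-on-grid {k} {ℤ.suc m} (x + unit k) (trans (cong (ℚ._+ h k) on-grid) (sym (suc*h m k)))

  previous : x - unit k < x × ⌜ x - unit k ⌝ ≡ fraction (ℤ.pred m) k
  previous = lin< (h-positive k) (solve 2 (λ q e → q :- (q :- e) := e :- con 0ℚ) refl (value x) (h k))
    , ⌜⌝-on-grid {k} {ℤ.pred m} (x - unit k) (begin
        value x ℚ.- h k                       ≡⟨ cong (ℚ._- h k) on-grid ⟩
        ι m ℚ.* h k ℚ.- h k                   ≡⟨ cong (λ i → ι i ℚ.* h k ℚ.- h k) (ℤ.suc-pred m) ⟨
        ι (ℤ.suc (ℤ.pred m)) ℚ.* h k ℚ.- h k  ≡⟨ cong (ℚ._- h k) (suc*h (ℤ.pred m) k) ⟩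
        ι (ℤ.pred m) ℚ.* h k ℚ.+ h k ℚ.- h k  ≡⟨ solve 2 (λ q e → q :+ e :- e := q) refl (ι (ℤ.pred m) ℚ.* h k) (h k) ⟩
        ι (ℤ.pred m) ℚ.* h k                  ∎)
    where open ≡-Reasoning

opaque

  -- The witness is the next multiple of 1 / 2 ^ `exponent x`. The strict gap between `x` and `y` is
  -- what later leaves room for an earlier time or for a number in between.
  ⌜⌝-rights : ∀ x {Y} → Y ∈ rights ⌜ x ⌝ → ∃ λ y → x < y × Y ≽ ⌜ y ⌝
  ⌜⌝-rights x {Y} Y∈ = let x<y , y≡ = next x (↥ value x) (exponent x) (value-on-grid x) in
    x + unit (exponent x) , x<y , subst (Y ≽_) (sym y≡) (rights-≽ (neighbours (exponent x) (↥ value x)) Y∈)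

  ⌜⌝-lefts : ∀ x {X} → X ∈ lefts ⌜ x ⌝ → ∃ λ y → y < x × ⌜ y ⌝ ≽ X
  ⌜⌝-lefts x {X} X∈ = let y<x , y≡ = previous x (↥ value x) (exponent x) (value-on-grid x) in
    x - unit (exponent x) , y<x , subst (_≽ X) (sym y≡) (≽-lefts (neighbours (exponent x) (ℤ.pred (↥ value x)))
      (subst (λ i → X ∈ lefts (fraction i (exponent x))) (sym (ℤ.suc-pred (↥ value x))) X∈))

-- Cooling

−1 : ℤ[½]
−1 = fromℤ -1ℤ

opaque
  unfolding cooling

  -- The regularity of the stops in t is read off from the walls of the constructed thermographs.
  -- The right wall is stored as minus `ρₜ`, so its monotonicity is reversed.
  λ-antitone : ∀ G {s t} → s ≤ t → λₜ t G ≤ λₜ s G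
  λ-antitone G {s} {t} = Wall.mono (wall-λ (build G)) {s} {t}

  λ-lipschitz : ∀ G {s t} → s ≤ t → value (λₜ s G) ℚ.≤ value (λₜ t G) ℚ.+ (value t ℚ.- value s)
  λ-lipschitz G {s} {t} = Wall.lipschitz (wall-λ (build G)) {s} {t}

  ρ-monotone : ∀ G {s t} → s ≤ t → ρₜ s G ≤ ρₜ t G
  ρ-monotone G {s} {t} s≤t = ℚ.neg-antimono-≤ (Wall.mono (wall-ν (build G)) {s} {t} s≤t)

  ρ-lipschitz : ∀ G {s t} → s ≤ t → value (ρₜ t G) ℚ.≤ value (ρₜ s G) ℚ.+ (value t ℚ.- value s)
  ρ-lipschitz G {s} {t} s≤t = lin≤ (Wall.lipschitz (wall-ν (build G)) {s} {t} s≤t)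
    (solve 4 (λ x y s t → :- x :+ (t :- s) :- :- y := y :+ (t :- s) :- x) refl
      (value (Thermograph.ν (build G) s)) (value (Thermograph.ν (build G) t)) (value s) (value t))

  λ-at-minus-one : ∀ G → λₜ −1 G ≡ fromℤ (ceiling G)
  λ-at-minus-one G = λ-at-−1 (build G)

  ρ-at-minus-one : ∀ G → ρₜ −1 G ≡ fromℤ (floor G)
  ρ-at-minus-one G = trans (cong -_ (ν-at-−1 (build G))) (value-injective { - fromℤ (ℤ.- floor G)} {fromℤ (floor G)}
    (trans (sym (ι-neg (ℤ.- floor G))) (cong ι (ℤ.neg-involutive (floor G)))))

≤-cases : ∀ {s t} → s ≤ t → s < t ⊎ s ≡ t
≤-cases {s} {t} s≤t with value s ℚ.<? value t
... | yes s<t = inj₁ s<t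
... | no  s≮t = inj₂ (value-injective {s} {t} (ℚ.≤-antisym s≤t (ℚ.≮⇒≥ s≮t)))

module _ {G T} (eq : temperature G ≡ [ T ]) where

  λ-frozen : ∀ {t} → T ≤ t → λₜ t G ≡ λₜ T G
  λ-frozen {t} T≤t with ≤-cases {T} {t} T≤t
  ... | inj₁ T<t  = λ-above {t = t} eq T<t
  ... | inj₂ refl = refl

  ρ-frozen : ∀ {t} → T ≤ t → ρₜ t G ≡ ρₜ T G
  ρ-frozen {t} T≤t with ≤-cases {T} {t} T≤t
  ... | inj₁ T<t  = ρ-above {t = t} eq T<t
  ... | inj₂ refl = refl

-- Unfrozen and frozen games.

data Kind (G : Game) : Set where
  whole : ∀ n → G ≈ᴳ integer n → Kind G
  hot   : ∀ T → temperature G ≡ [ T ] → λₜ T G ≡ ρₜ T G → −1 < T → Kind G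

-- A temperature at most -1 would make both stops at -1 equal to the common frozen value. These
-- stops are the ceiling and the floor, so the game would be an integer.
kind : ∀ G → Kind G
kind G with integer? G
... | yes (n , G≈n) = whole n G≈n
... | no  ¬int with temperature-least {G} ¬int
... | T , eq , (x , l , r) , _ = hot T eq λ≡ρ (ℚ.≰⇒> λ T≤−1 → ¬int (floor G
    , Rounding.floor⁺ (rounding G)
    , subst (λ n → integer n ≥ᴳ G) (ceiling≡floor T≤−1) (Rounding.ceiling⁺ (rounding G))))
  where
  λ≡ρ : λₜ T G ≡ ρₜ T G
  λ≡ρ = trans (max-unique G (λ-below {t = T} eq ℚ.≤-refl) l) (min-unique G r (ρ-below {t = T} eq ℚ.≤-refl))

  ceiling≡floor : T ≤ −1 → ceiling G ≡ floor G
  -- An integer is recovered as the numerator of its value.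
  ceiling≡floor T≤−1 = cong (λ z → ↥ value z) (trans (sym (λ-at-minus-one G)) (trans (λ-frozen eq {−1} T≤−1)
    (trans λ≡ρ (trans (sym (ρ-frozen eq {−1} T≤−1)) (ρ-at-minus-one G)))))

-- The stops meet at the temperature and stay constant above it; going down in t the left stop can
-- only grow and the right stop only shrink.
ρ≤λ : ∀ t G → ρₜ t G ≤ λₜ t G
ρ≤λ t G with kind G
... | whole n G≈n = ℚ.≤-reflexive (cong value (trans (ρ-integer {G} {n} G≈n t) (sym (λ-integer {G} {n} G≈n t))))
... | hot T eq λ≡ρ _ with ℚ.≤-total (value t) (value T)
... | inj₁ t≤T = ℚ.≤-trans (ρ-monotone G {t} {T} t≤T) (ℚ.≤-trans (ℚ.≤-reflexive (cong value (sym λ≡ρ))) (λ-antitone G {t} {T} t≤T))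
... | inj₂ T≤t = ℚ.≤-reflexive (cong value (trans (ρ-frozen eq {t} T≤t) (trans (sym λ≡ρ) (sym (λ-frozen eq {t} T≤t)))))

record Active (t : ℤ[½]) (G : Game) : Set where
  constructor active
  field
    {T}  : ℤ[½]
    temp : temperature G ≡ [ T ]
    t≤T  : t ≤ T

-- An integer counts as frozen since -1: at t = -1 the stops of any game are
-- its ceiling and its floor, so the options of an integer n satisfy the same
-- bounds there as the options of other games at the temperature.
record Frozen (t : ℤ[½]) (G : Game) : Set where
  field
    since    : ℤ[½]
    since<t  : since < t
    origin   : IsInteger G × since ≡ −1 ⊎ temperature G ≡ [ since ] × −1 < since
    x        : ℤ[½]
    cooled≡  : cooled t G ≡ ⌜ x ⌝
    λ≡       : ∀ {u} → since ≤ u → λₜ u G ≡ x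
    ρ≡       : ∀ {u} → since ≤ u → ρₜ u G ≡ x
    ≥-lefts  : ∀ {X} → X ∈ lefts G → ρₜ since X - since ≤ x
    ≤-rights : ∀ {X} → X ∈ rights G → x ≤ λₜ since X + since

status : ∀ {t} → −1 < t → ∀ G → Active t G ⊎ Frozen t G
status {t} −1<t G with kind G
... | hot T eq λ≡ρ −1<T = case value t ℚ.≤? value T of λ
  { (yes t≤T) → inj₁ (active eq t≤T)
  ; (no  t≰T) → inj₂ record
    { since    = T
    ; since<t  = ℚ.≰⇒> t≰T
    ; origin   = inj₂ (eq , −1<T)
    ; x        = λₜ T G
    ; cooled≡  = cooled-above {t = t} eq (ℚ.≰⇒> t≰T)
    ; λ≡       = λ {u} T≤u → λ-frozen eq {u} T≤u
    ; ρ≡       = λ {u} T≤u → trans (ρ-frozen eq {u} T≤u) (sym λ≡ρ)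
    ; ≥-lefts  = proj₂ (λ-below {t = T} eq ℚ.≤-refl)
    ; ≤-rights = λ {X} X∈ → subst (_≤ λₜ T X + T) (sym λ≡ρ) (proj₂ (ρ-below {t = T} eq ℚ.≤-refl) X∈)
    } }
... | whole n G≈n@(G≥n , n≥G) = inj₂ record
  { since    = −1
  ; since<t  = −1<t
  ; origin   = inj₁ ((n , G≈n) , refl)
  ; x        = fromℤ n
  ; cooled≡  = cooled-integer {G} {n} G≈n t
  ; λ≡       = λ {u} _ → λ-integer {G} {n} G≈n u
  ; ρ≡       = λ {u} _ → ρ-integer {G} {n} G≈n u
  -- Since `integer n ⊳ X`, even `floor X + 1` is at most `n`, and subtracting -1 supplies exactly
  -- this unit.
  ; ≥-lefts  = λ {X} X∈ → subst (λ z → z - −1 ≤ fromℤ n) (sym (ρ-at-minus-one X))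
      (subst (ℚ._≤ ι n) (trans (ι-+ (+ 1) (floor X)) (ℚ.+-comm 1ℚ (ι (floor X))))
        (ι-≤ (⊳-floor {X} {n} (GameOrder.≥-left {integer n} {G} n≥G X∈))))
  ; ≤-rights = λ {X} X∈ → subst (λ z → fromℤ n ≤ z + −1) (sym (λ-at-minus-one X))
      (lin≤ (subst (ℚ._≤ ι (ceiling X)) (ι-+ (+ 1) n) (ι-≤ (⊳-ceiling {X} {n} (GameOrder.≥-right {G} {integer n} G≥n X∈))))
        (solve 2 (λ c n → c :+ con (ι -1ℤ) :- n := c :- (con 1ℚ :+ n)) refl (ι (ceiling X)) (ι n)))
  }

opaque

  midpoint : ∀ {x y} → x < y → ∃ λ c → x < c × c < y
  midpoint {x} {y} x<y = c
    , subst (ℚ._< value c) (halves (value x)) (ℚ.*-monoʳ-<-pos ½ (ℚ.+-monoʳ-< (value x) x<y))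
    , subst (value c ℚ.<_) (halves (value y)) (ℚ.*-monoʳ-<-pos ½ (ℚ.+-monoˡ-< (value y) x<y))
    where
    c : ℤ[½]
    c = ½ᴰ * (x + y)

    halves : ∀ p → ½ ℚ.* (p ℚ.+ p) ≡ p
    halves p = trans (ℚ.*-distribˡ-+ ½ p p) (trans (sym (ℚ.*-distribʳ-+ p ½ ½)) (ℚ.*-identityˡ p))

  -- Stepping back in time by the distance of two numbers: over that span a stop with Lipschitz
  -- constant 1 changes by at most `y - x`.
  earlier : ∀ t {x y} → x < y → ∃ λ s → s < t × value t ℚ.- value s ≡ value y ℚ.- value x
  earlier t {x} {y} x<y = s , lin< x<y t-s , t-s
    where
    s : ℤ[½]
    s = t - (y - x)

    t-s : value t ℚ.- value s ≡ value y ℚ.- value x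
    t-s = solve 3 (λ t x y → t :- (t :- (y :- x)) := y :- x) refl (value t) (value x) (value y)

shift-- : ∀ {x y t u} l → t ℚ.- u ≡ y ℚ.- x → y ℚ.- t ℚ.- l ≡ x ℚ.- (l ℚ.+ u)
shift-- {x} {y} {t} {u} l eq = begin
  y ℚ.- t ℚ.- l                       ≡⟨ solve 4 (λ x y t l → y :- t :- l := y :- x :+ x :- t :- l) refl x y t l ⟩
  y ℚ.- x ℚ.+ x ℚ.- t ℚ.- l           ≡⟨ cong (λ d → d ℚ.+ x ℚ.- t ℚ.- l) eq ⟨
  t ℚ.- u ℚ.+ x ℚ.- t ℚ.- l           ≡⟨ solve 4 (λ x t u l → t :- u :+ x :- t :- l := x :- (l :+ u)) refl x t u l ⟩
  x ℚ.- (l ℚ.+ u)                     ∎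
  where open ≡-Reasoning

shift-+ : ∀ {x y t u} r → t ℚ.- u ≡ y ℚ.- x → r ℚ.- (x ℚ.+ t) ≡ r ℚ.- u ℚ.- y
shift-+ {x} {y} {t} {u} r eq = begin
  r ℚ.- (x ℚ.+ t)                     ≡⟨ solve 4 (λ x t u r → r :- (x :+ t) := r :- u :- x :- (t :- u)) refl x t u r ⟩
  r ℚ.- u ℚ.- x ℚ.- (t ℚ.- u)         ≡⟨ cong (λ d → r ℚ.- u ℚ.- x ℚ.- d) eq ⟩
  r ℚ.- u ℚ.- x ℚ.- (y ℚ.- x)         ≡⟨ solve 4 (λ x y u r → r :- u :- x :- (y :- x) := r :- u :- y) refl x y u r ⟩
  r ℚ.- u ℚ.- y                       ∎
  where open ≡-Reasoning

+-- : ∀ a b → a ℚ.+ (b ℚ.- a) ≡ b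
+-- = solve 2 (λ a b → a :+ (b :- a) := b) refl

swap-- : ∀ a b c → a ℚ.- c ≡ a ℚ.+ (b ℚ.- c) ℚ.- b
swap-- = solve 3 (λ a b c → a :- c := a :+ (b :- c) :- b) refl

⌜⌝--+ : ∀ x y → ⌜ x - y ⌝ +ᴳ ⌜ y ⌝ ≃ ⌜ x ⌝
⌜⌝--+ x y = ≽-trans (+-monoˡ ⌜ y ⌝ (proj₂ (⌜⌝-- x y))) (-+-≽ ⌜ x ⌝ ⌜ y ⌝)
          , ≽-trans (≽--+ ⌜ x ⌝ ⌜ y ⌝) (+-monoˡ ⌜ y ⌝ (proj₁ (⌜⌝-- x y)))

-- Comparison of cooled games with numbers.

module Cooled {t : ℤ[½]} (−1<t : −1 < t) where

  module _ {G} (a : Active t G) where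

    private
      cooled≡ : cooled t G ≡ pre-cooled t G
      cooled≡ = cooled-below {t = t} (Active.temp a) (Active.t≤T a)

    cooled-left : ∀ {X} → X ∈ lefts G → cooled t X -ᴳ ⌜ t ⌝ ∈ lefts (cooled t G)
    cooled-left X∈ = subst (λ K → _ ∈ lefts K) (sym cooled≡) (∈-map⁺ (λ X → cooled t X -ᴳ ⌜ t ⌝) X∈)

    cooled-right : ∀ {X} → X ∈ rights G → cooled t X +ᴳ ⌜ t ⌝ ∈ rights (cooled t G)
    cooled-right X∈ = subst (λ K → _ ∈ rights K) (sym cooled≡) (∈-map⁺ (λ X → cooled t X +ᴳ ⌜ t ⌝) X∈)

    all-cooled-lefts : (P : Game → Set) → (∀ {X} → X ∈ lefts G → P (cooled t X -ᴳ ⌜ t ⌝)) →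
                       ∀ {Z} → Z ∈ lefts (cooled t G) → P Z
    all-cooled-lefts P f {Z} Z∈ =
      case ∈-map⁻ (λ X → cooled t X -ᴳ ⌜ t ⌝) (subst (λ K → Z ∈ lefts K) cooled≡ Z∈) of λ
        { (X , X∈ , refl) → f X∈ }

    all-cooled-rights : (P : Game → Set) → (∀ {X} → X ∈ rights G → P (cooled t X +ᴳ ⌜ t ⌝)) →
                        ∀ {Z} → Z ∈ rights (cooled t G) → P Z
    all-cooled-rights P f {Z} Z∈ =
      case ∈-map⁻ (λ X → cooled t X +ᴳ ⌜ t ⌝) (subst (λ K → Z ∈ rights K) cooled≡ Z∈) of λ
        { (X , X∈ , refl) → f X∈ }

    module _ {u} (u≤t : u ≤ t) where
      private
        u≤T : u ≤ Active.T a
        u≤T = ℚ.≤-trans u≤t (Active.t≤T a)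

      is-λ : Isλ̃ u G (λₜ u G)
      is-λ = λ-below {t = u} (Active.temp a) u≤T

      is-ρ : Isρ̃ u G (ρₜ u G)
      is-ρ = ρ-below {t = u} (Active.temp a) u≤T

  module _ {G} (f : Frozen t G) where
    open Frozen f

    -- By the Lipschitz bound, `ρₜ s G - s` does not increase with `s`, and after `since` it
    -- decreases strictly because the stop is constant there.
    frozen-ρ-slope : ∀ {s} → s < t → x - t < ρₜ s G - s
    frozen-ρ-slope {s} s<t with ℚ.≤-total (value since) (value s)
    ... | inj₁ since≤s = subst (λ y → x - t < y - s) (sym (ρ≡ since≤s)) (ℚ.+-monoʳ-< (value x) (ℚ.neg-antimono-< s<t))
    ... | inj₂ s≤since = lin< (ℚ.+-mono-<-≤ since<t
        (subst (λ y → value y ℚ.≤ value (ρₜ s G) ℚ.+ (value since ℚ.- value s)) (ρ≡ ℚ.≤-refl) (ρ-lipschitz G {s} {since} s≤since)))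
      (solve 5 (λ x t r s e → r :- s :- (x :- t) := t :+ (r :+ (e :- s)) :- (e :+ x)) refl
        (value x) (value t) (value (ρₜ s G)) (value s) (value since))

    frozen-λ-slope : ∀ {s} → s < t → λₜ s G + s < x + t
    frozen-λ-slope {s} s<t with ℚ.≤-total (value since) (value s)
    ... | inj₁ since≤s = subst (λ y → y + s < x + t) (sym (λ≡ since≤s)) (ℚ.+-monoʳ-< (value x) s<t)
    ... | inj₂ s≤since = lin< (ℚ.+-mono-<-≤ since<t
        (subst (λ y → value (λₜ s G) ℚ.≤ value y ℚ.+ (value since ℚ.- value s)) (λ≡ ℚ.≤-refl) (λ-lipschitz G {s} {since} s≤since)))
      (solve 5 (λ x t l s e → x :+ t :- (l :+ s) := t :+ (x :+ (e :- s)) :- (e :+ l)) refl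
        (value x) (value t) (value (λₜ s G)) (value s) (value since))

  -- The time `s` and the number `x` are quantified inside, because the induction applies the
  -- hypothesis for an option at another time and another number.
  BoundedAbove BoundedBelow : Game → Set
  BoundedAbove G = ∀ {s x} → s < t → (λₜ s G ≤ x → ⌜ x ⌝ ≽ cooled t G) ×
                                     (ρₜ s G - s ≤ x → ⌜ x ⌝ ▷ cooled t G -ᴳ ⌜ t ⌝)
  BoundedBelow G = ∀ {s x} → s < t → (x ≤ ρₜ s G → cooled t G ≽ ⌜ x ⌝) ×
                                     (x ≤ λₜ s G + s → cooled t G +ᴳ ⌜ t ⌝ ▷ ⌜ x ⌝)

  bounded-above : ∀ G → BoundedAbove G
  bounded-above = induction BoundedAbove λ G ih {s} {x} s<t → case status −1<t G of λ
    { (inj₁ a) → above-active G ih a {s} {x} s<t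
    ; (inj₂ f) → above-frozen G f {s} {x} s<t }
    where
    above-frozen : ∀ G → Frozen t G → BoundedAbove G
    above-frozen G f {s} {y} s<t =
        (λ λ≤ → subst (⌜ y ⌝ ≽_) (sym cooled≡) (⌜⌝-mono {x} {y}
          (subst (_≤ y) (λ≡ (ℚ.<⇒≤ since<t)) (ℚ.≤-trans (λ-antitone G {s} {t} (ℚ.<⇒≤ s<t)) λ≤))))
      , (λ ρ≤ → subst (λ K → ⌜ y ⌝ ▷ K -ᴳ ⌜ t ⌝) (sym cooled≡) (▷-≽-trans
          (⌜⌝-mono-▷ {x - t} {y} (ℚ.<-≤-trans (frozen-ρ-slope f {s} s<t) ρ≤)) (proj₂ (⌜⌝-- x t))))
      where open Frozen f

    above-active : ∀ G → (∀ {X} → X ≺ G → BoundedAbove X) → Active t G → BoundedAbove G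
    above-active G ih a {s} {x} s<t = first , second
      where
      s≤t : s ≤ t
      s≤t = ℚ.<⇒≤ s<t

      first : λₜ s G ≤ x → ⌜ x ⌝ ≽ cooled t G
      first λ≤ = ≽-intro right (all-cooled-lefts a (⌜ x ⌝ ▷_) λ {X} X∈ →
          proj₂ (ih (inj₁ X∈) {s} {x} s<t) (ℚ.≤-trans (proj₂ (is-λ a {s} s≤t) X∈) λ≤))
        where
        right : ∀ {Y} → Y ∈ rights ⌜ x ⌝ → Y ▷ cooled t G
        right Y∈ with ⌜⌝-rights x Y∈
        -- Left answers with the right option `Z` that attains the right stop at the earlier time
        -- `u`. From `λₜ u Z + u ≤ x` and the choice of `u` follows `λₜ u Z ≤ y - t`, so the
        -- hypothesis at `u` puts `Z` cooled by `t`, plus `t`, below `y`.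
        ... | y , x<y , Y≽ with earlier t {x} {y} x<y
        ... | u , u<t , t-u with is-ρ a {u} (ℚ.<⇒≤ u<t)
        ... | (Z , Z∈ , ρ≡) , _ = ▷-right (cooled-right a Z∈) (≽-trans Y≽ (≽-trans (proj₂ (⌜⌝--+ y t))
              (+-monoˡ ⌜ t ⌝ (proj₁ (ih (inj₂ Z∈) {u} {y - t} u<t) (lin≤ λu+u≤x eq)))))
          where
          λu+u≤x : λₜ u Z + u ≤ x
          λu+u≤x = subst (_≤ x) ρ≡ (ℚ.≤-trans (ρ-monotone G {u} {t} (ℚ.<⇒≤ u<t)) (ℚ.≤-trans (ρ≤λ t G)
            (ℚ.≤-trans (λ-antitone G {s} {t} s≤t) λ≤)))

          eq : value (y - t) ℚ.- value (λₜ u Z) ≡ value x ℚ.- (value (λₜ u Z) ℚ.+ value u)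
          eq = shift-- {value x} {value y} {value t} {value u} (value (λₜ u Z)) t-u

      second : ρₜ s G - s ≤ x → ⌜ x ⌝ ▷ cooled t G -ᴳ ⌜ t ⌝
      second ρ≤ with proj₁ (is-ρ a {s} s≤t)
      -- Here the time stays `s`: the option attaining the right stop has `λₜ s Z + s ≤ x + s`, and
      -- in the game its `+ t` cancels the `- t`.
      ... | Z , Z∈ , ρ≡ = ▷-right (right-+ˡ {cooled t G} { -ᴳ ⌜ t ⌝} (cooled-right a Z∈))
          (≽-trans (proj₁ (ih (inj₂ Z∈) {s} {x} s<t) λs≤) (≽-+- (cooled t Z) ⌜ t ⌝))
        where
        λs≤ : λₜ s Z ≤ x
        λs≤ = lin≤ (subst (λ z → z - s ≤ x) ρ≡ ρ≤)
          (solve 3 (λ l s x → x :- l := x :- (l :+ s :- s)) refl (value (λₜ s Z)) (value s) (value x))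

  -- The mirror image of `bounded-above`, with the players and the two stops exchanged.
  bounded-below : ∀ G → BoundedBelow G
  bounded-below = induction BoundedBelow λ G ih {s} {x} s<t → case status −1<t G of λ
    { (inj₁ a) → below-active G ih a {s} {x} s<t
    ; (inj₂ f) → below-frozen G f {s} {x} s<t }
    where
    below-frozen : ∀ G → Frozen t G → BoundedBelow G
    below-frozen G f {s} {y} s<t =
        (λ ≤ρ → subst (_≽ ⌜ y ⌝) (sym cooled≡) (⌜⌝-mono {y} {x}
          (subst (y ≤_) (ρ≡ (ℚ.<⇒≤ since<t)) (ℚ.≤-trans ≤ρ (ρ-monotone G {s} {t} (ℚ.<⇒≤ s<t))))))
      , (λ ≤λ → subst (λ K → K +ᴳ ⌜ t ⌝ ▷ ⌜ y ⌝) (sym cooled≡) (≽-▷-trans (proj₁ (⌜⌝-+ x t))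
          (⌜⌝-mono-▷ {y} {x + t} (ℚ.≤-<-trans ≤λ (frozen-λ-slope f {s} s<t)))))
      where open Frozen f

    below-active : ∀ G → (∀ {X} → X ≺ G → BoundedBelow X) → Active t G → BoundedBelow G
    below-active G ih a {s} {x} s<t = first , second
      where
      s≤t : s ≤ t
      s≤t = ℚ.<⇒≤ s<t

      first : x ≤ ρₜ s G → cooled t G ≽ ⌜ x ⌝
      first ≤ρ = ≽-intro (all-cooled-rights a (_▷ ⌜ x ⌝) λ {X} X∈ →
          proj₂ (ih (inj₂ X∈) {s} {x} s<t) (ℚ.≤-trans ≤ρ (proj₂ (is-ρ a {s} s≤t) X∈))) left
        where
        left : ∀ {Y} → Y ∈ lefts ⌜ x ⌝ → cooled t G ▷ Y
        left Y∈ with ⌜⌝-lefts x Y∈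
        ... | y , y<x , ≽Y with earlier t {y} {x} y<x
        ... | u , u<t , t-u with is-λ a {u} (ℚ.<⇒≤ u<t)
        ... | (Z , Z∈ , λ≡) , _ = ▷-left (cooled-left a Z∈) (≽-trans
              (+-monoˡ (-ᴳ ⌜ t ⌝) (≽-trans (proj₁ (ih (inj₁ Z∈) {u} {y + t} u<t) (lin≤ x≤ρu-u eq)) (proj₂ (⌜⌝-+ y t))))
              (≽-trans (+--≽ ⌜ y ⌝ ⌜ t ⌝) ≽Y))
          where
          x≤ρu-u : x ≤ ρₜ u Z - u
          x≤ρu-u = subst (x ≤_) λ≡ (ℚ.≤-trans ≤ρ (ℚ.≤-trans (ρ-monotone G {s} {t} s≤t) (ℚ.≤-trans (ρ≤λ t G)
            (λ-antitone G {u} {t} (ℚ.<⇒≤ u<t)))))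

          eq : value (ρₜ u Z) ℚ.- value (y + t) ≡ value (ρₜ u Z) ℚ.- value u ℚ.- value x
          eq = shift-+ {value y} {value x} {value t} {value u} (value (ρₜ u Z)) t-u

      second : x ≤ λₜ s G + s → cooled t G +ᴳ ⌜ t ⌝ ▷ ⌜ x ⌝
      second ≤λ with proj₁ (is-λ a {s} s≤t)
      ... | Z , Z∈ , λ≡ = ▷-left (left-+ˡ {cooled t G} {⌜ t ⌝} (cooled-left a Z∈))
          (≽-trans (-+-≽ (cooled t Z) ⌜ t ⌝) (proj₁ (ih (inj₁ Z∈) {s} {x} s<t) ≤ρs))
        where
        ≤ρs : x ≤ ρₜ s Z
        ≤ρs = lin≤ (subst (λ z → x ≤ z + s) λ≡ ≤λ)
          (solve 3 (λ r s x → r :- x := r :- s :+ s :- x) refl (value (ρₜ s Z)) (value s) (value x))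

  -- A strict inequality at `t` itself suffices: its slack pays for the growth of the left stop when
  -- going back to an earlier `s`, where `bounded-above` applies.
  λ<⇒≽ : ∀ G {x} → λₜ t G < x → ⌜ x ⌝ ≽ cooled t G
  λ<⇒≽ G {x} λ<x with earlier t {λₜ t G} {x} λ<x
  ... | s , s<t , t-s = proj₁ (bounded-above G {s} {x} s<t)
    (subst (value (λₜ s G) ℚ.≤_) (trans (cong (λ d → value (λₜ t G) ℚ.+ d) t-s) (+-- (value (λₜ t G)) (value x)))
      (λ-lipschitz G {s} {t} (ℚ.<⇒≤ s<t)))

  <ρ⇒≽ : ∀ G {x} → x < ρₜ t G → cooled t G ≽ ⌜ x ⌝
  <ρ⇒≽ G {x} x<ρ with earlier t {x} {ρₜ t G} x<ρ
  ... | s , s<t , t-s = proj₁ (bounded-below G {s} {x} s<t)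
    (lin≤ (subst (λ d → value (ρₜ t G) ℚ.≤ value (ρₜ s G) ℚ.+ d) t-s (ρ-lipschitz G {s} {t} (ℚ.<⇒≤ s<t)))
      (swap-- (value (ρₜ s G)) (value (ρₜ t G)) (value x)))

  cooled-▷-left : ∀ {G X} → X ∈ lefts G → cooled t G ▷ cooled t X -ᴳ ⌜ t ⌝
  cooled-▷-left {G} {X} X∈ with status −1<t G
  ... | inj₁ a = ▷-left (cooled-left a X∈) ≽-refl
  ... | inj₂ f = subst (_▷ cooled t X -ᴳ ⌜ t ⌝) (sym cooled≡) (proj₂ (bounded-above X {since} {x} since<t) (≥-lefts X∈))
    where open Frozen f

  right-▷-cooled : ∀ {H Y} → Y ∈ rights H → cooled t Y ▷ cooled t H -ᴳ ⌜ t ⌝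
  right-▷-cooled {H} {Y} Y∈ with status −1<t H
  ... | inj₁ a = ▷-right (right-+ˡ {cooled t H} { -ᴳ ⌜ t ⌝} (cooled-right a Y∈)) (≽-+- (cooled t Y) ⌜ t ⌝)
  -- `bounded-below` speaks of `cooled t Y +ᴳ ⌜ t ⌝`, so both sides are shifted back by `t`.
  ... | inj₂ f = ≽-▷-trans (≽-+- (cooled t Y) ⌜ t ⌝) (subst (λ K → cooled t Y +ᴳ ⌜ t ⌝ -ᴳ ⌜ t ⌝ ▷ K -ᴳ ⌜ t ⌝) (sym cooled≡)
      (+-monoˡ-▷ (-ᴳ ⌜ t ⌝) (proj₂ (bounded-below Y {since} {x} since<t) (≤-rights Y∈))))
    where open Frozen f

  -- Otherwise some number `c` lies strictly between the two sides. Then `cooled t H` is at least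
  -- `c + t` and `cooled t G` at most `c`, which contradicts the assumption.
  stops-▷ : ∀ G H → cooled t G ▷ cooled t H -ᴳ ⌜ t ⌝ → ρₜ t H - t ≤ λₜ t G
  stops-▷ G H G▷H = ℚ.≮⇒≥ λ λ<ρ → case midpoint {λₜ t G} {ρₜ t H - t} λ<ρ of λ
    { (c , λ<c , c<ρ) → ▷⇒⋠ G▷H (≽-trans
        (+-monoˡ (-ᴳ ⌜ t ⌝) (≽-trans
          (<ρ⇒≽ H {c + t} (lin< c<ρ (solve 3 (λ r c t → r :- (c :+ t) := r :- t :- c) refl (value (ρₜ t H)) (value c) (value t))))
          (proj₂ (⌜⌝-+ c t))))
        (≽-trans (+--≽ ⌜ c ⌝ ⌜ t ⌝) (λ<⇒≽ G {c} λ<c))) }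

-- The simultaneous induction on both games.

CoolingPreservesOrder : Game → Game → Set
CoolingPreservesOrder G H = ∀ t → −1 < t → (G ≽ H → cooled t G ≽ cooled t H) × (G ▷ H → cooled t G ▷ cooled t H -ᴳ ⌜ t ⌝)

module _ G H (ihᴳ : ∀ {X} → X ≺ G → CoolingPreservesOrder X H) (ihᴴ : ∀ {Y} → Y ≺ H → CoolingPreservesOrder G Y) where

  -- The left stop of an unfrozen `H` is `ρₜ t Y - t` for some left option `Y`. Since `G ▷ Y`, part
  -- 2 for `G` and `Y` allows `stops-▷` to bound it by the left stop of `G`.
  λ-mono : ∀ {t} → −1 < t → Active t H → G ≽ H → λₜ t H ≤ λₜ t G
  λ-mono {t} −1<t a G≽H = let (Y , Y∈ , λ≡) , _ = Cooled.is-λ −1<t a {t} ℚ.≤-refl in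
    subst (_≤ λₜ t G) (sym λ≡) (Cooled.stops-▷ −1<t G Y (proj₂ (ihᴴ (inj₁ Y∈) t −1<t) (≽-left G≽H Y∈)))

  ρ-mono : ∀ {t} → −1 < t → Active t G → G ≽ H → ρₜ t H ≤ ρₜ t G
  ρ-mono {t} −1<t a G≽H = let (X , X∈ , ρ≡) , _ = Cooled.is-ρ −1<t a {t} ℚ.≤-refl in
    subst (ρₜ t H ≤_) (sym ρ≡) (lin≤ (Cooled.stops-▷ −1<t X H (proj₂ (ihᴳ (inj₂ X∈) t −1<t) (≽-right G≽H X∈)))
      (solve 3 (λ l t r → l :+ t :- r := l :- (r :- t)) refl (value (λₜ t X)) (value t) (value (ρₜ t H))))

  -- At the later of the two freezing times both stops already have their final values, and the game
  -- freezing then is still unfrozen, so `λ-mono` or `ρ-mono` applies. This uses the induction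
  -- hypotheses at a time before `t`.
  frozen-mono : ∀ {t} (f : Frozen t G) (g : Frozen t H) → G ≽ H → Frozen.x g ≤ Frozen.x f
  frozen-mono {t} f g G≽H = compare F.origin E.origin (ℚ.≤-total (value F.since) (value E.since))
    where
    module F = Frozen f
    module E = Frozen g

    integers : IsInteger G → IsInteger H → E.x ≤ F.x
    integers (n , G≈n) (m , H≈m) = subst₂ _≤_
      (trans (sym (λ-integer {H} {m} H≈m t)) (E.λ≡ (ℚ.<⇒≤ E.since<t)))
      (trans (sym (λ-integer {G} {n} G≈n t)) (F.λ≡ (ℚ.<⇒≤ F.since<t)))
      (ι-≤ (integer-cancel {m} {n} (unwrap (≽-trans (wrap (proj₂ G≈n)) (≽-trans G≽H (wrap (proj₁ H≈m)))))))

    compare : IsInteger G × F.since ≡ −1 ⊎ temperature G ≡ [ F.since ] × −1 < F.since →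
              IsInteger H × E.since ≡ −1 ⊎ temperature H ≡ [ E.since ] × −1 < E.since →
              F.since ≤ E.since ⊎ E.since ≤ F.since → E.x ≤ F.x
    compare _ (inj₂ (eq , −1<)) (inj₁ ≤) = subst₂ _≤_ (E.λ≡ ℚ.≤-refl) (F.λ≡ ≤)
      (λ-mono {E.since} −1< (active eq ℚ.≤-refl) G≽H)
    compare (inj₂ (eq , −1<)) _ (inj₂ ≥) = subst₂ _≤_ (E.ρ≡ ≥) (F.ρ≡ ℚ.≤-refl)
      (ρ-mono {F.since} −1< (active eq ℚ.≤-refl) G≽H)
    compare (inj₁ (intᴳ , _)) (inj₁ (intᴴ , _)) _ = integers intᴳ intᴴ
    -- A non-integer freezes strictly after -1, hence never before or together with an integer.
    compare (inj₂ (_ , −1<)) (inj₁ (_ , eq)) (inj₁ ≤) = contradiction (subst (F.since ≤_) eq ≤) (ℚ<⇒≱ −1<)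
    compare (inj₁ (_ , eq)) (inj₂ (_ , −1<)) (inj₂ ≥) = contradiction (subst (E.since ≤_) eq ≥) (ℚ<⇒≱ −1<)

  cooled-≽ : ∀ {t} → −1 < t → G ≽ H → cooled t G ≽ cooled t H
  cooled-≽ {t} −1<t G≽H = compare (status −1<t G) (status −1<t H)
    where
    open Cooled −1<t

    -- Adding `t` to part 2 for a right option of `G` and for `H` cancels the `- t` on the side of
    -- `H`.
    rights-▷ : Active t G → ∀ {X} → X ∈ rights (cooled t G) → X ▷ cooled t H
    rights-▷ a = all-cooled-rights a (_▷ cooled t H) λ X∈ → ▷-≽-trans
      (+-monoˡ-▷ ⌜ t ⌝ (proj₂ (ihᴳ (inj₂ X∈) t −1<t) (≽-right G≽H X∈))) (-+-≽ (cooled t H) ⌜ t ⌝)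

    ▷-lefts : Active t H → ∀ {Y} → Y ∈ lefts (cooled t H) → cooled t G ▷ Y
    ▷-lefts a = all-cooled-lefts a (cooled t G ▷_) λ Y∈ → proj₂ (ihᴴ (inj₁ Y∈) t −1<t) (≽-left G≽H Y∈)

    compare : Active t G ⊎ Frozen t G → Active t H ⊎ Frozen t H → cooled t G ≽ cooled t H
    compare (inj₁ a) (inj₁ b) = ≽-intro (rights-▷ a) (▷-lefts b)
    compare (inj₂ f) (inj₂ g) = subst₂ _≽_ (sym (Frozen.cooled≡ f)) (sym (Frozen.cooled≡ g))
      (⌜⌝-mono {Frozen.x g} {Frozen.x f} (frozen-mono f g G≽H))
    -- The left stop of `H` is at most `x`, so a number `c` strictly between `x` and `y` is at least
    -- `cooled t H`. The remaining gap from `c` to `y` makes the comparison with the right option of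
    -- `⌜ x ⌝` strict enough for `▷`.
    compare (inj₂ f) (inj₁ b) = ≽-intro
      (λ {Y} Y∈ → case ⌜⌝-rights x (subst (λ K → Y ∈ rights K) cooled≡ Y∈) of λ
        { (y , x<y , Y≽y) → case midpoint {x} {y} x<y of λ
          { (c , x<c , c<y) → ≽-▷-trans Y≽y (▷-≽-trans (⌜⌝-mono-▷ {c} {y} c<y)
              (λ<⇒≽ H {c} (ℚ.≤-<-trans (subst (λₜ t H ≤_) (λ≡ (ℚ.<⇒≤ since<t)) (λ-mono −1<t b G≽H)) x<c))) } })
      (▷-lefts b)
      where open Frozen f
    compare (inj₁ a) (inj₂ g) = ≽-intro (rights-▷ a)
      (λ {X} X∈ → case ⌜⌝-lefts x (subst (λ K → X ∈ lefts K) cooled≡ X∈) of λ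
        { (y , y<x , y≽X) → case midpoint {y} {x} y<x of λ
          { (c , y<c , c<x) → ▷-≽-trans (≽-▷-trans
              (<ρ⇒≽ G {c} (ℚ.<-≤-trans c<x (subst (_≤ ρₜ t G) (ρ≡ (ℚ.<⇒≤ since<t)) (ρ-mono −1<t a G≽H))))
              (⌜⌝-mono-▷ {y} {c} y<c)) y≽X } })
      where open Frozen g

  cooled-▷ : ∀ {t} → −1 < t → G ▷ H → cooled t G ▷ cooled t H -ᴳ ⌜ t ⌝
  cooled-▷ {t} −1<t G▷H = case ▷-view G▷H of λ
    { (inj₁ (X , X∈ , X≽H)) → ▷-≽-trans (cooled-▷-left X∈) (+-monoˡ (-ᴳ ⌜ t ⌝) (proj₁ (ihᴳ (inj₁ X∈) t −1<t) X≽H))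
    ; (inj₂ (Y , Y∈ , G≽Y)) → ≽-▷-trans (proj₁ (ihᴴ (inj₂ Y∈) t −1<t) G≽Y) (right-▷-cooled Y∈) }
    where open Cooled −1<t

cooled-order : ∀ G H → CoolingPreservesOrder G H
cooled-order = induction (λ G → ∀ H → CoolingPreservesOrder G H) λ G ihG → induction (CoolingPreservesOrder G) λ H ihH t −1<t →
  cooled-≽ G H (λ X≺ → ihG X≺ H) ihH −1<t , cooled-▷ G H (λ X≺ → ihG X≺ H) ihH −1<t

theorem11 : ∀ (t : ℤ[½]) → fromℤ -1ℤ < t → ∀ (G H : Game) →
    (G ≥ᴳ H → cooled t G ≥ᴳ cooled t H) ×
    (G ⊳ H → cooled t G ⊳ (cooled t H -ᴳ ⌜ t ⌝))
theorem11 t −1<t G H =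
    (λ G≥H → unwrap (proj₁ (cooled-order G H t −1<t) (wrap G≥H)))
  , (λ G⊳H → unwrap (proj₂ (cooled-order G H t −1<t) (wrap G⊳H)))
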